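{- Let $C_i$ be a sequence of self-dual binary codes with length $n(C_i)\to\infty$. Then \[ \limsup_{i\to\infty}\frac{d(C_i)}{n(C_i)}\le\frac{1-5^{ -1/4}}{2}. \]
   Context: A binary linear code is self-dual if it equals its dual with respect to the standard inner product over $\mathbb{F}_2$; $d(C)$ is its minimum Hamming distance and $n(C)$ its length. -}

module Defs where

open import Data.Bool using (Bool; true; false; _∧_; _xor_)
open import Data.Nat using (ℕ; zero; suc; _+_; _*_; _∸_; _^_; _≤_; _<_)
open import Data.Vec using (Vec; []; _∷_; replicate)
open import Data.Product using (Σ; _×_; ∃)
open import Data.Sum using (_⊎_)
open import Relation.Binary.PropositionalEquality using (_≡_)
open import Relation.Nullary using (¬_)

-- Words of length n over F₂ = Bool (false = 0, true = 1, xor = addition).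
Word : ℕ → Set
Word n = Vec Bool n

inner : ∀ {n} → Word n → Word n → Bool
inner []       []       = false
inner (x ∷ xs) (y ∷ ys) = (x ∧ y) xor inner xs ys

weight : ∀ {n} → Word n → ℕ
weight []           = 0
weight (true  ∷ xs) = suc (weight xs)
weight (false ∷ xs) = weight xs

Code : ℕ → Set₁
Code n = Word n → Set

_⊕_ : ∀ {n} → Word n → Word n → Word n
[] ⊕ [] = []
(x ∷ xs) ⊕ (y ∷ ys) = (x xor y) ∷ (xs ⊕ ys)

IsLinear : ∀ {n} → Code n → Set
IsLinear {n} C = C (replicate n false) × (∀ x y → C x → C y → C (x ⊕ y))

IsSelfDual : ∀ {n} → Code n → Set
IsSelfDual {n} C =
  IsLinear C ×
  (∀ (x : Word n) → (C x → ∀ y → C y → inner x y ≡ false)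
                  × ((∀ y → C y → inner x y ≡ false) → C x))

IsMinDist : ∀ {n} → Code n → ℕ → Set
IsMinDist {n} C d =
  (Σ (Word n) λ x → C x × ¬ (x ≡ replicate n false) × weight x ≡ d)
  × (∀ x → C x → ¬ (x ≡ replicate n false) → d ≤ weight x)

-- The rational a / b (b > 0) is strictly larger than (1 - 5^(-1/4)) / 2.
-- Equivalently 1 - 2a/b < 5^(-1/4), i.e. either 1 - 2a/b ≤ 0,
-- or 5 (b - 2a)^4 < b^4.
AboveBound : ℕ → ℕ → Set
AboveBound a b = (b ≤ 2 * a) ⊎ (5 * (b ∸ 2 * a) ^ 4 < b ^ 4)

{-# OPTIONS --safe #-}
module Submission where

-- Let W(y) = Σ A_w y^w be the weight enumerator of a self-dual code C of length n = 2N. Summing over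
-- the shadow of C, whose weights are ≡ N mod 4, W is proportional to Σ_v (1 + iy)^(n-|v|) (1 - iy)^|v|,
-- so a Chebyshev expansion gives
--   W = Σ_k (-1)^k s_k J^(-k) (1 + y²)^N,  s_k ≥ 0,  J = (1 + y²)⁴ / (y² (1 - y²)²).
-- For even m and c > 0 the residue at y = 0 of W (1 + y²)^(-N) (J - c) J^(m-1) dJ, which by Lagrange
-- inversion only sees s_m and s_(m+1), therefore has a sign: Σ_k A_2k g_(m+1-k) ≤ 0. Here g_s is the
-- coefficient of Z^s in F(Z) (1 - Z)^(-Q) (1 + Z)^(-q), with F a polynomial of degree 6, Q = 2m + 3 and
-- q = N + 1 - 4m. Take m ≈ N/6 so that K = Q - q is a large constant. The coefficients b_s of
-- (1 - Z)^(-Q) (1 + Z)^(-q) satisfy a three term recurrence, from which the ratios r_s = b_(s-1) / b_s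
-- change by at most 1/K from one s to the next and r_s² is close to s / (2Q + s), so that g_s is close
-- to b_s F(r_s). Let c be the value of J at a rational y = t slightly above 5^(-1/4). Then F is positive
-- at 5^(-1/2), which is the limit of r_(m+1) and thus gives the sign of the term k = 0, and on the
-- interval [0, ((1 - t) / (1 + t))²), which contains r_(m+1-k) for all 2k ≥ d as soon as d/n exceeds
-- the bound. All these terms being positive is a contradiction.

open import Defs
import Algebra.Properties.CommutativeSemiring.Exp
import Algebra.Properties.Semiring.Exp
import Algebra.Solver.Ring
open import Algebra.Bundles using (CommutativeRing)
open import Algebra.Solver.Ring.AlmostCommutativeRing using (fromCommutativeRing; _-Raw-AlmostCommutative⟶_; Induced-equivalence)
open import Data.Bool.Base using (Bool; true; false; _∧_; _xor_)
open import Data.Bool.Properties using (∧-comm; xor-same) renaming (_≟_ to _≟ᵇ_)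
open import Data.Empty using (⊥; ⊥-elim)
open import Data.Fin.Base using (Fin; toℕ)
open import Data.Fin.Properties using (all?) renaming (_≟_ to _≟ᶠ_)
open import Data.Integer.Base as ℤ using (ℤ; +_; -[1+_]; 0ℤ; 1ℤ; -1ℤ; +≤+)
import Data.Integer.Properties as ℤₚ
open import Data.Integer.Tactic.RingSolver using (solve-∀)
open import Data.Maybe.Base using (just; nothing)
open import Data.Nat.Base as ℕ using (ℕ; zero; suc)
open import Data.Nat.DivMod using (_divMod_; result; _/_; _%_; m%n<n; m≡m%n+[m/n]*n)
import Data.Nat.Properties as ℕₚ
open import Data.Nat.Tactic.RingSolver using () renaming (solve-∀ to ℕ-solve-∀)
open import Data.Product using (∃; _×_; _,_; proj₁; proj₂)
open import Data.Sum.Base using (_⊎_; inj₁; inj₂; [_,_]′)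
open import Data.Vec.Base using ([]; _∷_; replicate)
open import Data.Vec.Properties using (≡-dec)
open import Level using (0ℓ)
open import Relation.Binary.Definitions using (WeaklyDecidable)
open import Relation.Binary.PropositionalEquality using (_≡_; refl; sym; trans; cong; cong₂; subst; module ≡-Reasoning)
open import Relation.Nullary using (Dec; yes; no; ¬_)
open import Relation.Nullary.Decidable using (toWitness; _⊎-dec_; _×-dec_; decidable-stable)

-- Why 5^(-1/4): if d/n = (1 - τ)/2, nonzero codewords have k ≥ 3m(1 - τ) up to bounded terms. At
-- equality r_(m+1-k)² tends to (m - k)/(5m - k) = (3τ - 2)/(3τ + 2), and this equals ((1 - τ)/(1 +
-- τ))⁴ exactly when 5τ⁴ = 1. The term k = 0 needs 1/√5 < t², which forces t strictly above the
-- critical value; the strict inequality assumed for d/n pays for the difference. One c serves both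
-- ends because J is invariant under y -> (1 - y)/(1 + y), so J - c vanishes at t and at (1 - t)/(1
-- + t). The order of quantifiers matters: t fixes a positive lower bound for F, the bound fixes K
-- (the error is of order 1/K), and only then may m grow. As m must be even, K cannot be one
-- constant: it runs through twelve consecutive values according to N mod 12. Working in X = i y
-- makes the signs (-1)^k disappear, so positivity of the Chebyshev expansion becomes membership in
-- a cone. Ratios and the irrational bound never occur as such: all denominators are cleared, and
-- every estimate is an integer polynomial identity whose terms are visibly non-negative.

module PowerSeries where
  open import Data.Integer.Base using (_+_; _*_; -_; _-_; _≤_; _<_)

  -- Formal power series over ℤ and their ring structure

  Series : Set
  Series = ℕ → ℤ

  infix 4 _≈_
  infixl 6 _⊞_
  infixl 7 _⊠_

  _≈_ : Series → Series → Set
  f ≈ g = ∀ n → f n ≡ g n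

  tail : Series → Series
  tail f n = f (suc n)

  const : ℤ → Series
  const c zero    = c
  const c (suc n) = 0ℤ

  X : Series
  X zero    = 0ℤ
  X (suc n) = const 1ℤ n

  _⊞_ : Series → Series → Series
  (f ⊞ g) n = f n + g n

  ⊟_ : Series → Series
  (⊟ f) n = - f n

  _⊠_ : Series → Series → Series
  (f ⊠ g) zero    = f 0 * g 0
  (f ⊠ g) (suc n) = f 0 * g (suc n) + (tail f ⊠ g) n

  scale : ℤ → Series → Series
  scale c f n = c * f n

  ⊠-cong : ∀ {f f′ g g′} → f ≈ f′ → g ≈ g′ → f ⊠ g ≈ f′ ⊠ g′
  ⊠-cong p q zero    = cong₂ _*_ (p 0) (q 0)
  ⊠-cong p q (suc n) = cong₂ _+_ (cong₂ _*_ (p 0) (q (suc n))) (⊠-cong (λ k → p (suc k)) q n)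

  ⊠-zeroˡ : ∀ {z} → (∀ n → z n ≡ 0ℤ) → ∀ f n → (z ⊠ f) n ≡ 0ℤ
  ⊠-zeroˡ z≡0 f zero    rewrite z≡0 0 = refl
  ⊠-zeroˡ z≡0 f (suc n) rewrite z≡0 0 = trans (ℤₚ.+-identityˡ _) (⊠-zeroˡ (λ k → z≡0 (suc k)) f n)

  ⊠-distribʳ : ∀ f g h → (g ⊞ h) ⊠ f ≈ (g ⊠ f) ⊞ (h ⊠ f)
  ⊠-distribʳ f g h zero    = ℤₚ.*-distribʳ-+ (f 0) (g 0) (h 0)
  ⊠-distribʳ f g h (suc n) rewrite ⊠-distribʳ f (tail g) (tail h) n = lem (g 0) (h 0) (f (suc n)) ((tail g ⊠ f) n) ((tail h ⊠ f) n)
    where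
    lem : ∀ a b c d e → (a + b) * c + (d + e) ≡ (a * c + d) + (b * c + e)
    lem = solve-∀

  ⊠-scaleˡ : ∀ c f g → scale c f ⊠ g ≈ scale c (f ⊠ g)
  ⊠-scaleˡ c f g zero    = ℤₚ.*-assoc c (f 0) (g 0)
  ⊠-scaleˡ c f g (suc n) rewrite ⊠-scaleˡ c (tail f) g n = lem c (f 0) (g (suc n)) ((tail f ⊠ g) n)
    where
    lem : ∀ c a b d → c * a * b + c * d ≡ c * (a * b + d)
    lem = solve-∀

  -- Peels the Cauchy product at its other end, which is what commutativity needs, since the
  -- definition recurses on the first factor only.
  ⊠-sucʳ : ∀ f g n → (f ⊠ g) (suc n) ≡ f (suc n) * g 0 + (f ⊠ tail g) n
  ⊠-sucʳ f g zero    = ℤₚ.+-comm (f 0 * g 1) (f 1 * g 0)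
  ⊠-sucʳ f g (suc n) rewrite ⊠-sucʳ (tail f) g n = lem (f 0 * g (suc (suc n))) (f (suc (suc n)) * g 0) ((tail f ⊠ tail g) n)
    where
    lem : ∀ a b c → a + (b + c) ≡ b + (a + c)
    lem = solve-∀

  ⊠-comm : ∀ f g → f ⊠ g ≈ g ⊠ f
  ⊠-comm f g zero    = ℤₚ.*-comm (f 0) (g 0)
  ⊠-comm f g (suc n) rewrite ⊠-sucʳ g f n = cong₂ _+_ (ℤₚ.*-comm (f 0) (g (suc n))) (⊠-comm (tail f) g n)

  ⊠-assoc : ∀ f g h → (f ⊠ g) ⊠ h ≈ f ⊠ (g ⊠ h)
  ⊠-assoc f g h zero    = ℤₚ.*-assoc (f 0) (g 0) (h 0)
  ⊠-assoc f g h (suc n)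
    rewrite ⊠-distribʳ h (scale (f 0) (tail g)) (tail f ⊠ g) n
          | ⊠-scaleˡ (f 0) (tail g) h n
          | ⊠-assoc (tail f) g h n = lem (f 0) (g 0) (h (suc n)) ((tail g ⊠ h) n) ((tail f ⊠ (g ⊠ h)) n)
    where
    lem : ∀ a b c d e → a * b * c + (a * d + e) ≡ a * (b * c + d) + e
    lem = solve-∀

  const-⊠ : ∀ c f → const c ⊠ f ≈ scale c f
  const-⊠ c f zero    = refl
  const-⊠ c f (suc n) rewrite ⊠-zeroˡ {tail (const c)} (λ k → refl) f n = ℤₚ.+-identityʳ _

  ⊠-identityˡ : ∀ f → const 1ℤ ⊠ f ≈ f
  ⊠-identityˡ f n = trans (const-⊠ 1ℤ f n) (ℤₚ.*-identityˡ (f n))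

  ⊠-distribˡ : ∀ f g h → f ⊠ (g ⊞ h) ≈ (f ⊠ g) ⊞ (f ⊠ h)
  ⊠-distribˡ f g h n rewrite ⊠-comm f (g ⊞ h) n | ⊠-comm f g n | ⊠-comm f h n = ⊠-distribʳ f g h n

  const-0 : ∀ n → const 0ℤ n ≡ 0ℤ
  const-0 zero    = refl
  const-0 (suc n) = refl

  seriesRing : CommutativeRing 0ℓ 0ℓ
  seriesRing = record
    { Carrier = Series ; _≈_ = _≈_ ; _+_ = _⊞_ ; _*_ = _⊠_ ; -_ = ⊟_ ; 0# = const 0ℤ ; 1# = const 1ℤ
    ; isCommutativeRing = record
      { isRing = record
        { +-isAbelianGroup = record
          { isGroup = record
            { isMonoid = record
              { isSemigroup = record
                { isMagma = record
                  { isEquivalence = record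
                    { refl = λ n → refl ; sym = λ p n → sym (p n) ; trans = λ p q n → trans (p n) (q n) }
                  ; ∙-cong = λ p q n → cong₂ _+_ (p n) (q n) }
                ; assoc = λ f g h n → ℤₚ.+-assoc (f n) (g n) (h n) }
              ; identity = (λ f n → trans (cong (_+ f n) (const-0 n)) (ℤₚ.+-identityˡ (f n)))
                         , (λ f n → trans (cong (λ z → f n + z) (const-0 n)) (ℤₚ.+-identityʳ (f n))) }
            ; inverse = (λ f n → trans (ℤₚ.+-inverseˡ (f n)) (sym (const-0 n)))
                      , (λ f n → trans (ℤₚ.+-inverseʳ (f n)) (sym (const-0 n)))
            ; ⁻¹-cong = λ p n → cong -_ (p n) }
          ; comm = λ f g n → ℤₚ.+-comm (f n) (g n) }
        ; *-cong = ⊠-cong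
        ; *-assoc = ⊠-assoc
        ; *-identity = ⊠-identityˡ , (λ f n → trans (⊠-comm f (const 1ℤ) n) (⊠-identityˡ f n))
        ; distrib = ⊠-distribˡ , ⊠-distribʳ }
      ; *-comm = ⊠-comm } }

  module R = CommutativeRing seriesRing
  open Algebra.Properties.Semiring.Exp R.semiring public using (_^_; ^-homo-*; ^-assocʳ; ^-congˡ)
  open Algebra.Properties.CommutativeSemiring.Exp R.commutativeSemiring public using (^-distrib-*)

  -- Lets the ring solver use integers as coefficients and decide their equality.
  constHom : CommutativeRing.rawRing ℤₚ.+-*-commutativeRing -Raw-AlmostCommutative⟶ fromCommutativeRing seriesRing
  constHom = record
    { ⟦_⟧ = const
    ; +-homo = λ { a b zero → refl ; a b (suc n) → refl }
    ; *-homo = λ a b n → sym (trans (const-⊠ a (const b) n) (lem a b n))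
    ; -‿homo = λ { a zero → refl ; a (suc n) → refl }
    ; 0-homo = λ n → refl
    ; 1-homo = λ n → refl }
    where
    lem : ∀ a b n → a * const b n ≡ const (a * b) n
    lem a b zero    = refl
    lem a b (suc n) = ℤₚ.*-zeroʳ a

  const≟ : WeaklyDecidable (Induced-equivalence constHom)
  const≟ a b with a ℤₚ.≟ b
  ... | yes refl = just (λ n → refl)
  ... | no _     = nothing

  module Solver = Algebra.Solver.Ring (CommutativeRing.rawRing ℤₚ.+-*-commutativeRing) (fromCommutativeRing seriesRing) constHom const≟
  open Solver using (solve; _:=_; _:+_; _:*_; _:-_; :-_; con; _:^_)

  -- The derivation X d/dX and logarithmic derivatives

  θ : Series → Series
  θ f n = + n * f n

  θ-⊠ : ∀ f g → θ (f ⊠ g) ≈ θ f ⊠ g ⊞ f ⊠ θ g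
  θ-⊠ f g zero    = lem (f 0) (g 0)
    where
    lem : ∀ a b → 0ℤ * (a * b) ≡ 0ℤ * a * b + a * (0ℤ * b)
    lem = solve-∀
  θ-⊠ f g (suc n) = begin
    + suc n * (f 0 * g (suc n) + (tail f ⊠ g) n)
      ≡⟨ lem (+ n) (f 0) (g (suc n)) ((tail f ⊠ g) n) ⟩
    f 0 * (+ suc n * g (suc n)) + ((tail f ⊠ g) n + θ (tail f ⊠ g) n)
      ≡⟨ cong (λ z → f 0 * (+ suc n * g (suc n)) + ((tail f ⊠ g) n + z)) (θ-⊠ (tail f) g n) ⟩
    f 0 * (+ suc n * g (suc n)) + ((tail f ⊠ g) n + ((θ (tail f) ⊠ g) n + (tail f ⊠ θ g) n))
      ≡⟨ lem′ (f 0) (g (suc n)) (+ suc n) ((tail f ⊠ g) n) ((θ (tail f) ⊠ g) n) ((tail f ⊠ θ g) n) ⟩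
    0ℤ * f 0 * g (suc n) + ((tail f ⊠ g) n + (θ (tail f) ⊠ g) n) + (f 0 * (+ suc n * g (suc n)) + (tail f ⊠ θ g) n)
      ≡⟨ cong (λ z → 0ℤ * f 0 * g (suc n) + z + (f 0 * (+ suc n * g (suc n)) + (tail f ⊠ θ g) n))
              (trans (sym (⊠-distribʳ g (tail f) (θ (tail f)) n)) (⊠-cong {g = g} tail-θ (λ k → refl) n)) ⟩
    0ℤ * f 0 * g (suc n) + (tail (θ f) ⊠ g) n + (f 0 * (+ suc n * g (suc n)) + (tail f ⊠ θ g) n) ∎
    where
    open ≡-Reasoning
    lem : ∀ n a b c → (1ℤ + n) * (a * b + c) ≡ a * ((1ℤ + n) * b) + (c + n * c)
    lem = solve-∀
    lem′ : ∀ a b k c d e → a * (k * b) + (c + (d + e)) ≡ 0ℤ * a * b + (c + d) + (a * (k * b) + e)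
    lem′ = solve-∀
    lem″ : ∀ n a → a + n * a ≡ (1ℤ + n) * a
    lem″ = solve-∀
    tail-θ : tail f ⊞ θ (tail f) ≈ tail (θ f)
    tail-θ k = lem″ (+ k) (f (suc k))

  X-suc : ∀ f n → (X ⊠ f) (suc n) ≡ f n
  X-suc f n = trans (ℤₚ.+-identityˡ _) (⊠-identityˡ f n)

  X² : Series
  X² = X ⊠ X

  X²-zero : ∀ f → (X² ⊠ f) 0 ≡ 0ℤ
  X²-zero f = refl

  X²-shift : ∀ f n → (X² ⊠ f) (suc (suc n)) ≡ f n
  X²-shift f n = trans (⊠-assoc X X f (suc (suc n))) (trans (X-suc (X ⊠ f) (suc n)) (X-suc f n))

  -- In terms of y, where X = i y, these are 1 - y², 1 + y² and their inverses.
  o p o⁻¹ p⁻¹ : Series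
  o = const 1ℤ ⊞ X²
  p = const 1ℤ ⊞ ⊟ X²
  o⁻¹ 0 = 1ℤ
  o⁻¹ 1 = 0ℤ
  o⁻¹ (suc (suc n)) = - o⁻¹ n
  p⁻¹ 0 = 1ℤ
  p⁻¹ 1 = 0ℤ
  p⁻¹ (suc (suc n)) = p⁻¹ n

  o-inverse : o ⊠ o⁻¹ ≈ const 1ℤ
  o-inverse n = trans (⊠-distribʳ o⁻¹ (const 1ℤ) X² n) (trans (cong (_+ (X² ⊠ o⁻¹) n) (⊠-identityˡ o⁻¹ n)) (lem n))
    where
    lem : ∀ n → o⁻¹ n + (X² ⊠ o⁻¹) n ≡ const 1ℤ n
    lem 0 = refl
    lem 1 = refl
    lem (suc (suc n)) rewrite X²-shift o⁻¹ n = ℤₚ.+-inverseˡ (o⁻¹ n)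

  p-inverse : p ⊠ p⁻¹ ≈ const 1ℤ
  p-inverse n = trans (⊠-distribʳ p⁻¹ (const 1ℤ) (⊟ X²) n) (trans (cong₂ _+_ (⊠-identityˡ p⁻¹ n) (neg n)) (lem n))
    where
    neg : ⊟ X² ⊠ p⁻¹ ≈ ⊟ (X² ⊠ p⁻¹)
    neg = solve 2 (λ x y → (:- x) :* y := :- (x :* y)) (λ n → refl) X² p⁻¹
    lem : ∀ n → p⁻¹ n + - (X² ⊠ p⁻¹) n ≡ const 1ℤ n
    lem 0 = refl
    lem 1 = refl
    lem (suc (suc n)) rewrite X²-shift p⁻¹ n = ℤₚ.+-inverseʳ (p⁻¹ n)

  infix 4 _has-dlog_

  _has-dlog_ : Series → Series → Set
  f has-dlog u = θ f ≈ u ⊠ f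

  open import Relation.Binary.Reasoning.Setoid R.setoid using (begin_; step-≈-⟩; step-≈-⟨; _∎)

  dlog-⊠ : ∀ {f g u v} → f has-dlog u → g has-dlog v → f ⊠ g has-dlog u ⊞ v
  dlog-⊠ {f} {g} {u} {v} hf hg = begin
    θ (f ⊠ g)                   ≈⟨ θ-⊠ f g ⟩
    θ f ⊠ g ⊞ f ⊠ θ g           ≈⟨ R.+-cong (R.*-congʳ {g} hf) (R.*-congˡ {f} hg) ⟩
    u ⊠ f ⊠ g ⊞ f ⊠ (v ⊠ g)     ≈⟨ solve 4 (λ f g u v → u :* f :* g :+ f :* (v :* g) := (u :+ v) :* (f :* g)) R.refl f g u v ⟩
    (u ⊞ v) ⊠ (f ⊠ g)           ∎

  θ-const : ∀ c n → θ (const c) n ≡ 0ℤ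
  θ-const c zero    = refl
  θ-const c (suc n) = ℤₚ.*-zeroʳ (+ suc n)

  dlog-const : ∀ c → const c has-dlog const 0ℤ
  dlog-const c n = trans (θ-const c n) (sym (trans (const-⊠ 0ℤ (const c) n) refl))

  dlog-^ : ∀ {f u} → f has-dlog u → ∀ k → f ^ k has-dlog const (+ k) ⊠ u
  dlog-^ {f} {u} hf zero    n = trans (dlog-const 1ℤ n) (⊠-cong {g = const 1ℤ} (λ k → sym (trans (const-⊠ 0ℤ u k) (sym (const-0 k)))) (λ k → refl) n)
  dlog-^ {f} {u} hf (suc k) = begin
    θ (f ⊠ f ^ k)                           ≈⟨ dlog-⊠ {f} {f ^ k} {u} {const (+ k) ⊠ u} hf (dlog-^ hf k) ⟩
    (u ⊞ const (+ k) ⊠ u) ⊠ (f ⊠ f ^ k)     ≈⟨ solve 3 (λ u c g → (u :+ c :* u) :* g := (con 1ℤ :+ c) :* u :* g) R.refl u (const (+ k)) (f ⊠ f ^ k) ⟩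
    (const 1ℤ ⊞ const (+ k)) ⊠ u ⊠ (f ⊠ f ^ k)
      ≈⟨ R.*-congʳ {f ⊠ f ^ k} (R.*-congʳ {u} {const 1ℤ ⊞ const (+ k)} {const (+ suc k)} λ { zero → refl ; (suc n) → refl }) ⟩
    const (+ suc k) ⊠ u ⊠ (f ⊠ f ^ k)       ∎

  dlog-inverse : ∀ {f g u} → f ⊠ g ≈ const 1ℤ → f has-dlog u → g has-dlog ⊟ u
  dlog-inverse {f} {g} {u} fg≈1 hf = begin
    θ g                                       ≈⟨ R.*-identityˡ (θ g) ⟨
    const 1ℤ ⊠ θ g                            ≈⟨ R.*-congʳ {θ g} fg≈1 ⟨
    f ⊠ g ⊠ θ g                               ≈⟨ solve 4 (λ f g t u → f :* g :* t := g :* (u :* f :* g :+ f :* t) :- u :* g :* (f :* g)) R.refl f g (θ g) u ⟩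
    g ⊠ (u ⊠ f ⊠ g ⊞ f ⊠ θ g) ⊞ ⊟ (u ⊠ g ⊠ (f ⊠ g))
      ≈⟨ R.+-cong (R.*-congˡ {g} zero-derivative) (R.-‿cong (R.*-congˡ {u ⊠ g} fg≈1)) ⟩
    g ⊠ const 0ℤ ⊞ ⊟ (u ⊠ g ⊠ const 1ℤ)       ≈⟨ solve 2 (λ g u → g :* con 0ℤ :- u :* g :* con 1ℤ := (:- u) :* g) R.refl g u ⟩
    ⊟ u ⊠ g                                   ∎
    where
    zero-derivative : u ⊠ f ⊠ g ⊞ f ⊠ θ g ≈ const 0ℤ
    zero-derivative = begin
      u ⊠ f ⊠ g ⊞ f ⊠ θ g   ≈⟨ R.+-congʳ {f ⊠ θ g} (R.*-congʳ {g} hf) ⟨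
      θ f ⊠ g ⊞ f ⊠ θ g     ≈⟨ θ-⊠ f g ⟨
      θ (f ⊠ g)             ≈⟨ (λ n → trans (cong (+ n *_) (fg≈1 n)) (trans (θ-const 1ℤ n) (sym (const-0 n)))) ⟩
      const 0ℤ              ∎

  θ-X² : θ X² ≈ const (+ 2) ⊠ X²
  θ-X² = begin
    θ X²                 ≈⟨ θ-⊠ X X ⟩
    θ X ⊠ X ⊞ X ⊠ θ X    ≈⟨ R.+-cong (R.*-congʳ {X} θ-X) (R.*-congˡ {X} θ-X) ⟩
    X ⊠ X ⊞ X ⊠ X        ≈⟨ solve 1 (λ x → x :* x :+ x :* x := con (+ 2) :* (x :* x)) R.refl X ⟩
    const (+ 2) ⊠ X²     ∎
    where
    θ-X : θ X ≈ X
    θ-X 0 = refl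
    θ-X 1 = refl
    θ-X (suc (suc n)) = ℤₚ.*-zeroʳ (+ suc (suc n))

  dlog-o : o has-dlog const (+ 2) ⊠ X² ⊠ o⁻¹
  dlog-o = begin
    θ o                            ≈⟨ (λ n → trans (ℤₚ.*-distribˡ-+ (+ n) (const 1ℤ n) (X² n)) (trans (cong (_+ θ X² n) (θ-const 1ℤ n)) (trans (ℤₚ.+-identityˡ _) (θ-X² n)))) ⟩
    const (+ 2) ⊠ X²               ≈⟨ R.*-identityʳ _ ⟨
    const (+ 2) ⊠ X² ⊠ const 1ℤ    ≈⟨ R.*-congˡ {const (+ 2) ⊠ X²} o-inverse ⟨
    const (+ 2) ⊠ X² ⊠ (o ⊠ o⁻¹)   ≈⟨ solve 3 (λ x o o′ → x :* (o :* o′) := x :* o′ :* o) R.refl (const (+ 2) ⊠ X²) o o⁻¹ ⟩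
    const (+ 2) ⊠ X² ⊠ o⁻¹ ⊠ o     ∎

  dlog-p : p has-dlog ⊟ (const (+ 2) ⊠ X² ⊠ p⁻¹)
  dlog-p = begin
    θ p                                ≈⟨ (λ n → trans (lem (+ n) (const 1ℤ n) (X² n)) (trans (cong (_+ - θ X² n) (θ-const 1ℤ n)) (trans (ℤₚ.+-identityˡ _) (cong -_ (θ-X² n))))) ⟩
    ⊟ (const (+ 2) ⊠ X²)               ≈⟨ R.*-identityʳ _ ⟨
    ⊟ (const (+ 2) ⊠ X²) ⊠ const 1ℤ    ≈⟨ R.*-congˡ {⊟ (const (+ 2) ⊠ X²)} p-inverse ⟨
    ⊟ (const (+ 2) ⊠ X²) ⊠ (p ⊠ p⁻¹)   ≈⟨ solve 3 (λ x p p′ → (:- x) :* (p :* p′) := (:- (x :* p′)) :* p) R.refl (const (+ 2) ⊠ X²) p p⁻¹ ⟩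
    ⊟ (const (+ 2) ⊠ X² ⊠ p⁻¹) ⊠ p     ∎
    where
    lem : ∀ n a b → n * (a + - b) ≡ n * a + - (n * b)
    lem = solve-∀

  -- Lagrange inversion for J

  double : ℕ → ℕ
  double zero    = zero
  double (suc n) = suc (suc (double n))

  double≡ : ∀ k → double k ≡ k ℕ.+ k
  double≡ zero    = refl
  double≡ (suc k) = cong suc (trans (cong suc (double≡ k)) (sym (ℕₚ.+-suc k k)))

  -- In terms of y this is 1 - 6y² + y⁴, the numerator of the logarithmic derivative of J: θ J / J =
  -- -2 ŵ / (p o).
  ŵ : Series
  ŵ = const 1ℤ ⊞ const (+ 6) ⊠ X² ⊞ X² ⊠ X²

  -- This is y² J, that is, J with its pole at 0 removed.
  h : Series
  h = p ^ 4 ⊠ o⁻¹ ^ 2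

  dlog-h : h has-dlog const (+ 4) ⊠ ⊟ (const (+ 2) ⊠ X² ⊠ p⁻¹) ⊞ const (+ 2) ⊠ ⊟ (const (+ 2) ⊠ X² ⊠ o⁻¹)
  dlog-h = dlog-⊠ {p ^ 4} {o⁻¹ ^ 2} (dlog-^ dlog-p 4) (dlog-^ (dlog-inverse {o} {o⁻¹} o-inverse dlog-o) 2)

  double-+ : ∀ r → + double r ≡ + 2 * + r
  double-+ zero    = refl
  double-+ (suc r) = trans (cong (λ z → + 2 + z) (double-+ r)) (lem (+ r))
    where
    lem : ∀ r → + 2 + + 2 * r ≡ + 2 * (1ℤ + r)
    lem = solve-∀

  -- 2 r h ^ r - θ (h ^ r) = 2 r ŵ p⁻¹ o⁻¹ h ^ r, and the left side has no term in X ^ (2 r).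
  residue-suc : ∀ r → (ŵ ⊠ (p⁻¹ ⊠ o⁻¹) ⊠ h ^ suc r) (double (suc r)) ≡ 0ℤ
  residue-suc r′ = ℤₚ.*-cancelˡ-≡ (+ double r) _ _ (trans (sym (const-⊠ (+ double r) V (double r))) (trans (identity (double r)) (trans vanish (sym (ℤₚ.*-zeroʳ (+ double r))))))
    where
    r = suc r′
    V = ŵ ⊠ (p⁻¹ ⊠ o⁻¹) ⊠ h ^ r
    vanish : (const (+ double r) ⊠ h ^ r ⊞ ⊟ θ (h ^ r)) (double r) ≡ 0ℤ
    vanish rewrite const-⊠ (+ double r) (h ^ r) (double r) = ℤₚ.+-inverseʳ (+ double r * (h ^ r) (double r))
    split : ŵ ⊠ (p⁻¹ ⊠ o⁻¹) ≈ const 1ℤ ⊞ const (+ 4) ⊠ X² ⊠ p⁻¹ ⊞ const (+ 2) ⊠ X² ⊠ o⁻¹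
    split = begin
      ŵ ⊠ (p⁻¹ ⊠ o⁻¹)
        ≈⟨ solve 3 (λ x a c → (con 1ℤ :+ con (+ 6) :* x :+ x :* x) :* (a :* c)
             := ((con 1ℤ :- x) :* a) :* ((con 1ℤ :+ x) :* c) :+ con (+ 4) :* x :* a :* ((con 1ℤ :+ x) :* c) :+ con (+ 2) :* x :* c :* ((con 1ℤ :- x) :* a)) R.refl X² p⁻¹ o⁻¹ ⟩
      (p ⊠ p⁻¹) ⊠ (o ⊠ o⁻¹) ⊞ const (+ 4) ⊠ X² ⊠ p⁻¹ ⊠ (o ⊠ o⁻¹) ⊞ const (+ 2) ⊠ X² ⊠ o⁻¹ ⊠ (p ⊠ p⁻¹)
        ≈⟨ R.+-cong (R.+-cong (R.*-cong p-inverse o-inverse) (R.*-congˡ {const (+ 4) ⊠ X² ⊠ p⁻¹} o-inverse)) (R.*-congˡ {const (+ 2) ⊠ X² ⊠ o⁻¹} p-inverse) ⟩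
      const 1ℤ ⊠ const 1ℤ ⊞ const (+ 4) ⊠ X² ⊠ p⁻¹ ⊠ const 1ℤ ⊞ const (+ 2) ⊠ X² ⊠ o⁻¹ ⊠ const 1ℤ
        ≈⟨ solve 2 (λ y z → con 1ℤ :* con 1ℤ :+ y :* con 1ℤ :+ z :* con 1ℤ := con 1ℤ :+ y :+ z) R.refl (const (+ 4) ⊠ X² ⊠ p⁻¹) (const (+ 2) ⊠ X² ⊠ o⁻¹) ⟩
      const 1ℤ ⊞ const (+ 4) ⊠ X² ⊠ p⁻¹ ⊞ const (+ 2) ⊠ X² ⊠ o⁻¹ ∎
    2r : const (+ double r) ≈ const (+ 2) ⊠ const (+ r)
    2r n = trans (cong (λ z → const z n) (double-+ r)) (_-Raw-AlmostCommutative⟶_.*-homo constHom (+ 2) (+ r) n)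
    identity : const (+ double r) ⊠ V ≈ const (+ double r) ⊠ h ^ r ⊞ ⊟ θ (h ^ r)
    identity = begin
      const (+ double r) ⊠ V
        ≈⟨ R.*-cong 2r (R.*-congʳ {h ^ r} split) ⟩
      const (+ 2) ⊠ const (+ r) ⊠ ((const 1ℤ ⊞ const (+ 4) ⊠ X² ⊠ p⁻¹ ⊞ const (+ 2) ⊠ X² ⊠ o⁻¹) ⊠ h ^ r)
        ≈⟨ solve 5 (λ c x a b y → con (+ 2) :* c :* ((con 1ℤ :+ con (+ 4) :* x :* a :+ con (+ 2) :* x :* b) :* y)
             := con (+ 2) :* c :* y :- (c :* (con (+ 4) :* (:- (con (+ 2) :* x :* a)) :+ con (+ 2) :* (:- (con (+ 2) :* x :* b)))) :* y)
             R.refl (const (+ r)) X² p⁻¹ o⁻¹ (h ^ r) ⟩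
      const (+ 2) ⊠ const (+ r) ⊠ h ^ r ⊞ ⊟ ((const (+ r) ⊠ (const (+ 4) ⊠ ⊟ (const (+ 2) ⊠ X² ⊠ p⁻¹) ⊞ const (+ 2) ⊠ ⊟ (const (+ 2) ⊠ X² ⊠ o⁻¹))) ⊠ h ^ r)
        ≈⟨ R.+-cong (R.*-congʳ {h ^ r} 2r) (R.-‿cong (dlog-^ dlog-h r)) ⟨
      const (+ double r) ⊠ h ^ r ⊞ ⊟ θ (h ^ r) ∎

  ^-inverse : ∀ {f g} → f ⊠ g ≈ const 1ℤ → ∀ k → f ^ k ⊠ g ^ k ≈ const 1ℤ
  ^-inverse {f} {g} fg≈1 k = begin
    f ^ k ⊠ g ^ k   ≈⟨ ^-distrib-* f g k ⟨
    (f ⊠ g) ^ k     ≈⟨ ^-congˡ k fg≈1 ⟩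
    const 1ℤ ^ k    ≈⟨ 1^ k ⟩
    const 1ℤ        ∎
    where
    1^ : ∀ k → const 1ℤ ^ k ≈ const 1ℤ
    1^ zero    = R.refl
    1^ (suc k) = R.trans (⊠-identityˡ (const 1ℤ ^ k)) (1^ k)

  X²^-shift : ∀ i f r → (X² ^ i ⊠ f) (double (i ℕ.+ r)) ≡ f (double r)
  X²^-shift zero    f r = ⊠-identityˡ f (double r)
  X²^-shift (suc i) f r = trans (⊠-assoc X² (X² ^ i) f (double (suc (i ℕ.+ r)))) (trans (X²-shift (X² ^ i ⊠ f) (double (i ℕ.+ r))) (X²^-shift i f r))

  X²^-low : ∀ m j f → (X² ^ suc (m ℕ.+ j) ⊠ f) (double m) ≡ 0ℤ
  X²^-low zero    j f = refl
  X²^-low (suc m) j f = trans (⊠-assoc X² (X² ^ suc (m ℕ.+ j)) f (double (suc m))) (trans (X²-shift (X² ^ suc (m ℕ.+ j) ⊠ f) (double m)) (X²^-low m j f))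

  -- While e + 4i is held at N, the factor p^e (X² o²)^i equals (1 + y²)^N (-J)^(-i), a single term
  -- of the expansion of the weight enumerator. The last factor is shared by both summands of
  -- `kernel`.
  monomial : (e i m q : ℕ) → Series
  monomial e i m q = p ^ e ⊠ (X² ⊠ o ^ 2) ^ i ⊠ (ŵ ⊠ (o⁻¹ ⊠ (o⁻¹ ^ 2) ^ m) ⊠ p⁻¹ ^ q)

  -- The hypothesis leaves p^(4r - 1) and o^(-2r - 1), and their product is h^r / (p o).
  monomial-shift : ∀ e i r q → suc e ≡ q ℕ.+ 4 ℕ.* r → monomial e i (i ℕ.+ r) q ≈ X² ^ i ⊠ (ŵ ⊠ (p⁻¹ ⊠ o⁻¹) ⊠ h ^ r)
  monomial-shift e i r q eq = begin
    p ^ e ⊠ (X² ⊠ o ^ 2) ^ i ⊠ (ŵ ⊠ (o⁻¹ ⊠ (o⁻¹ ^ 2) ^ (i ℕ.+ r)) ⊠ p⁻¹ ^ q)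
      ≈⟨ R.*-cong (R.*-cong pe (^-distrib-* X² (o ^ 2) i)) (R.*-congʳ {p⁻¹ ^ q} (R.*-congˡ {ŵ} (R.*-congˡ {o⁻¹} (^-homo-* (o⁻¹ ^ 2) i r)))) ⟩
    p ^ q ⊠ (p ^ 4) ^ r ⊠ p⁻¹ ⊠ (X² ^ i ⊠ (o ^ 2) ^ i) ⊠ (ŵ ⊠ (o⁻¹ ⊠ ((o⁻¹ ^ 2) ^ i ⊠ (o⁻¹ ^ 2) ^ r)) ⊠ p⁻¹ ^ q)
      ≈⟨ solve 10 (λ pq p4r p′ xi oi w o′ o′i o′r p′q →
            pq :* p4r :* p′ :* (xi :* oi) :* (w :* (o′ :* (o′i :* o′r)) :* p′q)
              := (pq :* p′q) :* (oi :* o′i) :* (xi :* (w :* (p′ :* o′) :* (p4r :* o′r)))) R.refl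
            (p ^ q) ((p ^ 4) ^ r) p⁻¹ (X² ^ i) ((o ^ 2) ^ i) ŵ o⁻¹ ((o⁻¹ ^ 2) ^ i) ((o⁻¹ ^ 2) ^ r) (p⁻¹ ^ q) ⟩
    (p ^ q ⊠ p⁻¹ ^ q) ⊠ ((o ^ 2) ^ i ⊠ (o⁻¹ ^ 2) ^ i) ⊠ (X² ^ i ⊠ (ŵ ⊠ (p⁻¹ ⊠ o⁻¹) ⊠ ((p ^ 4) ^ r ⊠ (o⁻¹ ^ 2) ^ r)))
      ≈⟨ R.*-cong (R.*-cong (^-inverse p-inverse q) (^-inverse {o ^ 2} {o⁻¹ ^ 2} (^-inverse o-inverse 2) i))
                  (R.*-congˡ {X² ^ i} (R.*-congˡ {ŵ ⊠ (p⁻¹ ⊠ o⁻¹)} (R.sym (^-distrib-* (p ^ 4) (o⁻¹ ^ 2) r)))) ⟩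
    const 1ℤ ⊠ const 1ℤ ⊠ (X² ^ i ⊠ (ŵ ⊠ (p⁻¹ ⊠ o⁻¹) ⊠ h ^ r))
      ≈⟨ solve 1 (λ x → con 1ℤ :* con 1ℤ :* x := x) R.refl (X² ^ i ⊠ (ŵ ⊠ (p⁻¹ ⊠ o⁻¹) ⊠ h ^ r)) ⟩
    X² ^ i ⊠ (ŵ ⊠ (p⁻¹ ⊠ o⁻¹) ⊠ h ^ r) ∎
    where
    pe : p ^ e ≈ p ^ q ⊠ (p ^ 4) ^ r ⊠ p⁻¹
    pe = begin
      p ^ e                          ≈⟨ R.*-identityˡ (p ^ e) ⟨
      const 1ℤ ⊠ p ^ e               ≈⟨ R.*-congʳ {p ^ e} p-inverse ⟨
      p ⊠ p⁻¹ ⊠ p ^ e                ≈⟨ solve 3 (λ p p′ pe → p :* p′ :* pe := p :* pe :* p′) R.refl p p⁻¹ (p ^ e) ⟩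
      p ^ suc e ⊠ p⁻¹                ≈⟨ R.reflexive (cong (λ k → p ^ k ⊠ p⁻¹) eq) ⟩
      p ^ (q ℕ.+ 4 ℕ.* r) ⊠ p⁻¹      ≈⟨ R.*-congʳ {p⁻¹} (^-homo-* p q (4 ℕ.* r)) ⟩
      p ^ q ⊠ p ^ (4 ℕ.* r) ⊠ p⁻¹    ≈⟨ R.*-congʳ {p⁻¹} (R.*-congˡ {p ^ q} (^-assocʳ p 4 r)) ⟨
      p ^ q ⊠ (p ^ 4) ^ r ⊠ p⁻¹      ∎

  -- For r = 0 the coefficient is the constant term 1; the others are residues of exact
  -- differentials.
  residue-nonneg : ∀ r → 0ℤ ≤ (ŵ ⊠ (p⁻¹ ⊠ o⁻¹) ⊠ h ^ r) (double r)
  residue-nonneg zero    = +≤+ ℕ.z≤n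
  residue-nonneg (suc r) = ℤₚ.≤-reflexive (sym (residue-suc r))

  -- The coefficient is 1 for i = m and 0 otherwise: for i < m it is a vanishing residue, for i > m
  -- the series only starts beyond X^(2m).
  monomial-nonneg : ∀ e i m q → suc (e ℕ.+ 4 ℕ.* i) ≡ q ℕ.+ 4 ℕ.* m → 0ℤ ≤ monomial e i m q (double m)
  monomial-nonneg e i m q eq with ℕₚ.≤-<-connex i m
  ... | inj₁ i≤m with ℕₚ.m≤n⇒∃[o]m+o≡n i≤m
  ...   | r , refl = subst (0ℤ ≤_) (sym (trans (monomial-shift e i r q e+1≡ (double (i ℕ.+ r))) (X²^-shift i _ r))) (residue-nonneg r)
    where
    e+1≡ : suc e ≡ q ℕ.+ 4 ℕ.* r
    e+1≡ = ℕₚ.+-cancelʳ-≡ (4 ℕ.* i) (suc e) (q ℕ.+ 4 ℕ.* r) (trans eq (lem q i r))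
      where
      lem : ∀ q i r → q ℕ.+ 4 ℕ.* (i ℕ.+ r) ≡ q ℕ.+ 4 ℕ.* r ℕ.+ 4 ℕ.* i
      lem = ℕ-solve-∀
  monomial-nonneg e i m q eq | inj₂ m<i with ℕₚ.m≤n⇒∃[o]m+o≡n m<i
  ... | j , refl = ℤₚ.≤-reflexive (sym (trans (reorder (double m)) (X²^-low m j _)))
    where
    reorder : monomial e i m q ≈ X² ^ i ⊠ (p ^ e ⊠ (o ^ 2) ^ i ⊠ (ŵ ⊠ (o⁻¹ ⊠ (o⁻¹ ^ 2) ^ m) ⊠ p⁻¹ ^ q))
    reorder = R.trans (R.*-congʳ {rest} (R.*-congˡ {p ^ e} (^-distrib-* X² (o ^ 2) i)))
      (solve 4 (λ p x o w → p :* (x :* o) :* w := x :* (p :* o :* w)) R.refl (p ^ e) (X² ^ i) ((o ^ 2) ^ i) rest)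
      where
      rest = ŵ ⊠ (o⁻¹ ⊠ (o⁻¹ ^ 2) ^ m) ⊠ p⁻¹ ^ q

  -- Up to sign and a power of y, the coefficient of dy in (c₂ J - c₁) J ^ (m - 2) dJ / (1 + y²) ^ N,
  -- where J = (1 + y²)⁴ / (y² (1 - y²)²) and N + 5 = q + 4 m.
  kernel : (c₁ c₂ : ℤ) (m q : ℕ) → Series
  kernel c₁ c₂ m q = (const c₂ ⊠ p ^ 4 ⊞ const c₁ ⊠ (X² ⊠ o ^ 2)) ⊠ (ŵ ⊠ (o⁻¹ ⊠ (o⁻¹ ^ 2) ^ m) ⊠ p⁻¹ ^ q)

  -- The Chebyshev expansion and the sign of the residue

  0≤+ : ∀ {a b} → 0ℤ ≤ a → 0ℤ ≤ b → 0ℤ ≤ a + b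
  0≤+ = ℤₚ.+-mono-≤

  0≤* : ∀ {a b} → 0ℤ ≤ a → 0ℤ ≤ b → 0ℤ ≤ a * b
  0≤* {a} {b} p q = subst (_≤ a * b) (ℤₚ.*-zeroʳ a) (ℤₚ.*-monoˡ-≤-nonNeg a {{ℤ.nonNegative p}} q)

  -- Homogeneous polynomials with non-negative coefficients in p⁴ and 64 X² o². The index is the
  -- degree, needed later to keep e + 4i constant along the terms.
  data Cone : ℕ → Series → Set where
    one  : Cone 0 (const 1ℤ)
    add  : ∀ {l f g} → Cone l f → Cone l g → Cone l (f ⊞ g)
    mulp : ∀ {l f} → Cone l f → Cone (suc l) (p ^ 4 ⊠ f)
    mulx : ∀ {l f} → Cone l f → Cone (suc l) (const (+ 64) ⊠ (X² ⊠ o ^ 2) ⊠ f)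
    resp : ∀ {l f g} → f ≈ g → Cone l f → Cone l g

  α ᾱ : Series
  α = const 1ℤ ⊞ X
  ᾱ = const 1ℤ ⊞ ⊟ X

  -- A homogenised Chebyshev polynomial: since α⁸ ᾱ⁸ is the square of p⁴, this is 2 p^(4l) T_l(x)
  -- with x = (α⁸ + ᾱ⁸) / (2 p⁴) = 1 + 32 X² o² / p⁴.
  trace : ℕ → Series
  trace l = (α ^ 8) ^ l ⊞ (ᾱ ^ 8) ^ l

  α⁸+ᾱ⁸ : α ^ 8 ⊞ ᾱ ^ 8 ≈ const (+ 2) ⊠ p ^ 4 ⊞ const (+ 64) ⊠ (X² ⊠ o ^ 2)
  α⁸+ᾱ⁸ = solve 1 (λ x → (con 1ℤ :+ x) :^ 8 :+ (con 1ℤ :- x) :^ 8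
    := con (+ 2) :* (con 1ℤ :- x :* x) :^ 4 :+ con (+ 64) :* (x :* x :* (con 1ℤ :+ x :* x) :^ 2)) R.refl X

  α⁸*ᾱ⁸ : α ^ 8 ⊠ ᾱ ^ 8 ≈ p ^ 4 ⊠ p ^ 4
  α⁸*ᾱ⁸ = solve 1 (λ x → (con 1ℤ :+ x) :^ 8 :* (con 1ℤ :- x) :^ 8
    := (con 1ℤ :- x :* x) :^ 4 :* (con 1ℤ :- x :* x) :^ 4) R.refl X

  -- The recurrence of the traces has a negative term. With D = p⁴, x = 64 X² o² and δ_l = trace (l
  -- + 1) - D trace l it becomes δ_(l+1) = D δ_l + x trace (l + 1), which is free of minus signs;
  -- hence the mutual induction with `step-cone`.
  trace-cone : ∀ l → Cone l (trace l)
  step-cone  : ∀ l → Cone (suc l) (trace (suc l) ⊞ ⊟ (p ^ 4 ⊠ trace l))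

  trace-cone zero    = add one one
  trace-cone (suc l) = resp (solve 2 (λ a b → a :- b :+ b := a) R.refl (trace (suc l)) (p ^ 4 ⊠ trace l))
    (add (step-cone l) (mulp (trace-cone l)))

  step-cone zero    = resp eq (mulx one)
    where
    eq : const (+ 64) ⊠ (X² ⊠ o ^ 2) ⊠ const 1ℤ ≈ trace 1 ⊞ ⊟ (p ^ 4 ⊠ trace 0)
    eq = R.trans (solve 2 (λ x p → x :* con 1ℤ := con (+ 2) :* p :+ x :- p :* (con 1ℤ :+ con 1ℤ)) R.refl (const (+ 64) ⊠ (X² ⊠ o ^ 2)) (p ^ 4))
      (R.+-congʳ {⊟ (p ^ 4 ⊠ trace 0)} (R.trans (R.sym α⁸+ᾱ⁸) (solve 2 (λ a b → a :+ b := a :* con 1ℤ :+ b :* con 1ℤ) R.refl (α ^ 8) (ᾱ ^ 8))))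
  step-cone (suc l) = resp eq (add (mulp (step-cone l)) (mulx (trace-cone (suc l))))
    where
    a = α ^ 8
    b = ᾱ ^ 8
    u = a ^ l
    v = b ^ l
    x = const (+ 64) ⊠ (X² ⊠ o ^ 2)
    D = p ^ 4
    eq : D ⊠ (trace (suc l) ⊞ ⊟ (D ⊠ trace l)) ⊞ x ⊠ trace (suc l) ≈ trace (suc (suc l)) ⊞ ⊟ (D ⊠ trace (suc l))
    eq = begin
      D ⊠ (trace (suc l) ⊞ ⊟ (D ⊠ trace l)) ⊞ x ⊠ trace (suc l)
        ≈⟨ solve 6 (λ a b u v x D → D :* (a :* u :+ b :* v :- D :* (u :+ v)) :+ x :* (a :* u :+ b :* v)
             := (con (+ 2) :* D :+ x) :* (a :* u :+ b :* v) :- D :* D :* (u :+ v) :- D :* (a :* u :+ b :* v)) R.refl a b u v x D ⟩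
      (const (+ 2) ⊠ D ⊞ x) ⊠ trace (suc l) ⊞ ⊟ (D ⊠ D ⊠ trace l) ⊞ ⊟ (D ⊠ trace (suc l))
        ≈⟨ R.+-congʳ {⊟ (D ⊠ trace (suc l))} (R.+-cong (R.*-congʳ {trace (suc l)} α⁸+ᾱ⁸) (R.-‿cong (R.*-congʳ {trace l} α⁸*ᾱ⁸))) ⟨
      (a ⊞ b) ⊠ trace (suc l) ⊞ ⊟ (a ⊠ b ⊠ trace l) ⊞ ⊟ (D ⊠ trace (suc l))
        ≈⟨ solve 5 (λ a b u v D → (a :+ b) :* (a :* u :+ b :* v) :- a :* b :* (u :+ v) :- D :* (a :* u :+ b :* v)
             := a :* (a :* u) :+ b :* (b :* v) :- D :* (a :* u :+ b :* v)) R.refl a b u v D ⟩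
      trace (suc (suc l)) ⊞ ⊟ (D ⊠ trace (suc l)) ∎

  α*ᾱ : α ⊠ ᾱ ≈ p
  α*ᾱ = solve 1 (λ x → (con 1ℤ :+ x) :* (con 1ℤ :- x) := con 1ℤ :- x :* x) R.refl X

  module _ (c₁ c₂ : ℤ) (0≤c₁ : 0ℤ ≤ c₁) (0≤c₂ : 0ℤ ≤ c₂) (m q : ℕ) where

    pairing : Series → ℤ
    pairing f = (f ⊠ kernel c₁ c₂ (suc m) q) (double (suc m))

    pairing-cong : ∀ {f g} → f ≈ g → pairing f ≡ pairing g
    pairing-cong eq = R.*-congʳ {kernel c₁ c₂ (suc m) q} eq (double (suc m))

    -- The two summands of the kernel raise e by 4 or i by 1, and both changes agree with passing
    -- from m to m + 1. The first contributes c₂ when i = m + 1, the second c₁ when i = m.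
    pairing-basis : ∀ e i → suc (e ℕ.+ 4 ℕ.* i) ≡ q ℕ.+ 4 ℕ.* m → 0ℤ ≤ pairing (p ^ e ⊠ (X² ⊠ o ^ 2) ^ i)
    pairing-basis e i eq = subst (0ℤ ≤_) (sym (split (double (suc m))))
      (0≤+ (0≤scale 0≤c₂ (monomial-nonneg (4 ℕ.+ e) i (suc m) q (lem₁ e i q m eq)))
           (0≤scale 0≤c₁ (monomial-nonneg e (suc i) (suc m) q (lem₂ e i q m eq))))
      where
      rest = ŵ ⊠ (o⁻¹ ⊠ (o⁻¹ ^ 2) ^ suc m) ⊠ p⁻¹ ^ q
      split : p ^ e ⊠ (X² ⊠ o ^ 2) ^ i ⊠ kernel c₁ c₂ (suc m) q ≈ const c₂ ⊠ monomial (4 ℕ.+ e) i (suc m) q ⊞ const c₁ ⊠ monomial e (suc i) (suc m) q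
      split = R.trans
        (solve 7 (λ pe xi k₁ k₂ p x w → pe :* xi :* ((k₂ :* p :^ 4 :+ k₁ :* x) :* w) := k₂ :* (p :^ 4 :* pe :* xi :* w) :+ k₁ :* (pe :* (x :* xi) :* w)) R.refl
          (p ^ e) ((X² ⊠ o ^ 2) ^ i) (const c₁) (const c₂) p (X² ⊠ o ^ 2) rest)
        (R.+-congʳ {const c₁ ⊠ monomial e (suc i) (suc m) q} (R.*-congˡ {const c₂} (R.*-congʳ {rest} (R.*-congʳ {(X² ⊠ o ^ 2) ^ i} (R.sym (^-homo-* p 4 e))))))
      0≤scale : ∀ {c f} → 0ℤ ≤ c → 0ℤ ≤ f (double (suc m)) → 0ℤ ≤ (const c ⊠ f) (double (suc m))
      0≤scale {c} {f} c≥0 f≥0 = subst (0ℤ ≤_) (sym (const-⊠ c f (double (suc m)))) (0≤* c≥0 f≥0)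
      lem₁ : ∀ e i q m → suc (e ℕ.+ 4 ℕ.* i) ≡ q ℕ.+ 4 ℕ.* m → suc (4 ℕ.+ e ℕ.+ 4 ℕ.* i) ≡ q ℕ.+ 4 ℕ.* suc m
      lem₁ e i q m eq = trans (cong (4 ℕ.+_) eq) (lem q m)
        where
        lem : ∀ q m → 4 ℕ.+ (q ℕ.+ 4 ℕ.* m) ≡ q ℕ.+ 4 ℕ.* suc m
        lem = ℕ-solve-∀
      lem₂ : ∀ e i q m → suc (e ℕ.+ 4 ℕ.* i) ≡ q ℕ.+ 4 ℕ.* m → suc (e ℕ.+ 4 ℕ.* suc i) ≡ q ℕ.+ 4 ℕ.* suc m
      lem₂ e i q m eq = trans (lem e i) (lem₁ e i q m eq)
        where
        lem : ∀ e i → suc (e ℕ.+ 4 ℕ.* suc i) ≡ suc (4 ℕ.+ e ℕ.+ 4 ℕ.* i)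
        lem = ℕ-solve-∀

    -- Stated for all e and i because `mulp` and `mulx` move their factor from the cone element into
    -- the monomial.
    pairing-cone : ∀ {l f} → Cone l f → ∀ e i → suc (e ℕ.+ 4 ℕ.* (l ℕ.+ i)) ≡ q ℕ.+ 4 ℕ.* m → 0ℤ ≤ pairing (p ^ e ⊠ (X² ⊠ o ^ 2) ^ i ⊠ f)
    pairing-cone one e i eq = subst (0ℤ ≤_) (pairing-cong {b} {b ⊠ const 1ℤ} (R.sym (R.*-identityʳ b))) (pairing-basis e i eq)
      where
      b = p ^ e ⊠ (X² ⊠ o ^ 2) ^ i
    pairing-cone (add {l} {f} {g} cf cg) e i eq = subst (0ℤ ≤_) (sym (split (double (suc m)))) (0≤+ (pairing-cone cf e i eq) (pairing-cone cg e i eq))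
      where
      split : p ^ e ⊠ (X² ⊠ o ^ 2) ^ i ⊠ (f ⊞ g) ⊠ kernel c₁ c₂ (suc m) q ≈ p ^ e ⊠ (X² ⊠ o ^ 2) ^ i ⊠ f ⊠ kernel c₁ c₂ (suc m) q ⊞ p ^ e ⊠ (X² ⊠ o ^ 2) ^ i ⊠ g ⊠ kernel c₁ c₂ (suc m) q
      split = solve 4 (λ b f g k → b :* (f :+ g) :* k := b :* f :* k :+ b :* g :* k) R.refl (p ^ e ⊠ (X² ⊠ o ^ 2) ^ i) f g (kernel c₁ c₂ (suc m) q)
    pairing-cone (mulp {l} {f} cf) e i eq = subst (0ℤ ≤_) (pairing-cong reorder) (pairing-cone cf (4 ℕ.+ e) i (trans (lem e l i) eq))
      where
      lem : ∀ e l i → suc (4 ℕ.+ e ℕ.+ 4 ℕ.* (l ℕ.+ i)) ≡ suc (e ℕ.+ 4 ℕ.* (suc l ℕ.+ i))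
      lem = ℕ-solve-∀
      reorder : p ^ (4 ℕ.+ e) ⊠ (X² ⊠ o ^ 2) ^ i ⊠ f ≈ p ^ e ⊠ (X² ⊠ o ^ 2) ^ i ⊠ (p ^ 4 ⊠ f)
      reorder = R.trans (R.*-congʳ {f} (R.*-congʳ {(X² ⊠ o ^ 2) ^ i} (^-homo-* p 4 e)))
        (solve 4 (λ a b c d → a :* b :* c :* d := b :* c :* (a :* d)) R.refl (p ^ 4) (p ^ e) ((X² ⊠ o ^ 2) ^ i) f)
    pairing-cone (mulx {l} {f} cf) e i eq = subst (0ℤ ≤_) (trans (sym (const-⊠ (+ 64) (p ^ e ⊠ (X² ⊠ o ^ 2) ^ suc i ⊠ f ⊠ kernel c₁ c₂ (suc m) q) (double (suc m)))) (reorder (double (suc m))))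
        (0≤* {+ 64} (+≤+ ℕ.z≤n) (pairing-cone cf e (suc i) (trans (lem e l i) eq)))
      where
      lem : ∀ e l i → suc (e ℕ.+ 4 ℕ.* (l ℕ.+ suc i)) ≡ suc (e ℕ.+ 4 ℕ.* (suc l ℕ.+ i))
      lem = ℕ-solve-∀
      reorder : const (+ 64) ⊠ (p ^ e ⊠ (X² ⊠ o ^ 2) ^ suc i ⊠ f ⊠ kernel c₁ c₂ (suc m) q) ≈ p ^ e ⊠ (X² ⊠ o ^ 2) ^ i ⊠ (const (+ 64) ⊠ (X² ⊠ o ^ 2) ⊠ f) ⊠ kernel c₁ c₂ (suc m) q
      reorder = solve 6 (λ c pe x xi f k → c :* (pe :* (x :* xi) :* f :* k) := pe :* xi :* (c :* x :* f) :* k) R.refl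
        (const (+ 64)) (p ^ e) (X² ⊠ o ^ 2) ((X² ⊠ o ^ 2) ^ i) f (kernel c₁ c₂ (suc m) q)
    pairing-cone (resp {l} {f} {g} f≈g cf) e i eq = subst (0ℤ ≤_) (pairing-cong (R.*-congˡ {p ^ e ⊠ (X² ⊠ o ^ 2) ^ i} f≈g)) (pairing-cone cf e i eq)

    -- Extracting (α ᾱ)^e = p^e from both conjugate summands leaves `trace l`.
    pairing-trace : ∀ e l → suc (e ℕ.+ 4 ℕ.* l) ≡ q ℕ.+ 4 ℕ.* m → 0ℤ ≤ pairing (α ^ (e ℕ.+ 8 ℕ.* l) ⊠ ᾱ ^ e ⊞ ᾱ ^ (e ℕ.+ 8 ℕ.* l) ⊠ α ^ e)
    pairing-trace e l eq = subst (0ℤ ≤_) (pairing-cong (R.sym expand)) (pairing-cone (trace-cone l) e 0 (trans (cong (λ k → suc (e ℕ.+ 4 ℕ.* k)) (ℕₚ.+-identityʳ l)) eq))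
      where
      power : ∀ f → f ^ (e ℕ.+ 8 ℕ.* l) ≈ f ^ e ⊠ (f ^ 8) ^ l
      power f = R.trans (^-homo-* f e (8 ℕ.* l)) (R.*-congˡ {f ^ e} (R.sym (^-assocʳ f 8 l)))
      expand : α ^ (e ℕ.+ 8 ℕ.* l) ⊠ ᾱ ^ e ⊞ ᾱ ^ (e ℕ.+ 8 ℕ.* l) ⊠ α ^ e ≈ p ^ e ⊠ (X² ⊠ o ^ 2) ^ 0 ⊠ trace l
      expand = begin
        α ^ (e ℕ.+ 8 ℕ.* l) ⊠ ᾱ ^ e ⊞ ᾱ ^ (e ℕ.+ 8 ℕ.* l) ⊠ α ^ e
          ≈⟨ R.+-cong (R.*-congʳ {ᾱ ^ e} (power α)) (R.*-congʳ {α ^ e} (power ᾱ)) ⟩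
        α ^ e ⊠ (α ^ 8) ^ l ⊠ ᾱ ^ e ⊞ ᾱ ^ e ⊠ (ᾱ ^ 8) ^ l ⊠ α ^ e
          ≈⟨ solve 4 (λ a b u v → a :* u :* b :+ b :* v :* a := a :* b :* con 1ℤ :* (u :+ v)) R.refl (α ^ e) (ᾱ ^ e) ((α ^ 8) ^ l) ((ᾱ ^ 8) ^ l) ⟩
        α ^ e ⊠ ᾱ ^ e ⊠ const 1ℤ ⊠ trace l
          ≈⟨ R.*-congʳ {trace l} (R.*-congʳ {const 1ℤ} (R.trans (R.sym (^-distrib-* α ᾱ e)) (^-congˡ e α*ᾱ))) ⟩
        p ^ e ⊠ const 1ℤ ⊠ trace l ∎

  -- The coefficients b_s of (1 - Z)^(-Q) (1 + Z)^(-q)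

  sgn : ℕ → ℤ
  sgn zero    = 1ℤ
  sgn (suc n) = - sgn n

  sgn-square : ∀ n → sgn n * sgn n ≡ 1ℤ
  sgn-square zero    = refl
  sgn-square (suc n) = trans (lem (sgn n)) (sgn-square n)
    where
    lem : ∀ a → - a * - a ≡ a * a
    lem = solve-∀

  -- If f (X) = g (- X²), then half f = g.
  half : Series → Series
  half f s = sgn s * f (double s)

  -- Multiplication by Z^i. The default 0 stands for coefficients of negative index, so recurrences
  -- hold without boundary cases.
  back : ℕ → Series → Series
  back zero    f s       = f s
  back (suc i) f zero    = 0ℤ
  back (suc i) f (suc s) = back i f s

  half-X²^ : ∀ i f s → half (X² ^ i ⊠ f) s ≡ sgn i * back i (half f) s
  half-X²^ zero    f s       = trans (cong (sgn s *_) (⊠-identityˡ f (double s))) (sym (ℤₚ.*-identityˡ _))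
  half-X²^ (suc i) f zero    = sym (ℤₚ.*-zeroʳ (- sgn i))
  half-X²^ (suc i) f (suc s) = begin′
    - sgn s * (X² ^ suc i ⊠ f) (double (suc s))
      ≡⟨ cong (- sgn s *_) (trans (⊠-assoc X² (X² ^ i) f (double (suc s))) (X²-shift (X² ^ i ⊠ f) (double s))) ⟩
    - sgn s * (X² ^ i ⊠ f) (double s)      ≡⟨ ℤₚ.neg-distribˡ-* (sgn s) _ ⟨
    - half (X² ^ i ⊠ f) s                  ≡⟨ cong -_ (half-X²^ i f s) ⟩
    - (sgn i * back i (half f) s)          ≡⟨ ℤₚ.neg-distribˡ-* (sgn i) _ ⟩
    - sgn i * back i (half f) s            ∎′
    where open ≡-Reasoning renaming (begin_ to begin′_; _∎ to _∎′)

  power : (Q q : ℕ) → Series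
  power Q q = o⁻¹ ^ Q ⊠ p⁻¹ ^ q

  -- With Z = -X² the series `o` and `p` become 1 - Z and 1 + Z, so these are the numbers b_s.
  coeff : (Q q : ℕ) → ℕ → ℤ
  coeff Q q = half (power Q q)

  power-zero : ∀ Q q → power Q q 0 ≡ 1ℤ
  power-zero Q q = cong₂ _*_ (lem o⁻¹ refl Q) (lem p⁻¹ refl q)
    where
    lem : ∀ f → f 0 ≡ 1ℤ → ∀ k → (f ^ k) 0 ≡ 1ℤ
    lem f f0 zero    = refl
    lem f f0 (suc k) = cong₂ _*_ f0 (lem f f0 k)

  coeff-zero : ∀ Q q → coeff Q q 0 ≡ 1ℤ
  coeff-zero Q q = trans (ℤₚ.*-identityˡ _) (power-zero Q q)

  -- The logarithmic derivative -2Q X²/o + 2q X²/p, multiplied by p o = 1 - X⁴. Comparing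
  -- coefficients gives the three term recurrence `coeff-rec`.
  power-ode : ∀ Q q → let f = power Q q in
    θ f ⊞ ⊟ (X² ⊠ (X² ⊠ θ f)) ≈ X² ⊠ (const (+ 2 * (+ q - + Q)) ⊠ f) ⊞ X² ⊠ (X² ⊠ (const (+ 2 * (+ Q + + q)) ⊠ f))
  power-ode Q q = begin
    θ f ⊞ ⊟ (X² ⊠ (X² ⊠ θ f))
      ≈⟨ solve 2 (λ x t → t :- x :* (x :* t) := (con 1ℤ :- x) :* (con 1ℤ :+ x) :* t) R.refl X² (θ f) ⟩
    p ⊠ o ⊠ θ f
      ≈⟨ R.*-congˡ {p ⊠ o} (dlog-⊠ {o⁻¹ ^ Q} {p⁻¹ ^ q} (dlog-^ (dlog-inverse {o} {o⁻¹} o-inverse dlog-o) Q) (dlog-^ (dlog-inverse {p} {p⁻¹} p-inverse dlog-p) q)) ⟩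
    p ⊠ o ⊠ ((const (+ Q) ⊠ ⊟ (const (+ 2) ⊠ X² ⊠ o⁻¹) ⊞ const (+ q) ⊠ ⊟ ⊟ (const (+ 2) ⊠ X² ⊠ p⁻¹)) ⊠ f)
      ≈⟨ solve 8 (λ p o Q q x o′ p′ f → p :* o :* ((Q :* (:- (con (+ 2) :* x :* o′)) :+ q :* (:- (:- (con (+ 2) :* x :* p′)))) :* f)
           := con (+ 2) :* x :* (q :* o :* (p :* p′) :- Q :* p :* (o :* o′)) :* f) R.refl p o (const (+ Q)) (const (+ q)) X² o⁻¹ p⁻¹ f ⟩
    const (+ 2) ⊠ X² ⊠ (const (+ q) ⊠ o ⊠ (p ⊠ p⁻¹) ⊞ ⊟ (const (+ Q) ⊠ p ⊠ (o ⊠ o⁻¹))) ⊠ f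
      ≈⟨ R.*-congʳ {f} (R.*-congˡ {const (+ 2) ⊠ X²} (R.+-cong (R.*-congˡ {const (+ q) ⊠ o} p-inverse) (R.-‿cong (R.*-congˡ {const (+ Q) ⊠ p} o-inverse)))) ⟩
    const (+ 2) ⊠ X² ⊠ (const (+ q) ⊠ o ⊠ const 1ℤ ⊞ ⊟ (const (+ Q) ⊠ p ⊠ const 1ℤ)) ⊠ f
      ≈⟨ solve 4 (λ Q q x f → con (+ 2) :* x :* (q :* (con 1ℤ :+ x) :* con 1ℤ :- Q :* (con 1ℤ :- x) :* con 1ℤ) :* f
           := x :* (con (+ 2) :* (q :- Q) :* f) :+ x :* (x :* (con (+ 2) :* (Q :+ q) :* f))) R.refl (const (+ Q)) (const (+ q)) X² f ⟩
    X² ⊠ (const (+ 2) ⊠ (const (+ q) ⊞ ⊟ const (+ Q)) ⊠ f) ⊞ X² ⊠ (X² ⊠ (const (+ 2) ⊠ (const (+ Q) ⊞ const (+ q)) ⊠ f))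
      ≈⟨ R.+-cong (R.*-congˡ {X²} (R.*-congʳ {f} const₁)) (R.*-congˡ {X²} (R.*-congˡ {X²} (R.*-congʳ {f} const₂))) ⟩
    X² ⊠ (const (+ 2 * (+ q - + Q)) ⊠ f) ⊞ X² ⊠ (X² ⊠ (const (+ 2 * (+ Q + + q)) ⊠ f)) ∎
    where
    f = power Q q
    module H = _-Raw-AlmostCommutative⟶_ constHom
    const₁ : const (+ 2) ⊠ (const (+ q) ⊞ ⊟ const (+ Q)) ≈ const (+ 2 * (+ q - + Q))
    const₁ = R.sym (R.trans (H.*-homo (+ 2) (+ q - + Q)) (R.*-congˡ {const (+ 2)} (R.trans (H.+-homo (+ q) (- + Q)) (R.+-congˡ {const (+ q)} (H.-‿homo (+ Q))))))
    const₂ : const (+ 2) ⊠ (const (+ Q) ⊞ const (+ q)) ≈ const (+ 2 * (+ Q + + q))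
    const₂ = R.sym (R.trans (H.*-homo (+ 2) (+ Q + + q)) (R.*-congˡ {const (+ 2)} (H.+-homo (+ Q) (+ q))))

  coeff-one : ∀ Q q → coeff Q q 1 ≡ + Q - + q
  coeff-one Q q = ℤₚ.*-cancelˡ-≡ (+ 2) _ _ (begin′
    + 2 * (- 1ℤ * f 2)                                   ≡⟨ lem₁ (f 2) ⟩
    - (+ 2 * f 2 + - 0ℤ)                                 ≡⟨ cong (λ z → - (+ 2 * f 2 + - z)) (trans (X²-shift (X² ⊠ θ f) 0) (X²-zero (θ f))) ⟨
    - (θ f ⊞ ⊟ (X² ⊠ (X² ⊠ θ f))) 2                      ≡⟨ cong -_ (power-ode Q q 2) ⟩
    - ((X² ⊠ (const c ⊠ f)) 2 + (X² ⊠ (X² ⊠ (const c′ ⊠ f))) 2)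
      ≡⟨ cong -_ (cong₂ _+_ (trans (X²-shift (const c ⊠ f) 0) (trans (const-⊠ c f 0) (cong (c *_) (power-zero Q q)))) (trans (X²-shift (X² ⊠ (const c′ ⊠ f)) 0) (X²-zero (const c′ ⊠ f)))) ⟩
    - (c * 1ℤ + 0ℤ)                                      ≡⟨ lem₂ (+ Q) (+ q) ⟩
    + 2 * (+ Q - + q)                                    ∎′)
    where
    open ≡-Reasoning renaming (begin_ to begin′_; _∎ to _∎′)
    f  = power Q q
    c  = + 2 * (+ q - + Q)
    c′ = + 2 * (+ Q + + q)
    lem₁ : ∀ x → + 2 * (- 1ℤ * x) ≡ - (+ 2 * x + - 0ℤ)
    lem₁ = solve-∀
    lem₂ : ∀ x y → - (+ 2 * (y - x) * 1ℤ + 0ℤ) ≡ + 2 * (x - y)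
    lem₂ = solve-∀

  coeff-rec : ∀ Q q s → + suc (suc s) * coeff Q q (suc (suc s)) ≡ (+ Q - + q) * coeff Q q (suc s) + (+ Q + + q + + s) * coeff Q q s
  coeff-rec Q q s = ℤₚ.*-cancelˡ-≡ (+ 2) _ _ (begin′
    + 2 * (+ suc (suc s) * (- - ε * f₄))
      ≡⟨ lem₁ (+ s) ε f₀ f₄ ⟩
    ε * ((+ 4 + + 2 * + s) * f₄ + - (+ 2 * + s * f₀)) + + 2 * + s * (ε * f₀)
      ≡⟨ cong (λ z → ε * ((+ 4 + z) * f₄ + - (z * f₀)) + + 2 * + s * (ε * f₀)) (sym (double-+ s)) ⟩
    ε * ((+ 4 + + double s) * f₄ + - (+ double s * f₀)) + + 2 * + s * (ε * f₀)
      ≡⟨ cong (λ z → ε * (θ f (4 ℕ.+ double s) + - z) + + 2 * + s * (ε * f₀))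
           (trans (X²-shift (X² ⊠ θ f) (2 ℕ.+ double s)) (X²-shift (θ f) (double s))) ⟨
    ε * (θ f ⊞ ⊟ (X² ⊠ (X² ⊠ θ f))) (4 ℕ.+ double s) + + 2 * + s * (ε * f₀)
      ≡⟨ cong (λ z → ε * z + + 2 * + s * (ε * f₀)) (power-ode Q q (4 ℕ.+ double s)) ⟩
    ε * ((X² ⊠ (const c ⊠ f)) (4 ℕ.+ double s) + (X² ⊠ (X² ⊠ (const c′ ⊠ f))) (4 ℕ.+ double s)) + + 2 * + s * (ε * f₀)
      ≡⟨ cong₂ (λ y z → ε * (y + z) + + 2 * + s * (ε * f₀))
           (trans (X²-shift (const c ⊠ f) (2 ℕ.+ double s)) (const-⊠ c f (2 ℕ.+ double s)))
           (trans (X²-shift (X² ⊠ (const c′ ⊠ f)) (2 ℕ.+ double s)) (trans (X²-shift (const c′ ⊠ f) (double s)) (const-⊠ c′ f (double s)))) ⟩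
    ε * (c * f₂ + c′ * f₀) + + 2 * + s * (ε * f₀)
      ≡⟨ lem₂ (+ Q) (+ q) (+ s) ε f₀ f₂ ⟩
    + 2 * ((+ Q - + q) * (- ε * f₂) + (+ Q + + q + + s) * (ε * f₀)) ∎′)
    where
    open ≡-Reasoning renaming (begin_ to begin′_; _∎ to _∎′)
    f  = power Q q
    ε  = sgn s
    f₀ = f (double s)
    f₂ = f (2 ℕ.+ double s)
    f₄ = f (4 ℕ.+ double s)
    c  = + 2 * (+ q - + Q)
    c′ = + 2 * (+ Q + + q)
    lem₁ : ∀ s ε f₀ f₄ → + 2 * ((+ 2 + s) * (- - ε * f₄)) ≡ ε * ((+ 4 + + 2 * s) * f₄ + - (+ 2 * s * f₀)) + + 2 * s * (ε * f₀)
    lem₁ = solve-∀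
    lem₂ : ∀ Q q s ε f₀ f₂ → ε * (+ 2 * (q - Q) * f₂ + + 2 * (Q + q) * f₀) + + 2 * s * (ε * f₀)
      ≡ + 2 * ((Q - q) * (- ε * f₂) + (Q + q + s) * (ε * f₀))
    lem₂ = solve-∀

  -- Lowering Q by one multiplies the series by 1 - Z. This makes b_s increasing in s as soon as the
  -- coefficients for the smaller exponent are non-negative.
  coeff-diff : ∀ Q q s → coeff (suc Q) q (suc s) ≡ coeff (suc Q) q s + coeff Q q (suc s)
  coeff-diff Q q s = begin′
    - sgn s * f (2 ℕ.+ double s)
      ≡⟨ lem (sgn s) (f (2 ℕ.+ double s)) (f (double s)) ⟩
    sgn s * f (double s) + - sgn s * (f (2 ℕ.+ double s) + f (double s))
      ≡⟨ cong (λ z → sgn s * f (double s) + - sgn s * (f (2 ℕ.+ double s) + z)) (X²-shift f (double s)) ⟨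
    sgn s * f (double s) + - sgn s * (f ⊞ X² ⊠ f) (2 ℕ.+ double s)
      ≡⟨ cong (λ z → sgn s * f (double s) + - sgn s * z) (cancel (2 ℕ.+ double s)) ⟩
    sgn s * f (double s) + - sgn s * power Q q (2 ℕ.+ double s) ∎′
    where
    open ≡-Reasoning renaming (begin_ to begin′_; _∎ to _∎′)
    f = power (suc Q) q
    lem : ∀ ε a b → - ε * a ≡ ε * b + - ε * (a + b)
    lem = solve-∀
    cancel : f ⊞ X² ⊠ f ≈ power Q q
    cancel = R.trans (solve 4 (λ x o′ y z → o′ :* y :* z :+ x :* (o′ :* y :* z) := ((con 1ℤ :+ x) :* o′) :* (y :* z)) R.refl X² o⁻¹ (o⁻¹ ^ Q) (p⁻¹ ^ q))
      (R.trans (R.*-congʳ {power Q q} o-inverse) (R.*-identityˡ (power Q q)))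

  -- These are the coefficients of F(Z) = (c₂ (1 + Z)⁴ - c₁ Z (1 - Z)²) (1 - 6Z + Z²), which is
  -- palindromic.
  kernel-half : ∀ c₁ c₂ m q s → let b = coeff (suc (double m)) q in
    half (kernel c₁ c₂ m q) s ≡
      c₂ * b s - (c₁ + + 2 * c₂) * back 1 b s + (+ 8 * c₁ - + 17 * c₂) * back 2 b s - (+ 14 * c₁ + + 28 * c₂) * back 3 b s
      + (+ 8 * c₁ - + 17 * c₂) * back 4 b s - (c₁ + + 2 * c₂) * back 5 b s + c₂ * back 6 b s
  kernel-half c₁ c₂ m q s = begin′
    half (kernel c₁ c₂ m q) s
      ≡⟨ cong (sgn s *_) (expand (double s)) ⟩
    sgn s * (c₂ * f₀ + (c₁ + + 2 * c₂) * f₁ + (+ 8 * c₁ - + 17 * c₂) * f₂ + (+ 14 * c₁ + + 28 * c₂) * f₃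
      + (+ 8 * c₁ - + 17 * c₂) * f₄ + (c₁ + + 2 * c₂) * f₅ + c₂ * f₆)
      ≡⟨ lem₁ (sgn s) c₁ c₂ f₀ f₁ f₂ f₃ f₄ f₅ f₆ ⟩
    comb (sgn s * f₀) (sgn s * f₁) (sgn s * f₂) (sgn s * f₃) (sgn s * f₄) (sgn s * f₅) (sgn s * f₆)
      ≡⟨ comb-cong (half-X²^ 1 B s) (half-X²^ 2 B s) (half-X²^ 3 B s) (half-X²^ 4 B s) (half-X²^ 5 B s) (half-X²^ 6 B s) ⟩
    comb (b s) (-1ℤ * back 1 b s) (1ℤ * back 2 b s) (-1ℤ * back 3 b s) (1ℤ * back 4 b s) (-1ℤ * back 5 b s) (1ℤ * back 6 b s)
      ≡⟨ lem₂ c₁ c₂ (b s) (back 1 b s) (back 2 b s) (back 3 b s) (back 4 b s) (back 5 b s) (back 6 b s) ⟩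
    c₂ * b s - (c₁ + + 2 * c₂) * back 1 b s + (+ 8 * c₁ - + 17 * c₂) * back 2 b s - (+ 14 * c₁ + + 28 * c₂) * back 3 b s
      + (+ 8 * c₁ - + 17 * c₂) * back 4 b s - (c₁ + + 2 * c₂) * back 5 b s + c₂ * back 6 b s ∎′
    where
    open ≡-Reasoning renaming (begin_ to begin′_; _∎ to _∎′)
    B = power (suc (double m)) q
    b = coeff (suc (double m)) q
    f₀ = B (double s)
    f₁ = (X² ^ 1 ⊠ B) (double s)
    f₂ = (X² ^ 2 ⊠ B) (double s)
    f₃ = (X² ^ 3 ⊠ B) (double s)
    f₄ = (X² ^ 4 ⊠ B) (double s)
    f₅ = (X² ^ 5 ⊠ B) (double s)
    f₆ = (X² ^ 6 ⊠ B) (double s)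
    comb : (y₀ y₁ y₂ y₃ y₄ y₅ y₆ : ℤ) → ℤ
    comb y₀ y₁ y₂ y₃ y₄ y₅ y₆ = c₂ * y₀ + (c₁ + + 2 * c₂) * y₁ + (+ 8 * c₁ - + 17 * c₂) * y₂ + (+ 14 * c₁ + + 28 * c₂) * y₃
      + (+ 8 * c₁ - + 17 * c₂) * y₄ + (c₁ + + 2 * c₂) * y₅ + c₂ * y₆
    comb-cong : ∀ {y₀ y₁ y₂ y₃ y₄ y₅ y₆ z₁ z₂ z₃ z₄ z₅ z₆} → y₁ ≡ z₁ → y₂ ≡ z₂ → y₃ ≡ z₃ → y₄ ≡ z₄ → y₅ ≡ z₅ → y₆ ≡ z₆ →
      comb y₀ y₁ y₂ y₃ y₄ y₅ y₆ ≡ comb y₀ z₁ z₂ z₃ z₄ z₅ z₆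
    comb-cong refl refl refl refl refl refl = refl
    lem₁ : ∀ ε c₁ c₂ f₀ f₁ f₂ f₃ f₄ f₅ f₆ →
      ε * (c₂ * f₀ + (c₁ + + 2 * c₂) * f₁ + (+ 8 * c₁ - + 17 * c₂) * f₂ + (+ 14 * c₁ + + 28 * c₂) * f₃
        + (+ 8 * c₁ - + 17 * c₂) * f₄ + (c₁ + + 2 * c₂) * f₅ + c₂ * f₆)
      ≡ c₂ * (ε * f₀) + (c₁ + + 2 * c₂) * (ε * f₁) + (+ 8 * c₁ - + 17 * c₂) * (ε * f₂) + (+ 14 * c₁ + + 28 * c₂) * (ε * f₃)
        + (+ 8 * c₁ - + 17 * c₂) * (ε * f₄) + (c₁ + + 2 * c₂) * (ε * f₅) + c₂ * (ε * f₆)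
    lem₁ = solve-∀
    lem₂ : ∀ c₁ c₂ b₀ b₁ b₂ b₃ b₄ b₅ b₆ →
      c₂ * b₀ + (c₁ + + 2 * c₂) * (-1ℤ * b₁) + (+ 8 * c₁ - + 17 * c₂) * (1ℤ * b₂) + (+ 14 * c₁ + + 28 * c₂) * (-1ℤ * b₃)
        + (+ 8 * c₁ - + 17 * c₂) * (1ℤ * b₄) + (c₁ + + 2 * c₂) * (-1ℤ * b₅) + c₂ * (1ℤ * b₆)
      ≡ c₂ * b₀ - (c₁ + + 2 * c₂) * b₁ + (+ 8 * c₁ - + 17 * c₂) * b₂ - (+ 14 * c₁ + + 28 * c₂) * b₃
        + (+ 8 * c₁ - + 17 * c₂) * b₄ - (c₁ + + 2 * c₂) * b₅ + c₂ * b₆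
    lem₂ = solve-∀
    odd-power : ∀ m → o⁻¹ ⊠ (o⁻¹ ^ 2) ^ m ≈ o⁻¹ ^ suc (double m)
    odd-power zero    = R.refl
    odd-power (suc m) = R.trans (solve 2 (λ x y → x :* (x :^ 2 :* y) := x :* (x :* (x :* y))) R.refl o⁻¹ ((o⁻¹ ^ 2) ^ m))
      (R.*-congˡ {o⁻¹} (R.*-congˡ {o⁻¹} (odd-power m)))
    module H = _-Raw-AlmostCommutative⟶_ constHom
    expand : ∀ n → kernel c₁ c₂ m q n ≡ c₂ * B n + (c₁ + + 2 * c₂) * (X² ^ 1 ⊠ B) n + (+ 8 * c₁ - + 17 * c₂) * (X² ^ 2 ⊠ B) n
      + (+ 14 * c₁ + + 28 * c₂) * (X² ^ 3 ⊠ B) n + (+ 8 * c₁ - + 17 * c₂) * (X² ^ 4 ⊠ B) n + (c₁ + + 2 * c₂) * (X² ^ 5 ⊠ B) n + c₂ * (X² ^ 6 ⊠ B) n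
    expand n = begin′
      kernel c₁ c₂ m q n
        ≡⟨ R.*-congˡ {const c₂ ⊠ p ^ 4 ⊞ const c₁ ⊠ (X² ⊠ o ^ 2)} (R.*-congʳ {p⁻¹ ^ q} (R.*-congˡ {ŵ} (odd-power m))) n ⟩
      ((const c₂ ⊠ p ^ 4 ⊞ const c₁ ⊠ (X² ⊠ o ^ 2)) ⊠ (ŵ ⊠ o⁻¹ ^ suc (double m) ⊠ p⁻¹ ^ q)) n
        ≡⟨ solve 5 (λ k₁ k₂ x y z → (k₂ :* (con 1ℤ :- x) :^ 4 :+ k₁ :* (x :* (con 1ℤ :+ x) :^ 2)) :* ((con 1ℤ :+ con (+ 6) :* x :+ x :* x) :* y :* z)
             := k₂ :* (y :* z) :+ (k₁ :+ con (+ 2) :* k₂) :* (x :^ 1 :* (y :* z)) :+ (con (+ 8) :* k₁ :- con (+ 17) :* k₂) :* (x :^ 2 :* (y :* z))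
               :+ (con (+ 14) :* k₁ :+ con (+ 28) :* k₂) :* (x :^ 3 :* (y :* z)) :+ (con (+ 8) :* k₁ :- con (+ 17) :* k₂) :* (x :^ 4 :* (y :* z))
               :+ (k₁ :+ con (+ 2) :* k₂) :* (x :^ 5 :* (y :* z)) :+ k₂ :* (x :^ 6 :* (y :* z)))
             R.refl (const c₁) (const c₂) X² (o⁻¹ ^ suc (double m)) (p⁻¹ ^ q) n ⟩
      (const c₂ ⊠ B ⊞ k₁₂ ⊠ (X² ^ 1 ⊠ B) ⊞ k₈ ⊠ (X² ^ 2 ⊠ B) ⊞ k₁₄ ⊠ (X² ^ 3 ⊠ B) ⊞ k₈ ⊠ (X² ^ 4 ⊠ B) ⊞ k₁₂ ⊠ (X² ^ 5 ⊠ B) ⊞ const c₂ ⊠ (X² ^ 6 ⊠ B)) n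
        ≡⟨ cong₂ _+_ (cong₂ _+_ (cong₂ _+_ (cong₂ _+_ (cong₂ _+_ (cong₂ _+_ (const-⊠ c₂ B n)
             (by k₁₂≈ (X² ^ 1 ⊠ B))) (by k₈≈ (X² ^ 2 ⊠ B))) (by k₁₄≈ (X² ^ 3 ⊠ B))) (by k₈≈ (X² ^ 4 ⊠ B))) (by k₁₂≈ (X² ^ 5 ⊠ B))) (const-⊠ c₂ (X² ^ 6 ⊠ B) n) ⟩
      c₂ * B n + (c₁ + + 2 * c₂) * (X² ^ 1 ⊠ B) n + (+ 8 * c₁ - + 17 * c₂) * (X² ^ 2 ⊠ B) n
        + (+ 14 * c₁ + + 28 * c₂) * (X² ^ 3 ⊠ B) n + (+ 8 * c₁ - + 17 * c₂) * (X² ^ 4 ⊠ B) n + (c₁ + + 2 * c₂) * (X² ^ 5 ⊠ B) n + c₂ * (X² ^ 6 ⊠ B) n ∎′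
      where
      k₁₂ = const c₁ ⊞ const (+ 2) ⊠ const c₂
      k₈  = const (+ 8) ⊠ const c₁ ⊞ ⊟ (const (+ 17) ⊠ const c₂)
      k₁₄ = const (+ 14) ⊠ const c₁ ⊞ const (+ 28) ⊠ const c₂
      by : ∀ {k c} → const c ≈ k → ∀ f → (k ⊠ f) n ≡ c * f n
      by {k} {c} c≈k f = trans (sym (R.*-congʳ {f} c≈k n)) (const-⊠ c f n)
      k₁₂≈ : const (c₁ + + 2 * c₂) ≈ k₁₂
      k₁₂≈ = R.trans (H.+-homo c₁ (+ 2 * c₂)) (R.+-congˡ {const c₁} (H.*-homo (+ 2) c₂))
      k₈≈ : const (+ 8 * c₁ - + 17 * c₂) ≈ k₈
      k₈≈ = R.trans (H.+-homo (+ 8 * c₁) (- (+ 17 * c₂))) (R.+-cong (H.*-homo (+ 8) c₁) (R.trans (H.-‿homo (+ 17 * c₂)) (R.-‿cong (H.*-homo (+ 17) c₂))))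
      k₁₄≈ : const (+ 14 * c₁ + + 28 * c₂) ≈ k₁₄
      k₁₄≈ = R.trans (H.+-homo (+ 14 * c₁) (+ 28 * c₂)) (R.+-cong (H.*-homo (+ 14) c₁) (H.*-homo (+ 28) c₂))

-- Sums over binary words: Fourier inversion and Gauss sums

module Words where
  open import Data.Integer.Base using (_+_; _*_; -_; _-_; _≤_; _<_)
  open PowerSeries

  Σw : ∀ {n} → (Word n → ℤ) → ℤ
  Σw {zero}  F = F []
  Σw {suc n} F = Σw (λ x → F (false ∷ x)) + Σw (λ x → F (true ∷ x))

  Σw-cong : ∀ {n} {F G : Word n → ℤ} → (∀ x → F x ≡ G x) → Σw F ≡ Σw G
  Σw-cong {zero}  eq = eq []
  Σw-cong {suc n} eq = cong₂ _+_ (Σw-cong (λ x → eq (false ∷ x))) (Σw-cong (λ x → eq (true ∷ x)))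

  Σw-+ : ∀ {n} (F G : Word n → ℤ) → Σw (λ x → F x + G x) ≡ Σw F + Σw G
  Σw-+ {zero}  F G = refl
  Σw-+ {suc n} F G rewrite Σw-+ (λ x → F (false ∷ x)) (λ x → G (false ∷ x)) | Σw-+ (λ x → F (true ∷ x)) (λ x → G (true ∷ x)) =
    lem (Σw (λ x → F (false ∷ x))) (Σw (λ x → G (false ∷ x))) (Σw (λ x → F (true ∷ x))) (Σw (λ x → G (true ∷ x)))
    where
    lem : ∀ a b c d → a + b + (c + d) ≡ a + c + (b + d)
    lem = solve-∀

  Σw-*ˡ : ∀ {n} a (F : Word n → ℤ) → Σw (λ x → a * F x) ≡ a * Σw F
  Σw-*ˡ {zero}  a F = refl
  Σw-*ˡ {suc n} a F rewrite Σw-*ˡ a (λ x → F (false ∷ x)) | Σw-*ˡ a (λ x → F (true ∷ x)) =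
    sym (ℤₚ.*-distribˡ-+ a (Σw (λ x → F (false ∷ x))) (Σw (λ x → F (true ∷ x))))

  Σw-*ʳ : ∀ {n} a (F : Word n → ℤ) → Σw (λ x → F x * a) ≡ Σw F * a
  Σw-*ʳ a F = trans (Σw-cong (λ x → ℤₚ.*-comm (F x) a)) (trans (Σw-*ˡ a F) (ℤₚ.*-comm a (Σw F)))

  Σw-swap : ∀ {k n} (F : Word k → Word n → ℤ) → Σw (λ x → Σw (λ y → F x y)) ≡ Σw (λ y → Σw (λ x → F x y))
  Σw-swap {zero}  F = refl
  Σw-swap {suc k} F rewrite Σw-swap (λ x → F (false ∷ x)) | Σw-swap (λ x → F (true ∷ x)) =
    sym (Σw-+ (λ y → Σw (λ x → F (false ∷ x) y)) (λ y → Σw (λ x → F (true ∷ x) y)))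

  Σw-translate : ∀ {n} (c : Word n) (F : Word n → ℤ) → Σw (λ x → F (x ⊕ c)) ≡ Σw F
  Σw-translate []          F = refl
  Σw-translate (false ∷ c) F = cong₂ _+_ (Σw-translate c (λ x → F (false ∷ x))) (Σw-translate c (λ x → F (true ∷ x)))
  Σw-translate (true ∷ c)  F = trans (cong₂ _+_ (Σw-translate c (λ x → F (true ∷ x))) (Σw-translate c (λ x → F (false ∷ x))))
    (ℤₚ.+-comm (Σw (λ x → F (true ∷ x))) (Σw (λ x → F (false ∷ x))))

  Σw-nonneg : ∀ {n} {F : Word n → ℤ} → (∀ x → 0ℤ ≤ F x) → 0ℤ ≤ Σw F
  Σw-nonneg {zero}  F≥0 = F≥0 []
  Σw-nonneg {suc n} F≥0 = 0≤+ (Σw-nonneg (λ x → F≥0 (false ∷ x))) (Σw-nonneg (λ x → F≥0 (true ∷ x)))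

  term≤Σw : ∀ {n} {F : Word n → ℤ} → (∀ x → 0ℤ ≤ F x) → ∀ x → F x ≤ Σw F
  term≤Σw F≥0 []          = ℤₚ.≤-refl
  term≤Σw {F = F} F≥0 (false ∷ x) = subst (_≤ Σw F) (ℤₚ.+-identityʳ (F (false ∷ x)))
    (ℤₚ.+-mono-≤ (term≤Σw (λ y → F≥0 (false ∷ y)) x) (Σw-nonneg (λ y → F≥0 (true ∷ y))))
  term≤Σw {F = F} F≥0 (true ∷ x) = subst (_≤ Σw F) (ℤₚ.+-identityˡ (F (true ∷ x)))
    (ℤₚ.+-mono-≤ (Σw-nonneg (λ y → F≥0 (false ∷ y))) (term≤Σw (λ y → F≥0 (true ∷ y)) x))

  search : ∀ {n} {P : Word n → Set} → (∀ x → Dec (P x)) → Dec (∃ P)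
  search {zero}  P? with P? []
  ... | yes p = yes ([] , p)
  ... | no ¬p = no λ { ([] , p) → ¬p p }
  search {suc n} P? with search (λ x → P? (false ∷ x)) | search (λ x → P? (true ∷ x))
  ... | yes (x , p) | _           = yes (false ∷ x , p)
  ... | no _        | yes (x , p) = yes (true ∷ x , p)
  ... | no ¬f       | no ¬t       = no λ { (false ∷ x , p) → ¬f (x , p) ; (true ∷ x , p) → ¬t (x , p) }

  -- A code is an arbitrary predicate, so its indicator function needs decidability. Word n is
  -- finite, hence double-negated excluded middle holds for all words at once, and this suffices for
  -- refuting an inequality.
  ¬¬-decidable : ∀ {n} (P : Word n → Set) → ¬ ¬ (∀ x → Dec (P x))
  ¬¬-decidable {zero}  P k = k λ { [] → no λ p → k λ { [] → yes p } }
  ¬¬-decidable {suc n} P k = ¬¬-decidable (λ x → P (false ∷ x)) λ f → ¬¬-decidable (λ x → P (true ∷ x)) λ g →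
    k λ { (false ∷ x) → f x ; (true ∷ x) → g x }

  sign : Bool → ℤ
  sign false = 1ℤ
  sign true  = -1ℤ

  sign-xor : ∀ a b → sign (a xor b) ≡ sign a * sign b
  sign-xor false b     = sym (ℤₚ.*-identityˡ (sign b))
  sign-xor true  false = refl
  sign-xor true  true  = refl

  sign-injective : ∀ a b → sign a ≡ sign b → a ≡ b
  sign-injective false false eq = refl
  sign-injective true  true  eq = refl

  zeros : ∀ {n} → Word n → ℕ
  zeros []          = 0
  zeros (false ∷ x) = suc (zeros x)
  zeros (true ∷ x)  = zeros x

  zeros+weight : ∀ {n} (x : Word n) → zeros x ℕ.+ weight x ≡ n
  zeros+weight []          = refl
  zeros+weight (false ∷ x) = cong suc (zeros+weight x)
  zeros+weight (true ∷ x)  = trans (ℕₚ.+-suc (zeros x) (weight x)) (cong suc (zeros+weight x))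

  meet : ∀ {n} → Word n → Word n → ℕ
  meet []       []           = 0
  meet (true ∷ x) (true ∷ y) = suc (meet x y)
  meet (true ∷ x) (false ∷ y) = meet x y
  meet (false ∷ x) (_ ∷ y)    = meet x y

  sign-inner : ∀ {n} (x y : Word n) → sign (inner x y) ≡ sgn (meet x y)
  sign-inner []          []          = refl
  sign-inner (false ∷ x) (_ ∷ y)     = sign-inner x y
  sign-inner (true ∷ x)  (false ∷ y) = sign-inner x y
  sign-inner (true ∷ x)  (true ∷ y)  = trans (sign-xor true (inner x y)) (trans (cong (-1ℤ *_) (sign-inner x y)) (ℤₚ.-1*i≡-i (sgn (meet x y))))

  weight-⊕ : ∀ {n} (x y : Word n) → double (meet x y) ℕ.+ weight (x ⊕ y) ≡ weight x ℕ.+ weight y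
  weight-⊕ []          []          = refl
  weight-⊕ (false ∷ x) (false ∷ y) = weight-⊕ x y
  weight-⊕ (false ∷ x) (true ∷ y)  = trans (ℕₚ.+-suc _ _) (trans (cong suc (weight-⊕ x y)) (sym (ℕₚ.+-suc _ _)))
  weight-⊕ (true ∷ x)  (false ∷ y) = trans (ℕₚ.+-suc _ _) (cong suc (weight-⊕ x y))
  weight-⊕ (true ∷ x)  (true ∷ y)  = cong suc (trans (cong suc (weight-⊕ x y)) (sym (ℕₚ.+-suc _ _)))

  meet-self : ∀ {n} (x : Word n) → meet x x ≡ weight x
  meet-self []          = refl
  meet-self (false ∷ x) = meet-self x
  meet-self (true ∷ x)  = cong suc (meet-self x)

  ⊕-involutive : ∀ {n} (x y : Word n) → x ⊕ (x ⊕ y) ≡ y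
  ⊕-involutive []      []      = refl
  ⊕-involutive (a ∷ x) (b ∷ y) = cong₂ _∷_ (lem a b) (⊕-involutive x y)
    where
    lem : ∀ a b → a xor (a xor b) ≡ b
    lem false b     = refl
    lem true  false = refl
    lem true  true  = refl

  ⊕-cancelʳ : ∀ {n} (x y : Word n) → (x ⊕ y) ⊕ y ≡ x
  ⊕-cancelʳ []      []      = refl
  ⊕-cancelʳ (a ∷ x) (b ∷ y) = cong₂ _∷_ (lem a b) (⊕-cancelʳ x y)
    where
    lem : ∀ a b → (a xor b) xor b ≡ a
    lem false false = refl
    lem false true  = refl
    lem true  false = refl
    lem true  true  = refl

  inner-⊕ˡ : ∀ {n} (x y z : Word n) → inner (x ⊕ y) z ≡ inner x z xor inner y z
  inner-⊕ˡ []      []      []      = refl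
  inner-⊕ˡ (a ∷ x) (b ∷ y) (c ∷ z) rewrite inner-⊕ˡ x y z = lem a b c (inner x z) (inner y z)
    where
    lem : ∀ a b c d e → ((a xor b) ∧ c) xor (d xor e) ≡ ((a ∧ c) xor d) xor ((b ∧ c) xor e)
    lem false false c     d     e     = refl
    lem false true  false d     e     = refl
    lem false true  true  false e     = refl
    lem false true  true  true  false = refl
    lem false true  true  true  true  = refl
    lem true  false false d     e     = refl
    lem true  false true  false e     = refl
    lem true  false true  true  false = refl
    lem true  false true  true  true  = refl
    lem true  true  false d     e     = refl
    lem true  true  true  false false = refl
    lem true  true  true  false true  = refl
    lem true  true  true  true  false = refl
    lem true  true  true  true  true  = refl

  inner-comm : ∀ {n} (x y : Word n) → inner x y ≡ inner y x
  inner-comm []      []      = refl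
  inner-comm (a ∷ x) (b ∷ y) = cong₂ _xor_ (∧-comm a b) (inner-comm x y)

  pow2 : ℕ → ℤ
  pow2 zero    = 1ℤ
  pow2 (suc n) = + 2 * pow2 n

  0<pow2 : ∀ n → 0ℤ < pow2 n
  0<pow2 zero    = ℤ.+<+ (ℕ.s≤s ℕ.z≤n)
  0<pow2 (suc n) = ℤₚ.*-monoˡ-<-pos (+ 2) (0<pow2 n)

  -- The Fourier transform of x ↦ w^|x|, evaluated at v.
  enumerator : ∀ {n} → Series → Word n → Series
  enumerator w []          = const 1ℤ
  enumerator w (false ∷ v) = (const 1ℤ ⊞ w) ⊠ enumerator w v
  enumerator w (true ∷ v)  = (const 1ℤ ⊞ ⊟ w) ⊠ enumerator w v

  enumerator-weight : ∀ {n} w (v : Word n) → enumerator w v ≈ (const 1ℤ ⊞ w) ^ zeros v ⊠ (const 1ℤ ⊞ ⊟ w) ^ weight v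
  enumerator-weight w []          = λ { zero → refl ; (suc n) → sym (⊠-identityˡ (const 1ℤ) (suc n)) }
  enumerator-weight w (false ∷ v) = R.trans (R.*-congˡ {const 1ℤ ⊞ w} (enumerator-weight w v))
    (R.sym (R.*-assoc (const 1ℤ ⊞ w) ((const 1ℤ ⊞ w) ^ zeros v) ((const 1ℤ ⊞ ⊟ w) ^ weight v)))
  enumerator-weight w (true ∷ v)  = R.trans (R.*-congˡ {const 1ℤ ⊞ ⊟ w} (enumerator-weight w v))
    (solve 3 (λ a b c → a :* (b :* c) := b :* (a :* c)) R.refl (const 1ℤ ⊞ ⊟ w) ((const 1ℤ ⊞ w) ^ zeros v) ((const 1ℤ ⊞ ⊟ w) ^ weight v))
    where open Solver using (solve; _:=_; _:*_)

  -- Quantified over `f` so that the induction can move the factor of one coordinate into it; `w` is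
  -- general because both X and -X are substituted.
  fourier-inversion : ∀ {n} w (c : Word n) f k →
    Σw (λ v → sign (inner v c) * (enumerator w v ⊠ f) k) ≡ pow2 n * (w ^ weight c ⊠ f) k
  fourier-inversion w []          f k = refl
  fourier-inversion {suc n} w (b ∷ c) f k = trans (cong₂ _+_
      (trans (Σw-cong (λ v → cong (sign (inner v c) *_) (assoc (const 1ℤ ⊞ w) v k))) (fourier-inversion w c ((const 1ℤ ⊞ w) ⊠ f) k))
      (trans (Σw-cong (λ v → trans (cong₂ _*_ (sign-xor b (inner v c)) (assoc (const 1ℤ ⊞ ⊟ w) v k)) (ℤₚ.*-assoc (sign b) _ _)))
        (trans (Σw-*ˡ (sign b) (λ v → sign (inner v c) * (enumerator w v ⊠ ((const 1ℤ ⊞ ⊟ w) ⊠ f)) k)) (cong (sign b *_) (fourier-inversion w c ((const 1ℤ ⊞ ⊟ w) ⊠ f) k)))))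
      (combine b)
    where
    open Solver using (solve; _:=_; _:*_; _:+_; _:-_; :-_; con)
    assoc : ∀ a (v : Word n) → a ⊠ enumerator w v ⊠ f ≈ enumerator w v ⊠ (a ⊠ f)
    assoc a v = solve 3 (λ a e f → a :* e :* f := e :* (a :* f)) R.refl a (enumerator w v) f
    W = w ^ weight c
    lem₁ : ∀ p a b → p * a + 1ℤ * (p * b) ≡ p * (a + b)
    lem₁ = solve-∀
    lem₂ : ∀ p a b → p * a + -1ℤ * (p * b) ≡ p * (a + - b)
    lem₂ = solve-∀
    lem₃ : ∀ p a → p * (+ 2 * a) ≡ + 2 * p * a
    lem₃ = solve-∀
    combine : ∀ b → pow2 n * (W ⊠ ((const 1ℤ ⊞ w) ⊠ f)) k + sign b * (pow2 n * (W ⊠ ((const 1ℤ ⊞ ⊟ w) ⊠ f)) k)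
      ≡ pow2 (suc n) * (w ^ weight (b ∷ c) ⊠ f) k
    combine false = trans (lem₁ (pow2 n) _ _) (trans (cong (pow2 n *_)
      (trans (solve 3 (λ W w f → W :* ((con 1ℤ :+ w) :* f) :+ W :* ((con 1ℤ :- w) :* f) := con (+ 2) :* (W :* f)) R.refl W w f k)
        (const-⊠ (+ 2) (W ⊠ f) k))) (lem₃ (pow2 n) ((W ⊠ f) k)))
    combine true = trans (lem₂ (pow2 n) _ _) (trans (cong (pow2 n *_)
      (trans (solve 3 (λ W w f → W :* ((con 1ℤ :+ w) :* f) :- W :* ((con 1ℤ :- w) :* f) := con (+ 2) :* (w :* W :* f)) R.refl W w f k)
        (const-⊠ (+ 2) (w ⊠ W ⊠ f) k))) (lem₃ (pow2 n) ((w ⊠ W ⊠ f) k)))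

  -- The real and imaginary parts of i ^ k, as functions of k, are of this kind.
  Antiperiodic : (ℕ → ℤ) → Set
  Antiperiodic ρ = ∀ k → ρ (suc (suc k)) ≡ - ρ k

  antiperiodic-double : ∀ {ρ} → Antiperiodic ρ → ∀ j k → ρ (double j ℕ.+ k) ≡ sgn j * ρ k
  antiperiodic-double {ρ} ap zero    k = sym (ℤₚ.*-identityˡ (ρ k))
  antiperiodic-double {ρ} ap (suc j) k = trans (ap _) (trans (cong -_ (antiperiodic-double ap j k)) (ℤₚ.neg-distribˡ-* (sgn j) (ρ k)))

  -- (-1) ^ (k / 2) for even k; the values at odd k play no role.
  χ : ℕ → ℤ
  χ 0 = 1ℤ
  χ 1 = 1ℤ
  χ (suc (suc k)) = - χ k

  χ-double : ∀ k → χ (double k) ≡ sgn k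
  χ-double zero    = refl
  χ-double (suc k) = cong -_ (χ-double k)

  -- From |v ⊕ c| = |v| + |c| - 2 |v ∧ c|: every step of 2 in the argument of ρ is a change of sign,
  -- and (-1)^|v ∧ c| is the sign of the inner product.
  antiperiodic-⊕ : ∀ {ρ} → Antiperiodic ρ → ∀ {n} (v c : Word n) k → weight c ≡ double k →
    ρ (weight (v ⊕ c)) ≡ χ (weight c) * sign (inner v c) * ρ (weight v)
  antiperiodic-⊕ {ρ} ap v c k eq = begin
    ρ (weight (v ⊕ c))
      ≡⟨ ℤₚ.*-identityˡ _ ⟨
    1ℤ * ρ (weight (v ⊕ c))
      ≡⟨ cong (_* ρ (weight (v ⊕ c))) (sgn-square (meet v c)) ⟨
    sgn (meet v c) * sgn (meet v c) * ρ (weight (v ⊕ c))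
      ≡⟨ ℤₚ.*-assoc (sgn (meet v c)) (sgn (meet v c)) (ρ (weight (v ⊕ c))) ⟩
    sgn (meet v c) * (sgn (meet v c) * ρ (weight (v ⊕ c)))
      ≡⟨ cong (sgn (meet v c) *_) (antiperiodic-double ap (meet v c) (weight (v ⊕ c))) ⟨
    sgn (meet v c) * ρ (double (meet v c) ℕ.+ weight (v ⊕ c))
      ≡⟨ cong (λ z → sgn (meet v c) * ρ z) (trans (weight-⊕ v c) (trans (ℕₚ.+-comm (weight v) (weight c)) (cong (ℕ._+ weight v) eq))) ⟩
    sgn (meet v c) * ρ (double k ℕ.+ weight v)
      ≡⟨ cong₂ _*_ (sym (sign-inner v c)) (antiperiodic-double ap k (weight v)) ⟩
    sign (inner v c) * (sgn k * ρ (weight v))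
      ≡⟨ lem (sign (inner v c)) (sgn k) (ρ (weight v)) ⟩
    sgn k * sign (inner v c) * ρ (weight v)
      ≡⟨ cong (λ z → z * sign (inner v c) * ρ (weight v)) (trans (sym (χ-double k)) (cong χ (sym eq))) ⟩
    χ (weight c) * sign (inner v c) * ρ (weight v) ∎
    where
    open ≡-Reasoning
    lem : ∀ a b c → a * (b * c) ≡ b * a * c
    lem = solve-∀

  module GaussSum {ρ : ℕ → ℤ} (ap : Antiperiodic ρ) where

    -- For ρ(k) = i^k this is i^k (1 + i)^n; the real and the imaginary part are treated separately
    -- through ρ.
    gauss : ℕ → ℕ → ℤ
    gauss n k = Σw {n} (λ x → ρ (weight x ℕ.+ k))

    gauss-suc : ∀ n k → gauss (suc n) k ≡ gauss n k + gauss n (suc k)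
    gauss-suc n k = cong (λ z → gauss n k + z) (Σw-cong {n} (λ x → cong ρ (sym (ℕₚ.+-suc (weight x) k))))

    gauss-antiperiodic : ∀ n → Antiperiodic (gauss n)
    gauss-antiperiodic n k = trans (Σw-cong {n} (λ x → trans (cong ρ (trans (ℕₚ.+-suc _ _) (cong suc (ℕₚ.+-suc _ _)))) (trans (ap _) (sym (ℤₚ.-1*i≡-i _)))))
      (trans (Σw-*ˡ {n} -1ℤ (λ x → ρ (weight x ℕ.+ k))) (ℤₚ.-1*i≡-i _))

    -- Because (1 + i)² = 2i.
    gauss-double : ∀ N k → gauss (double N) k ≡ pow2 N * ρ (N ℕ.+ k)
    gauss-double zero    k = sym (ℤₚ.*-identityˡ (ρ k))
    gauss-double (suc N) k = begin
      gauss (suc (suc (double N))) k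
        ≡⟨ trans (gauss-suc (suc (double N)) k) (cong₂ _+_ (gauss-suc (double N) k) (gauss-suc (double N) (suc k))) ⟩
      gauss (double N) k + gauss (double N) (suc k) + (gauss (double N) (suc k) + gauss (double N) (suc (suc k)))
        ≡⟨ cong (λ z → gauss (double N) k + gauss (double N) (suc k) + (gauss (double N) (suc k) + z)) (gauss-antiperiodic (double N) k) ⟩
      gauss (double N) k + gauss (double N) (suc k) + (gauss (double N) (suc k) + - gauss (double N) k)
        ≡⟨ lem (gauss (double N) k) (gauss (double N) (suc k)) ⟩
      + 2 * gauss (double N) (suc k)
        ≡⟨ cong (+ 2 *_) (trans (gauss-double N (suc k)) (cong (λ z → pow2 N * ρ z) (ℕₚ.+-suc N k))) ⟩
      + 2 * (pow2 N * ρ (suc N ℕ.+ k))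
        ≡⟨ ℤₚ.*-assoc (+ 2) (pow2 N) (ρ (suc N ℕ.+ k)) ⟨
      pow2 (suc N) * ρ (suc N ℕ.+ k) ∎
      where
      open ≡-Reasoning
      lem : ∀ a b → a + b + (b + - a) ≡ + 2 * b
      lem = solve-∀

    -- Because 1 - i = -i (1 + i): each coordinate in the support of c contributes one factor -i.
    gauss-twist : ∀ {n} (c : Word n) k → Σw (λ x → sign (inner x c) * ρ (weight x ℕ.+ k)) ≡ sgn (weight c) * gauss n (weight c ℕ.+ k)
    gauss-twist []          k = refl
    gauss-twist {suc n} (b ∷ c) k = trans (cong₂ _+_ (gauss-twist c k) (trans
        (Σw-cong (λ x → trans (cong₂ _*_ (sign-xor b (inner x c)) (cong ρ (sym (ℕₚ.+-suc (weight x) k)))) (ℤₚ.*-assoc (sign b) _ _)))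
        (trans (Σw-*ˡ (sign b) (λ x → sign (inner x c) * ρ (weight x ℕ.+ suc k))) (cong (sign b *_) (trans (gauss-twist c (suc k)) (cong (λ z → sgn (weight c) * gauss n z) (ℕₚ.+-suc (weight c) k)))))))
        (combine b)
      where
      ε = sgn (weight c)
      j = weight c ℕ.+ k
      lem₁ : ∀ ε a b → ε * a + 1ℤ * (ε * b) ≡ ε * (a + b)
      lem₁ = solve-∀
      lem₂ : ∀ ε a b → ε * a + -1ℤ * (ε * b) ≡ - ε * (b + - a)
      lem₂ = solve-∀
      combine : ∀ b → ε * gauss n j + sign b * (ε * gauss n (suc j)) ≡ sgn (weight (b ∷ c)) * gauss (suc n) (weight (b ∷ c) ℕ.+ k)
      combine false = trans (lem₁ ε _ _) (cong (ε *_) (sym (gauss-suc n j)))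
      combine true  = trans (lem₂ ε _ _) (cong (- ε *_) (sym (trans (gauss-suc n (suc j)) (cong (λ z → gauss n (suc j) + z) (gauss-antiperiodic n j)))))

    gauss-twist-even : ∀ {n} (c : Word n) k → weight c ≡ double k → Σw (λ x → sign (inner x c) * ρ (weight x)) ≡ χ (weight c) * gauss n 0
    gauss-twist-even {n} c k eq = begin
      Σw (λ x → sign (inner x c) * ρ (weight x))
        ≡⟨ Σw-cong (λ x → cong (λ z → sign (inner x c) * ρ z) (sym (ℕₚ.+-identityʳ (weight x)))) ⟩
      Σw (λ x → sign (inner x c) * ρ (weight x ℕ.+ 0))   ≡⟨ gauss-twist c 0 ⟩
      sgn (weight c) * gauss n (weight c ℕ.+ 0)          ≡⟨ cong (λ z → sgn z * gauss n (z ℕ.+ 0)) eq ⟩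
      sgn (double k) * gauss n (double k ℕ.+ 0)          ≡⟨ cong₂ _*_ (sgn-double k) (antiperiodic-double (gauss-antiperiodic n) k 0) ⟩
      1ℤ * (sgn k * gauss n 0)                           ≡⟨ ℤₚ.*-identityˡ _ ⟩
      sgn k * gauss n 0                                  ≡⟨ cong (_* gauss n 0) (trans (sym (χ-double k)) (cong χ (sym eq))) ⟩
      χ (weight c) * gauss n 0                           ∎
      where
      open ≡-Reasoning
      sgn-double : ∀ k → sgn (double k) ≡ 1ℤ
      sgn-double zero    = refl
      sgn-double (suc k) = trans (ℤₚ.neg-involutive _) (sgn-double k)

  re im : ℕ → ℤ
  re 0 = 1ℤ
  re 1 = 0ℤ
  re (suc (suc k)) = - re k
  im 0 = 0ℤ
  im 1 = 1ℤ
  im (suc (suc k)) = - im k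

  +4-periodic : ∀ {ρ} → Antiperiodic ρ → ∀ r i → ρ (r ℕ.+ i ℕ.* 4) ≡ ρ r
  +4-periodic {ρ} ap r zero    = cong ρ (ℕₚ.+-identityʳ r)
  +4-periodic {ρ} ap r (suc i) = trans (cong ρ (lem r i)) (trans (ap _) (trans (cong -_ (ap _)) (trans (ℤₚ.neg-involutive _) (+4-periodic ap r i))))
    where
    lem : ∀ r i → r ℕ.+ suc i ℕ.* 4 ≡ 4 ℕ.+ (r ℕ.+ i ℕ.* 4)
    lem = ℕ-solve-∀

  -- The complex equation σ i^a = κ i^b. Distinct powers of i, as plane vectors, have inner product
  -- at most 0, whereas the equation makes σ times that inner product equal to κ > 0.
  re-im-injective : ∀ a b {σ κ} → 0ℤ ≤ σ → 0ℤ < κ → σ * re a ≡ κ * re b → σ * im a ≡ κ * im b →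
    ∃ λ l → a ℕ.+ 4 ℕ.* l ≡ b ⊎ a ≡ b ℕ.+ 4 ℕ.* l
  re-im-injective a b {σ} {κ} 0≤σ 0<κ eq-re eq-im with a divMod 4 | b divMod 4
  ... | result i r refl | result j s refl with separated r s
    where
    dot : Fin 4 → Fin 4 → ℤ
    dot r s = re (toℕ r) * re (toℕ s) + im (toℕ r) * im (toℕ s)
    separated : ∀ r s → r ≡ s ⊎ dot r s ≤ 0ℤ
    separated = toWitness {a? = all? λ r → all? λ s → (r ≟ᶠ s) ⊎-dec (dot r s ℤₚ.≤? 0ℤ)} _
  ... | inj₂ dot≤0 = ⊥-elim (ℤₚ.<-irrefl refl (ℤₚ.<-≤-trans 0<κ (subst (_≤ 0ℤ) (sym κ≡) (subst (σ * dot ≤_) (ℤₚ.*-zeroʳ σ) (ℤₚ.*-monoˡ-≤-nonNeg σ {{ℤ.nonNegative 0≤σ}} dot≤0)))))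
    where
    open ≡-Reasoning
    a₁ = re (toℕ r)
    a₂ = im (toℕ r)
    b₁ = re (toℕ s)
    b₂ = im (toℕ s)
    dot = a₁ * b₁ + a₂ * b₂
    unit : ∀ (s : Fin 4) → re (toℕ s) * re (toℕ s) + im (toℕ s) * im (toℕ s) ≡ 1ℤ
    unit = toWitness {a? = all? λ s → re (toℕ s) * re (toℕ s) + im (toℕ s) * im (toℕ s) ℤₚ.≟ 1ℤ} _
    reduce : ∀ {ρ} → Antiperiodic ρ → σ * ρ (toℕ r ℕ.+ i ℕ.* 4) ≡ κ * ρ (toℕ s ℕ.+ j ℕ.* 4) → σ * ρ (toℕ r) ≡ κ * ρ (toℕ s)
    reduce ap eq = trans (cong (σ *_) (sym (+4-periodic ap (toℕ r) i))) (trans eq (cong (κ *_) (+4-periodic ap (toℕ s) j)))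
    lem₁ : ∀ κ b₁ b₂ → κ * (b₁ * b₁ + b₂ * b₂) ≡ κ * b₁ * b₁ + κ * b₂ * b₂
    lem₁ = solve-∀
    lem₂ : ∀ σ a₁ a₂ b₁ b₂ → σ * a₁ * b₁ + σ * a₂ * b₂ ≡ σ * (a₁ * b₁ + a₂ * b₂)
    lem₂ = solve-∀
    κ≡ : κ ≡ σ * dot
    κ≡ = begin
      κ                              ≡⟨ trans (sym (ℤₚ.*-identityʳ κ)) (cong (κ *_) (sym (unit s))) ⟩
      κ * (b₁ * b₁ + b₂ * b₂)        ≡⟨ lem₁ κ b₁ b₂ ⟩
      κ * b₁ * b₁ + κ * b₂ * b₂      ≡⟨ cong₂ (λ y z → y * b₁ + z * b₂) (reduce {re} (λ _ → refl) eq-re) (reduce {im} (λ _ → refl) eq-im) ⟨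
      σ * a₁ * b₁ + σ * a₂ * b₂      ≡⟨ lem₂ σ a₁ a₂ b₁ b₂ ⟩
      σ * dot                        ∎
  ... | inj₁ refl with ℕₚ.≤-total i j
  ...   | inj₁ i≤j with ℕₚ.m≤n⇒∃[o]m+o≡n i≤j
  ...     | l , refl = l , inj₁ (lem (toℕ r) i l)
    where
    lem : ∀ r i l → r ℕ.+ i ℕ.* 4 ℕ.+ 4 ℕ.* l ≡ r ℕ.+ (i ℕ.+ l) ℕ.* 4
    lem = ℕ-solve-∀
  re-im-injective a b {σ} {κ} 0≤σ 0<κ eq-re eq-im | result i r refl | result j s refl | inj₁ refl | inj₂ j≤i with ℕₚ.m≤n⇒∃[o]m+o≡n j≤i
  ...     | l , refl = l , inj₂ (lem (toℕ r) j l)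
    where
    lem : ∀ r i l → r ℕ.+ (i ℕ.+ l) ℕ.* 4 ≡ r ℕ.+ i ℕ.* 4 ℕ.+ 4 ℕ.* l
    lem = ℕ-solve-∀

  sgn≡1⇒even : ∀ k → sgn k ≡ 1ℤ → ∃ λ j → k ≡ double j
  sgn≡1⇒even 0 eq = 0 , refl
  sgn≡1⇒even (suc (suc k)) eq with sgn≡1⇒even k (trans (sym (ℤₚ.neg-involutive (sgn k))) eq)
  ... | j , refl = suc j , refl

  -- The shadow of a self-dual code

  module SelfDual {n : ℕ} (C : Code n) (sd : IsSelfDual C) (C? : ∀ x → Dec (C x)) where

    0ᵂ : Word n
    0ᵂ = replicate n false

    even-weight : ∀ (x : Word n) → inner x x ≡ false → ∃ λ k → weight x ≡ double k
    even-weight x eq = sgn≡1⇒even (weight x) (trans (cong sgn (sym (meet-self x))) (trans (sym (sign-inner x x)) (cong sign eq)))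

    C-orthogonal : ∀ {x y} → C x → C y → inner x y ≡ false
    C-orthogonal {x} {y} cx cy = proj₁ (proj₂ sd x) cx y cy

    C-even : ∀ {c} → C c → ∃ λ k → weight c ≡ double k
    C-even {c} cc = even-weight c (C-orthogonal {c} {c} cc cc)

    C-⊕ : ∀ {x y} → C x → C y → C (x ⊕ y)
    C-⊕ {x} {y} = proj₂ (proj₁ sd) x y

    C-0 : C 0ᵂ
    C-0 = proj₁ (proj₁ sd)

    -- The inner product of the all-one word with y is that of y with itself, hence 0 on C. By
    -- self-duality the all-one word is a codeword, and codewords have even weight.
    n-even : ∃ λ N → n ≡ double N
    n-even with C-even (proj₂ (proj₂ sd (replicate n true)) λ y cy → trans (inner-ones y) (C-orthogonal {y} {y} cy cy))
      where
      inner-ones : ∀ {n} (y : Word n) → inner (replicate n true) y ≡ inner y y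
      inner-ones []          = refl
      inner-ones (false ∷ y) = inner-ones y
      inner-ones (true ∷ y)  = cong (true xor_) (inner-ones y)
    ... | N , eq = N , trans (sym (weight-ones n)) eq
      where
      weight-ones : ∀ n → weight (replicate n true) ≡ n
      weight-ones zero    = refl
      weight-ones (suc n) = cong suc (weight-ones n)

    ind : Word n → ℤ
    ind c with C? c
    ... | yes _ = 1ℤ
    ... | no _  = 0ℤ

    ind-yes : ∀ {c} → C c → ind c ≡ 1ℤ
    ind-yes {c} cc with C? c
    ... | yes _  = refl
    ... | no ¬cc = ⊥-elim (¬cc cc)

    ind-nonneg : ∀ c → 0ℤ ≤ ind c
    ind-nonneg c with C? c
    ... | yes _ = +≤+ ℕ.z≤n
    ... | no _  = +≤+ ℕ.z≤n

    ind-*-nonneg : ∀ c {a} → (C c → 0ℤ ≤ a) → 0ℤ ≤ ind c * a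
    ind-*-nonneg c 0≤a with C? c
    ... | yes cc = subst (0ℤ ≤_) (sym (ℤₚ.*-identityˡ _)) (0≤a cc)
    ... | no _   = +≤+ ℕ.z≤n

    ind-cong : ∀ c {a b} → (C c → a ≡ b) → ind c * a ≡ ind c * b
    ind-cong c eq with C? c
    ... | yes cc = cong (1ℤ *_) (eq cc)
    ... | no _   = refl

    ind-⊕ : ∀ {c₀} → C c₀ → ∀ c → ind (c ⊕ c₀) ≡ ind c
    ind-⊕ {c₀} cc₀ c with C? c | C? (c ⊕ c₀)
    ... | yes _   | yes _  = refl
    ... | no _    | no _   = refl
    ... | yes cc  | no ¬c′ = ⊥-elim (¬c′ (C-⊕ cc cc₀))
    ... | no ¬cc  | yes c′ = ⊥-elim (¬cc (subst C (⊕-cancelʳ c c₀) (C-⊕ c′ cc₀)))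

    χ-inner : Word n → Word n → ℤ
    χ-inner v c = χ (weight c) * sign (inner v c)

    -- The indicator function of the shadow of C, multiplied by the size of C.
    shadow : Word n → ℤ
    shadow v = Σw (λ c → ind c * χ-inner v c)

    size : ℤ
    size = Σw ind

    0<size : 0ℤ < size
    0<size = ℤₚ.<-≤-trans (subst (0ℤ <_) (sym (ind-yes C-0)) (ℤ.+<+ (ℕ.s≤s ℕ.z≤n))) (term≤Σw ind-nonneg 0ᵂ)

    InShadow : Word n → Set
    InShadow v = ∀ c → C c → χ-inner v c ≡ 1ℤ

    -- On C, c ↦ i^|c| is a character because codewords have even weight and meet in an even number
    -- of coordinates; the product with c ↦ (-1)^⟨v,c⟩ is again one.
    χ-inner-⊕ : ∀ v {c c₀} → C c → C c₀ → χ-inner v (c ⊕ c₀) ≡ χ-inner v c * χ-inner v c₀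
    χ-inner-⊕ v {c} {c₀} cc cc₀ with C-even cc₀
    ... | k , eq = begin
      χ (weight (c ⊕ c₀)) * sign (inner v (c ⊕ c₀))
        ≡⟨ cong₂ _*_ (antiperiodic-⊕ {χ} (λ _ → refl) c c₀ k eq) (cong sign (trans (inner-comm v (c ⊕ c₀)) (inner-⊕ˡ c c₀ v))) ⟩
      χ (weight c₀) * sign (inner c c₀) * χ (weight c) * sign (inner c v xor inner c₀ v)
        ≡⟨ cong₂ (λ y z → χ (weight c₀) * sign y * χ (weight c) * z) (C-orthogonal {c} {c₀} cc cc₀) (trans (sign-xor (inner c v) (inner c₀ v)) (cong₂ (λ y z → sign y * sign z) (inner-comm c v) (inner-comm c₀ v))) ⟩
      χ (weight c₀) * 1ℤ * χ (weight c) * (sign (inner v c) * sign (inner v c₀))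
        ≡⟨ lem (χ (weight c₀)) (χ (weight c)) (sign (inner v c)) (sign (inner v c₀)) ⟩
      χ-inner v c * χ-inner v c₀ ∎
      where
      open ≡-Reasoning
      lem : ∀ a b c d → a * 1ℤ * b * (c * d) ≡ b * c * (a * d)
      lem = solve-∀

    χ-inner-values : ∀ v c → χ-inner v c ≡ 1ℤ ⊎ χ-inner v c ≡ -1ℤ
    χ-inner-values v c = product (χ-values (weight c)) (sign-values (inner v c))
      where
      Unit : ℤ → Set
      Unit z = z ≡ 1ℤ ⊎ z ≡ -1ℤ
      χ-values : ∀ k → Unit (χ k)
      χ-values 0 = inj₁ refl
      χ-values 1 = inj₁ refl
      χ-values (suc (suc k)) with χ-values k
      ... | inj₁ eq = inj₂ (cong -_ eq)
      ... | inj₂ eq = inj₁ (cong -_ eq)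
      sign-values : ∀ b → Unit (sign b)
      sign-values false = inj₁ refl
      sign-values true  = inj₂ refl
      product : ∀ {x y} → Unit x → Unit y → Unit (x * y)
      product (inj₁ refl) (inj₁ refl) = inj₁ refl
      product (inj₁ refl) (inj₂ refl) = inj₂ refl
      product (inj₂ refl) (inj₁ refl) = inj₂ refl
      product (inj₂ refl) (inj₂ refl) = inj₁ refl

    -- Orthogonality of characters: if some c₀ in C has value -1, translation by c₀ negates the sum.
    shadow-dichotomy : ∀ v → InShadow v ⊎ shadow v ≡ 0ℤ
    shadow-dichotomy v with search (λ c → C? c ×-dec (χ-inner v c ℤₚ.≟ -1ℤ))
    ... | no none = inj₁ λ c cc → [ (λ eq → eq) , (λ eq → ⊥-elim (none (c , cc , eq))) ]′ (χ-inner-values v c)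
    ... | yes (c₀ , cc₀ , eq) = inj₂ (self-neg (begin
      shadow v                                          ≡⟨ Σw-translate c₀ (λ c → ind c * χ-inner v c) ⟨
      Σw (λ c → ind (c ⊕ c₀) * χ-inner v (c ⊕ c₀))      ≡⟨ Σw-cong (λ c → trans (cong (_* χ-inner v (c ⊕ c₀)) (ind-⊕ cc₀ c))
                                                             (ind-cong c (λ cc → trans (χ-inner-⊕ v cc cc₀) (cong (χ-inner v c *_) eq)))) ⟩
      Σw (λ c → ind c * (χ-inner v c * -1ℤ))            ≡⟨ Σw-cong (λ c → ℤₚ.*-assoc (ind c) (χ-inner v c) -1ℤ) ⟨
      Σw (λ c → ind c * χ-inner v c * -1ℤ)              ≡⟨ Σw-*ʳ -1ℤ (λ c → ind c * χ-inner v c) ⟩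
      shadow v * -1ℤ                                    ∎))
      where
      open ≡-Reasoning
      self-neg : ∀ {a} → a ≡ a * -1ℤ → a ≡ 0ℤ
      self-neg {+ zero} _ = refl
      self-neg {+ suc k} ()
      self-neg { -[1+ k ]} ()

    shadow-nonneg : ∀ v → 0ℤ ≤ shadow v
    shadow-nonneg v with shadow-dichotomy v
    ... | inj₁ inS = Σw-nonneg (λ c → subst (0ℤ ≤_) (sym (ind-cong c (inS c))) (subst (0ℤ ≤_) (sym (ℤₚ.*-identityʳ (ind c))) (ind-nonneg c)))
    ... | inj₂ eq  = ℤₚ.≤-reflexive (sym eq)

    shadow-sum : (F : Word n → ℤ) → Σw (λ v → shadow v * F v) ≡ Σw (λ c → ind c * (χ (weight c) * Σw (λ v → sign (inner v c) * F v)))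
    shadow-sum F = begin
      Σw (λ v → shadow v * F v)
        ≡⟨ Σw-cong (λ v → sym (Σw-*ʳ (F v) (λ c → ind c * χ-inner v c))) ⟩
      Σw (λ v → Σw (λ c → ind c * χ-inner v c * F v))
        ≡⟨ Σw-swap (λ v c → ind c * χ-inner v c * F v) ⟩
      Σw (λ c → Σw (λ v → ind c * χ-inner v c * F v))
        ≡⟨ Σw-cong (λ c → trans (Σw-cong (λ v → lem (ind c) (χ (weight c)) (sign (inner v c)) (F v)))
             (trans (Σw-*ˡ (ind c * χ (weight c)) (λ v → sign (inner v c) * F v)) (ℤₚ.*-assoc (ind c) (χ (weight c)) _))) ⟩
      Σw (λ c → ind c * (χ (weight c) * Σw (λ v → sign (inner v c) * F v))) ∎
      where
      open ≡-Reasoning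
      lem : ∀ i x s f → i * (x * s) * f ≡ i * x * (s * f)
      lem = solve-∀

    χ-square : ∀ {c} → C c → χ (weight c) * χ (weight c) ≡ 1ℤ
    χ-square cc with C-even cc
    ... | k , eq = trans (cong (λ z → χ z * χ z) eq) (trans (cong (λ z → z * z) (χ-double k)) (sgn-square k))

    -- The sum of shadow(x) i^|x| is computed twice. Two words of the shadow differ by a codeword,
    -- so i^|x| is constant on it and equals i^|v|; summing over x before c, the Gauss sums give |C|
    -- 2^N i^N. All other factors have a sign, so i^|v| = i^N.
    shadow-weight : ∀ N → n ≡ double N → ∀ v → InShadow v → ∃ λ l → weight v ℕ.+ 4 ℕ.* l ≡ N ⊎ weight v ≡ N ℕ.+ 4 ℕ.* l
    shadow-weight N n≡ v inS = re-im-injective (weight v) N (Σw-nonneg shadow-nonneg) 0<κ (evaluate {re} (λ _ → refl)) (evaluate {im} (λ _ → refl))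
      where
      0<κ : 0ℤ < size * pow2 N
      0<κ = subst (_< size * pow2 N) (ℤₚ.*-zeroʳ size) (ℤₚ.*-monoˡ-<-pos size {{ℤ.positive 0<size}} (0<pow2 N))
      constant : ∀ {ρ} → Antiperiodic ρ → ∀ x → shadow x * ρ (weight x) ≡ shadow x * ρ (weight v)
      constant {ρ} ap x with shadow-dichotomy x
      ... | inj₂ eq rewrite eq = refl
      ... | inj₁ inSx = cong (shadow x *_) (begin
        ρ (weight x)                       ≡⟨ cong (λ z → ρ (weight z)) (⊕-involutive v x) ⟨
        ρ (weight (v ⊕ c))                 ≡⟨ antiperiodic-⊕ ap v c (proj₁ (C-even cc)) (proj₂ (C-even cc)) ⟩
        χ-inner v c * ρ (weight v)         ≡⟨ cong (_* ρ (weight v)) (inS c cc) ⟩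
        1ℤ * ρ (weight v)                  ≡⟨ ℤₚ.*-identityˡ _ ⟩
        ρ (weight v)                       ∎)
        where
        open ≡-Reasoning
        c = v ⊕ x
        same-sign : ∀ {y} → C y → sign (inner v y) ≡ sign (inner x y)
        same-sign {y} cy = trans (expand v) (trans (cong (χ (weight y) *_) (trans (inS y cy) (sym (inSx y cy)))) (sym (expand x)))
          where
          expand : ∀ v → sign (inner v y) ≡ χ (weight y) * χ-inner v y
          expand v = trans (sym (ℤₚ.*-identityˡ _)) (trans (cong (_* sign (inner v y)) (sym (χ-square cy))) (ℤₚ.*-assoc (χ (weight y)) (χ (weight y)) _))
        cc : C c
        -- Two words that induce the same character on C differ by an element of the dual code,
        -- which is C itself.
        cc = proj₂ (proj₂ sd c) λ y cy → trans (inner-⊕ˡ v x y) (trans (cong (_xor inner x y) (sign-injective _ _ (same-sign cy))) (xor-same (inner x y)))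
      evaluate : ∀ {ρ} → Antiperiodic ρ → Σw shadow * ρ (weight v) ≡ size * pow2 N * ρ N
      evaluate {ρ} ap = begin
        Σw shadow * ρ (weight v)
          ≡⟨ Σw-*ʳ (ρ (weight v)) shadow ⟨
        Σw (λ x → shadow x * ρ (weight v))
          ≡⟨ Σw-cong (constant ap) ⟨
        Σw (λ x → shadow x * ρ (weight x))
          ≡⟨ shadow-sum (λ x → ρ (weight x)) ⟩
        Σw (λ c → ind c * (χ (weight c) * Σw (λ x → sign (inner x c) * ρ (weight x))))
          ≡⟨ Σw-cong (λ c → ind-cong c (λ cc → trans (cong (χ (weight c) *_) (gauss-twist-even c (proj₁ (C-even cc)) (proj₂ (C-even cc))))
               (trans (sym (ℤₚ.*-assoc (χ (weight c)) (χ (weight c)) (gauss n 0))) (trans (cong (_* gauss n 0) (χ-square cc)) (ℤₚ.*-identityˡ (gauss n 0)))))) ⟩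
        Σw (λ c → ind c * gauss n 0)
          ≡⟨ Σw-*ʳ (gauss n 0) ind ⟩
        size * gauss n 0
          ≡⟨ cong (size *_) (trans (cong (λ z → gauss z 0) n≡) (trans (gauss-double N 0) (cong (λ z → pow2 N * ρ z) (ℕₚ.+-identityʳ N)))) ⟩
        size * (pow2 N * ρ N)
          ≡⟨ ℤₚ.*-assoc size (pow2 N) (ρ N) ⟨
        size * pow2 N * ρ N ∎
        where
        open ≡-Reasoning
        open GaussSum ap

    -- The residue inequality, summed over the shadow and over the code

    module Contradiction (c₁ c₂ : ℤ) (0≤c₁ : 0ℤ ≤ c₁) (0≤c₂ : 0ℤ ≤ c₂) (m q N : ℕ) (n≡ : n ≡ double N) (N+1≡ : suc N ≡ q ℕ.+ 4 ℕ.* m) (odd : sgn (suc m) ≡ -1ℤ) where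

      g : Series
      g = half (kernel c₁ c₂ (suc m) q)

      -- The conjugate term with -X is added because only the sum of (1 + X)^(n-|v|) (1 - X)^|v| and
      -- its conjugate is a power of p times a trace.
      value : Word n → ℤ
      value v = (enumerator X v ⊠ kernel c₁ c₂ (suc m) q) (double (suc m)) + (enumerator (⊟ X) v ⊠ kernel c₁ c₂ (suc m) q) (double (suc m))

      ᾱ̄≈α : const 1ℤ ⊞ ⊟ ⊟ X ≈ α
      ᾱ̄≈α k = cong (λ z → const 1ℤ k + z) (ℤₚ.neg-involutive (X k))

      value-nonneg : ∀ v l → weight v ℕ.+ 4 ℕ.* l ≡ N ⊎ weight v ≡ N ℕ.+ 4 ℕ.* l → 0ℤ ≤ value v
      value-nonneg v l (inj₁ eq) = subst (0ℤ ≤_) (trans (sym (pair-cong expand (double (suc m)))) (⊠-distribʳ K (enumerator X v) (enumerator (⊟ X) v) (double (suc m))))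
                            (pairing-trace c₁ c₂ 0≤c₁ 0≤c₂ m q (weight v) l (trans (cong suc eq) N+1≡))
        where
        K = kernel c₁ c₂ (suc m) q
        pair-cong : ∀ {f f′} → f ≈ f′ → f ⊠ K ≈ f′ ⊠ K
        pair-cong = R.*-congʳ {K}
        zeros≡ : zeros v ≡ weight v ℕ.+ 8 ℕ.* l
        zeros≡ = ℕₚ.+-cancelʳ-≡ (weight v) _ _ (trans (zeros+weight v) (trans n≡ (trans (cong double (sym eq)) (trans (double≡ (weight v ℕ.+ 4 ℕ.* l)) (lem (weight v) l)))))
          where
          lem : ∀ w l → w ℕ.+ 4 ℕ.* l ℕ.+ (w ℕ.+ 4 ℕ.* l) ≡ w ℕ.+ 8 ℕ.* l ℕ.+ w
          lem = ℕ-solve-∀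
        expand : enumerator X v ⊞ enumerator (⊟ X) v ≈ α ^ (weight v ℕ.+ 8 ℕ.* l) ⊠ ᾱ ^ weight v ⊞ ᾱ ^ (weight v ℕ.+ 8 ℕ.* l) ⊠ α ^ weight v
        expand = R.+-cong
          (R.trans (enumerator-weight X v) (R.reflexive (cong (λ z → α ^ z ⊠ ᾱ ^ weight v) zeros≡)))
          (R.trans (enumerator-weight (⊟ X) v) (R.trans (R.*-congˡ {ᾱ ^ zeros v} (^-congˡ (weight v) ᾱ̄≈α)) (R.reflexive (cong (λ z → ᾱ ^ z ⊠ α ^ weight v) zeros≡))))
      -- For |v| ≥ N, zeros and ones exchange roles, which merely swaps the two conjugate summands.
      value-nonneg v l (inj₂ eq) = subst (0ℤ ≤_) (trans (sym (pair-cong expand (double (suc m)))) (⊠-distribʳ K (enumerator X v) (enumerator (⊟ X) v) (double (suc m))))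
                            (pairing-trace c₁ c₂ 0≤c₁ 0≤c₂ m q (zeros v) l (trans (cong suc zeros+4l≡N) N+1≡))
        where
        K = kernel c₁ c₂ (suc m) q
        pair-cong : ∀ {f f′} → f ≈ f′ → f ⊠ K ≈ f′ ⊠ K
        pair-cong = R.*-congʳ {K}
        zeros+4l≡N : zeros v ℕ.+ 4 ℕ.* l ≡ N
        zeros+4l≡N = ℕₚ.+-cancelʳ-≡ N _ _ (trans (lem (zeros v) N l) (trans (cong (zeros v ℕ.+_) (sym eq)) (trans (zeros+weight v) (trans n≡ (double≡ N)))))
          where
          lem : ∀ z N l → z ℕ.+ 4 ℕ.* l ℕ.+ N ≡ z ℕ.+ (N ℕ.+ 4 ℕ.* l)
          lem = ℕ-solve-∀
        weight≡ : weight v ≡ zeros v ℕ.+ 8 ℕ.* l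
        weight≡ = trans eq (trans (cong (ℕ._+ 4 ℕ.* l) (sym zeros+4l≡N)) (lem (zeros v) l))
          where
          lem : ∀ z l → z ℕ.+ 4 ℕ.* l ℕ.+ 4 ℕ.* l ≡ z ℕ.+ 8 ℕ.* l
          lem = ℕ-solve-∀
        expand : enumerator X v ⊞ enumerator (⊟ X) v ≈ α ^ (zeros v ℕ.+ 8 ℕ.* l) ⊠ ᾱ ^ zeros v ⊞ ᾱ ^ (zeros v ℕ.+ 8 ℕ.* l) ⊠ α ^ zeros v
        expand = R.trans (R.+-comm (enumerator X v) (enumerator (⊟ X) v)) (R.+-cong
          (R.trans (enumerator-weight (⊟ X) v) (R.trans (R.*-comm (ᾱ ^ zeros v) _) (R.*-congʳ {ᾱ ^ zeros v} (R.trans (^-congˡ (weight v) ᾱ̄≈α) (R.reflexive (cong (α ^_) weight≡))))))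
          (R.trans (enumerator-weight X v) (R.trans (R.*-comm (α ^ zeros v) (ᾱ ^ weight v)) (R.*-congʳ {α ^ zeros v} (R.reflexive (cong (ᾱ ^_) weight≡))))))

      shadow-value : 0ℤ ≤ Σw (λ v → shadow v * value v)
      shadow-value = Σw-nonneg λ v → [ (λ inS → 0≤* (shadow-nonneg v) (value-nonneg v (proj₁ (shadow-weight N n≡ v inS)) (proj₂ (shadow-weight N n≡ v inS)))) , (λ eq → ℤₚ.≤-reflexive (sym (cong (_* value v) eq))) ]′ (shadow-dichotomy v)

      X^double : ∀ k → X ^ double k ≈ X² ^ k
      X^double zero    = R.refl
      X^double (suc k) = R.trans (R.sym (R.*-assoc X X (X ^ double k))) (R.*-congˡ {X²} (X^double k))

      ⊟X^double : ∀ k → (⊟ X) ^ double k ≈ X² ^ k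
      ⊟X^double zero    = R.refl
      ⊟X^double (suc k) = R.trans (solve 2 (λ x y → (:- x) :* ((:- x) :* y) := x :* x :* y) R.refl X ((⊟ X) ^ double k)) (R.*-congˡ {X²} (⊟X^double k))
        where open Solver using (solve; _:=_; _:*_; :-_)

      -- χ(|c|) cancels the sign (-1)^k of X^(2k) = (-Z)^k. The remaining minus sign is (-1)^(m+1),
      -- and this is where m has to be even.
      codeword-term : ∀ c k → weight c ≡ double k → χ (weight c) * Σw (λ v → sign (inner v c) * value v) ≡ - (+ 2 * pow2 n * back k g (suc m))
      codeword-term c k eq = begin
        χ (weight c) * Σw (λ v → sign (inner v c) * value v)
          ≡⟨ cong (χ (weight c) *_) (trans (Σw-cong (λ v → ℤₚ.*-distribˡ-+ (sign (inner v c)) (V₁ v) (V₂ v))) (trans (Σw-+ (λ v → sign (inner v c) * V₁ v) (λ v → sign (inner v c) * V₂ v))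
               (cong₂ _+_ (fourier-inversion X c K (double M)) (fourier-inversion (⊟ X) c K (double M))))) ⟩
        χ (weight c) * (pow2 n * (X ^ weight c ⊠ K) (double M) + pow2 n * ((⊟ X) ^ weight c ⊠ K) (double M))
          ≡⟨ cong (λ z → χ z * (pow2 n * (X ^ z ⊠ K) (double M) + pow2 n * ((⊟ X) ^ z ⊠ K) (double M))) eq ⟩
        χ (double k) * (pow2 n * (X ^ double k ⊠ K) (double M) + pow2 n * ((⊟ X) ^ double k ⊠ K) (double M))
          ≡⟨ cong₂ (λ y z → χ (double k) * (pow2 n * y + pow2 n * z)) (R.*-congʳ {K} (X^double k) (double M)) (R.*-congʳ {K} (⊟X^double k) (double M)) ⟩
        χ (double k) * (pow2 n * V + pow2 n * V)
          ≡⟨ cong (_* (pow2 n * V + pow2 n * V)) (χ-double k) ⟩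
        sgn k * (pow2 n * V + pow2 n * V)
          ≡⟨ lem₁ (sgn k) (pow2 n) V ⟩
        - (+ 2 * pow2 n * (sgn k * (-1ℤ * V)))
          ≡⟨ cong (λ z → - (+ 2 * pow2 n * (sgn k * z))) (trans (cong (_* V) (sym odd)) (half-X²^ k K M)) ⟩
        - (+ 2 * pow2 n * (sgn k * (sgn k * back k g M)))
          ≡⟨ cong (λ z → - (+ 2 * pow2 n * z)) (trans (sym (ℤₚ.*-assoc (sgn k) (sgn k) _)) (trans (cong (_* back k g M) (sgn-square k)) (ℤₚ.*-identityˡ _))) ⟩
        - (+ 2 * pow2 n * back k g M) ∎
        where
        open ≡-Reasoning
        K = kernel c₁ c₂ (suc m) q
        M = suc m
        V = (X² ^ k ⊠ K) (double M)
        V₁ V₂ : Word n → ℤ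
        V₁ v = (enumerator X v ⊠ K) (double M)
        V₂ v = (enumerator (⊟ X) v ⊠ K) (double M)
        lem₁ : ∀ e t V → e * (t * V + t * V) ≡ - (+ 2 * t * (e * (-1ℤ * V)))
        lem₁ = solve-∀

      -- One double sum, taken over the shadow, is non-negative; taken over C it is negative,
      -- strictly so because of the zero word.
      contradiction : 0ℤ < g (suc m) → (∀ c k → C c → ¬ (c ≡ 0ᵂ) → weight c ≡ double k → 0ℤ ≤ back k g (suc m)) → ⊥
      contradiction 0<g0 0≤gk = ℤₚ.<-irrefl refl (ℤₚ.<-≤-trans (ℤₚ.neg-mono-< negated-pos) (subst (0ℤ ≤_) (trans (shadow-sum value) flip) shadow-value))
        where
        t : Word n → ℤ
        t c = χ (weight c) * Σw (λ v → sign (inner v c) * value v)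
        F : Word n → ℤ
        F c = ind c * - t c
        flip : Σw (λ c → ind c * t c) ≡ - Σw F
        flip = trans (Σw-cong (λ c → lem (ind c) (t c))) (trans (Σw-*ˡ -1ℤ F) (ℤₚ.-1*i≡-i (Σw F)))
          where
          lem : ∀ i t → i * t ≡ -1ℤ * (i * - t)
          lem = solve-∀
        -t≡ : ∀ c k → weight c ≡ double k → - t c ≡ + 2 * pow2 n * back k g (suc m)
        -t≡ c k eq = trans (cong -_ (codeword-term c k eq)) (ℤₚ.neg-involutive _)
        weight-0 : ∀ n → weight (replicate n false) ≡ 0
        weight-0 zero    = refl
        weight-0 (suc n) = weight-0 n
        0<2^ : 0ℤ < + 2 * pow2 n
        0<2^ = 0<pow2 (suc n)
        0<-t0 : 0ℤ < - t 0ᵂ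
        0<-t0 = subst (0ℤ <_) (sym (-t≡ 0ᵂ 0 (weight-0 n))) (subst (_< + 2 * pow2 n * g (suc m)) (ℤₚ.*-zeroʳ (+ 2 * pow2 n)) (ℤₚ.*-monoˡ-<-pos (+ 2 * pow2 n) {{ℤ.positive 0<2^}} 0<g0))
        0≤-t : ∀ c → C c → 0ℤ ≤ - t c
        0≤-t c cc = by-cases (≡-dec _≟ᵇ_ c 0ᵂ)
          where
          by-cases : Dec (c ≡ 0ᵂ) → 0ℤ ≤ - t c
          by-cases (yes c≡0) = subst (λ z → 0ℤ ≤ - t z) (sym c≡0) (ℤₚ.<⇒≤ 0<-t0)
          by-cases (no c≢0)  = subst (0ℤ ≤_) (sym (-t≡ c (proj₁ (C-even cc)) (proj₂ (C-even cc)))) (0≤* (ℤₚ.<⇒≤ 0<2^) (0≤gk c (proj₁ (C-even cc)) cc c≢0 (proj₂ (C-even cc))))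
        F≥0 : ∀ c → 0ℤ ≤ F c
        F≥0 c = ind-*-nonneg c (0≤-t c)
        negated-pos : 0ℤ < Σw F
        negated-pos = ℤₚ.<-≤-trans (subst (0ℤ <_) (sym (trans (cong (_* - t 0ᵂ) (ind-yes C-0)) (ℤₚ.*-identityˡ _))) 0<-t0) (term≤Σw F≥0 0ᵂ)

-- Ratios of consecutive coefficients b_s

module Ratios where
  open import Data.Integer.Base using (_+_; _*_; -_; _-_; _≤_; _<_)
  open PowerSeries

  -- The pattern of all estimates below: a sum of products of non-negative quantities on one side,
  -- and a polynomial identity identifying it with the target.
  0≤-by : ∀ {a b} → 0ℤ ≤ a → a ≡ b → 0ℤ ≤ b
  0≤-by 0≤a refl = 0≤a

  ≤⇒0≤ : ∀ {a b} → a ≤ b → 0ℤ ≤ b - a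
  ≤⇒0≤ = ℤₚ.i≤j⇒0≤j-i

  0≤⇒≤ : ∀ {a b} → 0ℤ ≤ b - a → a ≤ b
  0≤⇒≤ = ℤₚ.0≤i-j⇒j≤i

  0≤-cancel : ∀ {c a} → 0ℤ < c → 0ℤ ≤ c * a → 0ℤ ≤ a
  0≤-cancel {c} {a} 0<c 0≤ca = ℤₚ.*-cancelˡ-≤-pos 0ℤ a c {{ℤ.positive 0<c}} (subst (_≤ c * a) (sym (ℤₚ.*-zeroʳ c)) 0≤ca)

  0<-cancel : ∀ {c a} → 0ℤ ≤ c → 0ℤ < c * a → 0ℤ < a
  0<-cancel {c} {a} 0≤c 0<ca = ℤₚ.*-cancelˡ-<-nonNeg c {{ℤ.nonNegative 0≤c}} (subst (_< c * a) (sym (ℤₚ.*-zeroʳ c)) 0<ca)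

  0<* : ∀ {a b} → 0ℤ < a → 0ℤ < b → 0ℤ < a * b
  0<* {a} {b} 0<a 0<b = subst (_< a * b) (ℤₚ.*-zeroʳ a) (ℤₚ.*-monoˡ-<-pos a {{ℤ.positive 0<a}} 0<b)

  0≤+ⁿ : ∀ n → 0ℤ ≤ + n
  0≤+ⁿ n = +≤+ ℕ.z≤n

  coeff-nonneg : ∀ Q q → q ℕ.≤ Q → ∀ s → 0ℤ ≤ coeff Q q s
  coeff-nonneg Q q q≤Q s = proj₁ (pair s)
    where
    0≤Q-q : 0ℤ ≤ + Q - + q
    0≤Q-q = ≤⇒0≤ (+≤+ q≤Q)
    pair : ∀ s → 0ℤ ≤ coeff Q q s × 0ℤ ≤ coeff Q q (suc s)
    pair zero    = subst (0ℤ ≤_) (sym (coeff-zero Q q)) (0≤+ⁿ 1) , subst (0ℤ ≤_) (sym (coeff-one Q q)) 0≤Q-q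
    pair (suc s) with pair s
    ... | 0≤s , 0≤s+1 = 0≤s+1 , 0≤-cancel {+ suc (suc s)} (ℤ.+<+ (ℕ.s≤s ℕ.z≤n))
      (subst (0ℤ ≤_) (sym (coeff-rec Q q s)) (0≤+ (0≤* 0≤Q-q 0≤s+1) (0≤* (0≤+ (0≤+ (0≤+ⁿ Q) (0≤+ⁿ q)) (0≤+ⁿ s)) 0≤s)))

  -- The homogenised polynomial Y⁶ F(X / Y).
  form : (c₁ c₂ X Y : ℤ) → ℤ
  form c₁ c₂ X Y = c₂ * (Y * Y * Y * Y * Y * Y) - (c₁ + + 2 * c₂) * (Y * Y * Y * Y * Y * X) + (+ 8 * c₁ - + 17 * c₂) * (Y * Y * Y * Y * X * X)
    - (+ 14 * c₁ + + 28 * c₂) * (Y * Y * Y * X * X * X) + (+ 8 * c₁ - + 17 * c₂) * (Y * Y * X * X * X * X) - (c₁ + + 2 * c₂) * (Y * X * X * X * X * X)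
    + c₂ * (X * X * X * X * X * X)

  -- What is retained of b_s, with K and G the difference and the sum of the exponents Q and q.
  record Sequence (K G : ℤ) (b : ℕ → ℤ) : Set where
    field
      0<K  : 0ℤ < K
      1≤G  : 0ℤ ≤ G - 1ℤ
      b₀   : b 0 ≡ 1ℤ
      b₁   : b 1 ≡ K
      rec  : ∀ s → + suc (suc s) * b (suc (suc s)) ≡ K * b (suc s) + (G + + s) * b s
      mono : ∀ s → b s ≤ b (suc s)

  coeff-sequence : ∀ Q q → q ℕ.≤ Q → Sequence (+ suc Q - + q) (+ suc Q + + q) (coeff (suc Q) q)
  coeff-sequence Q q q≤Q = record
    { 0<K  = ℤₚ.suc[i]≤j⇒i<j (0≤⇒≤ (0≤-by (≤⇒0≤ (+≤+ q≤Q)) (lem₁ (+ Q) (+ q))))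
    ; 1≤G  = 0≤-by (0≤+ (0≤+ⁿ Q) (0≤+ⁿ q)) (lem₂ (+ Q) (+ q))
    ; b₀   = coeff-zero (suc Q) q
    ; b₁   = coeff-one (suc Q) q
    ; rec  = coeff-rec (suc Q) q
    ; mono = λ s → subst (coeff (suc Q) q s ≤_) (sym (coeff-diff Q q s))
               (subst (_≤ coeff (suc Q) q s + coeff Q q (suc s)) (ℤₚ.+-identityʳ _) (ℤₚ.+-monoʳ-≤ (coeff (suc Q) q s) (coeff-nonneg Q q q≤Q (suc s)))) }
    where
    lem₁ : ∀ Q q → Q - q ≡ 1ℤ + Q - q - 1ℤ
    lem₁ = solve-∀
    lem₂ : ∀ Q q → Q + q ≡ 1ℤ + Q + q - 1ℤ
    lem₂ = solve-∀

  module _ {K G : ℤ} {b : ℕ → ℤ} (S : Sequence K G b) where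
    open Sequence S

    0≤K : 0ℤ ≤ K
    0≤K = ℤₚ.<⇒≤ 0<K

    0<b : ∀ s → 0ℤ < b s
    0<b zero    = subst (0ℤ <_) (sym b₀) (ℤ.+<+ (ℕ.s≤s ℕ.z≤n))
    0<b (suc s) = ℤₚ.<-≤-trans (0<b s) (mono s)

    0≤back : ∀ i s → 0ℤ ≤ back i b s
    0≤back zero    s       = ℤₚ.<⇒≤ (0<b s)
    0≤back (suc i) zero    = ℤₚ.≤-refl
    0≤back (suc i) (suc s) = 0≤back i s

    back-mono : ∀ i s → back (suc i) b s ≤ back i b s
    back-mono zero    zero    = ℤₚ.<⇒≤ (0<b 0)
    back-mono zero    (suc s) = mono s
    back-mono (suc i) zero    = ℤₚ.≤-refl
    back-mono (suc i) (suc s) = back-mono i s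

    rec′ : ∀ s → + suc s * b (suc s) ≡ K * b s + (G + + s - 1ℤ) * back 1 b s
    rec′ zero    rewrite b₀ | b₁ = lem K (G + 0ℤ - 1ℤ)
      where
      lem : ∀ K M → 1ℤ * K ≡ K * 1ℤ + M * 0ℤ
      lem = solve-∀
    rec′ (suc s) = trans (rec s) (cong (λ z → K * b (suc s) + z * b s) (lem G (+ s)))
      where
      lem : ∀ G s → G + s ≡ G + (1ℤ + s) - 1ℤ
      lem = solve-∀

    -- For y, x, z = b s, b (s - 1), b (s - 2): the ratios x / y and z / x differ by at most 1 / K.
    RatioStep : ℤ → ℤ → ℤ → Set
    RatioStep y x z = 0ℤ ≤ x * y - K * (x * x - y * z) × 0ℤ ≤ x * y + K * (x * x - y * z)

    -- Let E = x² - yz, and let E′ be the same expression one index later. The recurrence gives n E′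
    -- = y² - x² - M E, so the sign in front of E flips: the upper bound for E yields the lower
    -- bound for -E′ and conversely. Monotonicity of b absorbs y² - x².
    ratio-step₀ : ∀ s → RatioStep (b s) (back 1 b s) (back 2 b s)
    ratio-step₀ zero = 0≤-by (0≤+ⁿ 0) (lem₁ K (b 0)) , 0≤-by (0≤+ⁿ 0) (lem₂ K (b 0))
      where
      lem₁ : ∀ K y → 0ℤ ≡ 0ℤ * y - K * (0ℤ * 0ℤ - y * 0ℤ)
      lem₁ = solve-∀
      lem₂ : ∀ K y → 0ℤ ≡ 0ℤ * y + K * (0ℤ * 0ℤ - y * 0ℤ)
      lem₂ = solve-∀
    ratio-step₀ (suc zero) rewrite b₀ | b₁ = 0≤-by (0≤+ⁿ 0) (lem₁ K) , 0≤-by (0≤+ 0≤K 0≤K) (lem₂ K)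
      where
      lem₁ : ∀ K → 0ℤ ≡ 1ℤ * K - K * (1ℤ * 1ℤ - K * 0ℤ)
      lem₁ = solve-∀
      lem₂ : ∀ K → K + K ≡ 1ℤ * K + K * (1ℤ * 1ℤ - K * 0ℤ)
      lem₂ = solve-∀
    ratio-step₀ (suc (suc s)) with ratio-step₀ (suc s)
    ... | lower , upper =
        0≤-cancel {n} 0<n (0≤-by (0≤+ (0≤+ (0≤* 0≤M upper) (0≤* 0≤x 0≤y)) (0≤* 0≤K (0≤* 0≤x 0≤x)))
          (trans (lem₁ K M x y E) (trans (cong₂ (λ p q → p - K * q) (sym nYy) (sym scaled)) (lem₂ n (y * Y) K E′))))
      , 0≤-cancel {n} 0<n (0≤-by (0≤+ (0≤+ (0≤* 0≤M lower) (0≤* 0≤x 0≤y)) (0≤* 0≤K (0≤+ (0≤* 0≤y 0≤y) (0≤* (≤⇒0≤ (mono s)) (0≤+ 0≤x 0≤y)))))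
          (trans (lem₃ K M x y E) (trans (cong₂ (λ p q → p + K * q) (sym nYy) (sym scaled)) (lem₄ n (y * Y) K E′))))
      where
      n = + suc (suc s)
      0<n : 0ℤ < n
      0<n = ℤ.+<+ (ℕ.s≤s ℕ.z≤n)
      x = b s
      y = b (suc s)
      Y = b (suc (suc s))
      z = back 1 b s
      E = x * x - y * z
      M = G + + s - 1ℤ
      0≤x = ℤₚ.<⇒≤ (0<b s)
      0≤y = ℤₚ.<⇒≤ (0<b (suc s))
      0≤M : 0ℤ ≤ M
      0≤M = 0≤-by (0≤+ 1≤G (0≤+ⁿ s)) (lem G (+ s))
        where
        lem : ∀ G s → G - 1ℤ + s ≡ G + s - 1ℤ
        lem = solve-∀
      D = y * (K * y + (M + 1ℤ) * x)
      E′ = y * y - Y * x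
      nYy : n * (y * Y) ≡ D
      nYy = trans (lem′ n y Y) (cong (y *_) (trans (rec s) (cong (λ z → K * y + z * x) (lem G (+ s)))))
        where
        lem : ∀ G s → G + s ≡ G + s - 1ℤ + 1ℤ
        lem = solve-∀
        lem′ : ∀ n y Y → n * (y * Y) ≡ y * (n * Y)
        lem′ = solve-∀
      scaled : n * E′ ≡ y * y - x * x - M * E
      scaled = trans (lem (+ s) x y Y) (trans (cong₂ (λ p q → p * y + y * y - x * q) (rec′ s) (trans (rec s) (cong (λ z → K * y + z * x) (lem″ G (+ s))))) (lem′ K M x y z))
        where
        lem : ∀ s x y Y → (+ 2 + s) * (y * y - Y * x) ≡ (1ℤ + s) * y * y + y * y - x * ((+ 2 + s) * Y)
        lem = solve-∀
        lem″ : ∀ G s → G + s ≡ G + s - 1ℤ + 1ℤ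
        lem″ = solve-∀
        lem′ : ∀ K M x y z → (K * x + M * z) * y + y * y - x * (K * y + (M + 1ℤ) * x) ≡ y * y - x * x - M * (x * x - y * z)
        lem′ = solve-∀
      lem₂ : ∀ n a K E → n * a - K * (n * E) ≡ n * (a - K * E)
      lem₂ = solve-∀
      lem₄ : ∀ n a K E → n * a + K * (n * E) ≡ n * (a + K * E)
      lem₄ = solve-∀
      lem₁ : ∀ K M x y E → M * (x * y + K * E) + x * y + K * (x * x) ≡ y * (K * y + (M + 1ℤ) * x) - K * (y * y - x * x - M * E)
      lem₁ = solve-∀
      lem₃ : ∀ K M x y E → M * (x * y - K * E) + x * y + K * (y * y + (y - x) * (x + y)) ≡ y * (K * y + (M + 1ℤ) * x) + K * (y * y - x * x - M * E)
      lem₃ = solve-∀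

    ratio-step : ∀ i s → RatioStep (back i b s) (back (suc i) b s) (back (suc (suc i)) b s)
    ratio-step zero    s       = ratio-step₀ s
    ratio-step (suc i) zero    = 0≤-by (0≤+ⁿ 0) (lem₁ K) , 0≤-by (0≤+ⁿ 0) (lem₂ K)
      where
      lem₁ : ∀ K → 0ℤ ≡ 0ℤ * 0ℤ - K * (0ℤ * 0ℤ - 0ℤ * 0ℤ)
      lem₁ = solve-∀
      lem₂ : ∀ K → 0ℤ ≡ 0ℤ * 0ℤ + K * (0ℤ * 0ℤ - 0ℤ * 0ℤ)
      lem₂ = solve-∀
    ratio-step (suc i) (suc s) = ratio-step i s

    rec″ : ∀ s → + s * b s ≡ K * back 1 b s + (G + + s - + 2) * back 2 b s
    rec″ zero    = lem (b 0) K (G + 0ℤ - + 2)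
      where
      lem : ∀ y K M → 0ℤ * y ≡ K * 0ℤ + M * 0ℤ
      lem = solve-∀
    rec″ (suc s) = trans (rec′ s) (cong (λ z → K * b s + z * back 1 b s) (lem G (+ s)))
      where
      lem : ∀ G s → G + s - 1ℤ ≡ G + (1ℤ + s) - + 2
      lem = solve-∀

    module At (s : ℕ) where
      u : ℕ → ℤ
      u i = back i b s

      Y = b s
      X₁ = back 1 b s

      0<Y : 0ℤ < Y
      0<Y = 0<b s

      0≤Y : 0ℤ ≤ Y
      0≤Y = ℤₚ.<⇒≤ 0<Y

      0≤X₁ : 0ℤ ≤ X₁
      0≤X₁ = 0≤back 1 s

      X₁≤Y : 0ℤ ≤ Y - X₁
      X₁≤Y = ≤⇒0≤ (back-mono 0 s)

      u≤Y : ∀ i → u i ≤ Y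
      u≤Y zero    = ℤₚ.≤-refl
      u≤Y (suc i) = ℤₚ.≤-trans (back-mono i s) (u≤Y i)

      -- The i steps between the two ratios add up to |u_(i+1) / u_i - X₁ / Y| ≤ i / K.
      ratio-drift : ∀ i → 0ℤ ≤ + i * Y * u i + K * (Y * u (suc i) - X₁ * u i) × 0ℤ ≤ + i * Y * u i - K * (Y * u (suc i) - X₁ * u i)
      ratio-drift zero = 0≤-by (0≤+ⁿ 0) (lem₁ K Y X₁) , 0≤-by (0≤+ⁿ 0) (lem₂ K Y X₁)
        where
        lem₁ : ∀ K Y X → 0ℤ ≡ 0ℤ * Y * Y + K * (Y * X - X * Y)
        lem₁ = solve-∀
        lem₂ : ∀ K Y X → 0ℤ ≡ 0ℤ * Y * Y - K * (Y * X - X * Y)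
        lem₂ = solve-∀
      ratio-drift (suc i) with ratio-drift i | ratio-step i s | u i ℤₚ.≟ 0ℤ
      -- Here the index has dropped below 0 and all later terms vanish as well; in the other case u
      -- i can be cancelled.
      ... | _ | _ | yes u≡0 = 0≤-by (0≤+ⁿ 0) (trans (lem₁ (+ i) K Y X₁) (cong₂ (λ p q → + suc i * Y * p + K * (Y * q - X₁ * p)) (sym u₁≡0) (sym u₂≡0)))
                            , 0≤-by (0≤+ⁿ 0) (trans (lem₂ (+ i) K Y X₁) (cong₂ (λ p q → + suc i * Y * p - K * (Y * q - X₁ * p)) (sym u₁≡0) (sym u₂≡0)))
        where
        u₁≡0 : u (suc i) ≡ 0ℤ
        u₁≡0 = ℤₚ.≤-antisym (subst (u (suc i) ≤_) u≡0 (back-mono i s)) (0≤back (suc i) s)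
        u₂≡0 : u (suc (suc i)) ≡ 0ℤ
        u₂≡0 = ℤₚ.≤-antisym (subst (u (suc (suc i)) ≤_) u₁≡0 (back-mono (suc i) s)) (0≤back (suc (suc i)) s)
        lem₁ : ∀ i K Y X → 0ℤ ≡ (1ℤ + i) * Y * 0ℤ + K * (Y * 0ℤ - X * 0ℤ)
        lem₁ = solve-∀
        lem₂ : ∀ i K Y X → 0ℤ ≡ (1ℤ + i) * Y * 0ℤ - K * (Y * 0ℤ - X * 0ℤ)
        lem₂ = solve-∀
      ... | upper , lower | step₋ , step₊ | no u≢0 =
          0≤-cancel 0<u (0≤-by (0≤+ (0≤* 0≤Y step₋) (0≤* (0≤back (suc i) s) upper)) (lem₁ (+ i) K Y X₁ (u i) (u (suc i)) (u (suc (suc i)))))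
        , 0≤-cancel 0<u (0≤-by (0≤+ (0≤* 0≤Y step₊) (0≤* (0≤back (suc i) s) lower)) (lem₂ (+ i) K Y X₁ (u i) (u (suc i)) (u (suc (suc i)))))
        where
        0<u : 0ℤ < u i
        0<u = ℤₚ.≤∧≢⇒< (0≤back i s) (λ eq → u≢0 (sym eq))
        lem₁ : ∀ i K Y X y x z → Y * (x * y - K * (x * x - y * z)) + x * (i * Y * y + K * (Y * x - X * y)) ≡ y * ((1ℤ + i) * Y * x + K * (Y * z - X * x))
        lem₁ = solve-∀
        lem₂ : ∀ i K Y X y x z → Y * (x * y + K * (x * x - y * z)) + x * (i * Y * y - K * (Y * x - X * y)) ≡ y * ((1ℤ + i) * Y * x - K * (Y * z - X * x))
        lem₂ = solve-∀

      triangle : ℕ → ℤ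
      triangle zero    = 0ℤ
      triangle (suc i) = triangle i + + i

      0≤triangle : ∀ i → 0ℤ ≤ triangle i
      0≤triangle zero    = 0≤+ⁿ 0
      0≤triangle (suc i) = 0≤+ (0≤triangle i) (0≤+ⁿ i)

      pw : ℤ → ℕ → ℤ
      pw a zero    = 1ℤ
      pw a (suc i) = a * pw a i

      0≤pw : ∀ i → 0ℤ ≤ pw Y i
      0≤pw zero    = 0≤+ⁿ 1
      0≤pw (suc i) = 0≤* 0≤Y (0≤pw i)

      -- Says |u_i / Y - (X₁ / Y)^i| ≤ `triangle i` / K: as all ratios are at most 1, the drift i /
      -- K of the next ratio is simply added.
      geometric : ∀ i → 0ℤ ≤ triangle i * (Y * pw Y i) + K * (pw Y i * u i - pw X₁ i * Y) × 0ℤ ≤ triangle i * (Y * pw Y i) - K * (pw Y i * u i - pw X₁ i * Y)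
      geometric zero = 0≤-by (0≤+ⁿ 0) (lem₁ K Y) , 0≤-by (0≤+ⁿ 0) (lem₂ K Y)
        where
        lem₁ : ∀ K Y → 0ℤ ≡ 0ℤ * (Y * 1ℤ) + K * (1ℤ * Y - 1ℤ * Y)
        lem₁ = solve-∀
        lem₂ : ∀ K Y → 0ℤ ≡ 0ℤ * (Y * 1ℤ) - K * (1ℤ * Y - 1ℤ * Y)
        lem₂ = solve-∀
      geometric (suc i) with geometric i | ratio-drift i
      ... | upper , lower | drift₊ , drift₋ =
          0≤-by (0≤+ (0≤* (0≤pw i) (0≤+ drift₊ slack₁)) (0≤+ (0≤* 0≤X₁ upper) slack₂)) (lem₁ (+ i) (triangle i) K Y X₁ (u i) (u (suc i)) (pw Y i) (pw X₁ i))
        , 0≤-by (0≤+ (0≤* (0≤pw i) (0≤+ drift₋ slack₁)) (0≤+ (0≤* 0≤X₁ lower) slack₂)) (lem₂ (+ i) (triangle i) K Y X₁ (u i) (u (suc i)) (pw Y i) (pw X₁ i))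
        where
        slack₁ : 0ℤ ≤ + i * Y * (Y - u i)
        slack₁ = 0≤* (0≤* (0≤+ⁿ i) 0≤Y) (≤⇒0≤ (u≤Y i))
        slack₂ : 0ℤ ≤ triangle i * (Y * pw Y i) * (Y - X₁)
        slack₂ = 0≤* (0≤* (0≤triangle i) (0≤* 0≤Y (0≤pw i))) X₁≤Y
        lem₁ : ∀ i t K Y X y x P R → P * (i * Y * y + K * (Y * x - X * y) + i * Y * (Y - y)) + (X * (t * (Y * P) + K * (P * y - R * Y)) + t * (Y * P) * (Y - X))
          ≡ (t + i) * (Y * (Y * P)) + K * (Y * P * x - X * R * Y)
        lem₁ = solve-∀
        lem₂ : ∀ i t K Y X y x P R → P * (i * Y * y - K * (Y * x - X * y) + i * Y * (Y - y)) + (X * (t * (Y * P) - K * (P * y - R * Y)) + t * (Y * P) * (Y - X))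
          ≡ (t + i) * (Y * (Y * P)) - K * (Y * P * x - X * R * Y)
        lem₂ = solve-∀

      combination : (c₁ c₂ : ℤ) → ℤ
      combination c₁ c₂ = c₂ * b s - (c₁ + + 2 * c₂) * u 1 + (+ 8 * c₁ - + 17 * c₂) * u 2 - (+ 14 * c₁ + + 28 * c₂) * u 3
        + (+ 8 * c₁ - + 17 * c₂) * u 4 - (c₁ + + 2 * c₂) * u 5 + c₂ * u 6

      -- The error constants weight the coefficients of F by the triangular numbers 1, 3, 6, 10, 15:
      -- 108 = 8·1 + 14·3 + 8·6 + 10 and 238 = 17·1 + 28·3 + 17·6 + 2·10 + 15. The parts in c₁ and
      -- c₂ are estimated separately since 8c₁ - 17c₂ has no fixed sign.
      combination-approx : ∀ {c₁ c₂} → 0ℤ ≤ c₁ → 0ℤ ≤ c₂ →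
        0ℤ ≤ K * (Y * Y * Y * Y * Y * Y) * combination c₁ c₂ - K * Y * form c₁ c₂ X₁ Y + (+ 108 * c₁ + + 238 * c₂) * (Y * Y * Y * Y * Y * Y * Y)
      combination-approx {c₁} {c₂} 0≤c₁ 0≤c₂ = 0≤-by
        (0≤+ (0≤+ (0≤+ (0≤+ (0≤+ (0≤+
          (0≤* (0≤* (0≤* (0≤+ⁿ 8) 0≤c₁) (0≤pw 4)) (proj₁ (geometric 2)))
          (0≤* (0≤* (0≤* (0≤+ⁿ 17) 0≤c₂) (0≤pw 4)) (proj₂ (geometric 2))))
          (0≤* (0≤* (0≤+ (0≤* (0≤+ⁿ 14) 0≤c₁) (0≤* (0≤+ⁿ 28) 0≤c₂)) (0≤pw 3)) (proj₂ (geometric 3))))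
          (0≤* (0≤* (0≤* (0≤+ⁿ 8) 0≤c₁) (0≤pw 2)) (proj₁ (geometric 4))))
          (0≤* (0≤* (0≤* (0≤+ⁿ 17) 0≤c₂) (0≤pw 2)) (proj₂ (geometric 4))))
          (0≤* (0≤* (0≤+ 0≤c₁ (0≤* (0≤+ⁿ 2) 0≤c₂)) (0≤pw 1)) (proj₂ (geometric 5))))
          (0≤* 0≤c₂ (proj₁ (geometric 6))))
        (identity K Y X₁ c₁ c₂ (u 2) (u 3) (u 4) (u 5) (u 6))
        where
        identity : ∀ K Y X c₁ c₂ u₂ u₃ u₄ u₅ u₆ →
          + 8 * c₁ * (Y * (Y * (Y * (Y * 1ℤ)))) * (+ 1 * (Y * (Y * (Y * 1ℤ))) + K * (Y * (Y * 1ℤ) * u₂ - X * (X * 1ℤ) * Y))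
          + + 17 * c₂ * (Y * (Y * (Y * (Y * 1ℤ)))) * (+ 1 * (Y * (Y * (Y * 1ℤ))) - K * (Y * (Y * 1ℤ) * u₂ - X * (X * 1ℤ) * Y))
          + (+ 14 * c₁ + + 28 * c₂) * (Y * (Y * (Y * 1ℤ))) * (+ 3 * (Y * (Y * (Y * (Y * 1ℤ)))) - K * (Y * (Y * (Y * 1ℤ)) * u₃ - X * (X * (X * 1ℤ)) * Y))
          + + 8 * c₁ * (Y * (Y * 1ℤ)) * (+ 6 * (Y * (Y * (Y * (Y * (Y * 1ℤ))))) + K * (Y * (Y * (Y * (Y * 1ℤ))) * u₄ - X * (X * (X * (X * 1ℤ))) * Y))
          + + 17 * c₂ * (Y * (Y * 1ℤ)) * (+ 6 * (Y * (Y * (Y * (Y * (Y * 1ℤ))))) - K * (Y * (Y * (Y * (Y * 1ℤ))) * u₄ - X * (X * (X * (X * 1ℤ))) * Y))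
          + (c₁ + + 2 * c₂) * (Y * 1ℤ) * (+ 10 * (Y * (Y * (Y * (Y * (Y * (Y * 1ℤ)))))) - K * (Y * (Y * (Y * (Y * (Y * 1ℤ)))) * u₅ - X * (X * (X * (X * (X * 1ℤ)))) * Y))
          + c₂ * (+ 15 * (Y * (Y * (Y * (Y * (Y * (Y * (Y * 1ℤ))))))) + K * (Y * (Y * (Y * (Y * (Y * (Y * 1ℤ))))) * u₆ - X * (X * (X * (X * (X * (X * 1ℤ))))) * Y))
          ≡ K * (Y * Y * Y * Y * Y * Y) * (c₂ * Y - (c₁ + + 2 * c₂) * X + (+ 8 * c₁ - + 17 * c₂) * u₂ - (+ 14 * c₁ + + 28 * c₂) * u₃
              + (+ 8 * c₁ - + 17 * c₂) * u₄ - (c₁ + + 2 * c₂) * u₅ + c₂ * u₆)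
            - K * Y * (c₂ * (Y * Y * Y * Y * Y * Y) - (c₁ + + 2 * c₂) * (Y * Y * Y * Y * Y * X) + (+ 8 * c₁ - + 17 * c₂) * (Y * Y * Y * Y * X * X)
              - (+ 14 * c₁ + + 28 * c₂) * (Y * Y * Y * X * X * X) + (+ 8 * c₁ - + 17 * c₂) * (Y * Y * X * X * X * X) - (c₁ + + 2 * c₂) * (Y * X * X * X * X * X)
              + c₂ * (X * X * X * X * X * X))
            + (+ 108 * c₁ + + 238 * c₂) * (Y * Y * Y * Y * Y * Y * Y)
        identity = solve-∀

      -- If F(X₁ / Y) ≥ 1 / W, the relative error must stay below 1 / W; with c₂ ≤ c₁ it is at most
      -- (108 + 238) c₁ / K.
      combination-pos : ∀ {c₁ c₂ W} → 0ℤ ≤ c₁ → 0ℤ ≤ c₂ → 0ℤ ≤ c₁ - c₂ → 0ℤ ≤ W → 0ℤ < K - + 346 * c₁ * W →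
        0ℤ ≤ W * form c₁ c₂ X₁ Y - Y * Y * Y * Y * Y * Y → 0ℤ < combination c₁ c₂
      combination-pos {c₁} {c₂} {W} 0≤c₁ 0≤c₂ c₂≤c₁ 0≤W large 0≤WF = 0<-cancel (0≤* 0≤W (0≤* 0≤K 0≤Y⁶))
        (ℤₚ.<-≤-trans (0<* large (0<* (0<* (0<* (0<* (0<* (0<* 0<Y 0<Y) 0<Y) 0<Y) 0<Y) 0<Y) 0<Y))
          (0≤⇒≤ (0≤-by (0≤+ (0≤+ (0≤* 0≤W (combination-approx 0≤c₁ 0≤c₂)) (0≤* (0≤* 0≤K 0≤Y) 0≤WF)) (0≤* (0≤* (0≤* (0≤+ⁿ 238) 0≤W) c₂≤c₁) (0≤* 0≤Y⁶ 0≤Y)))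
            (lem K W Y c₁ c₂ (combination c₁ c₂) (form c₁ c₂ X₁ Y)))))
        where
        0≤Y⁶ : 0ℤ ≤ Y * Y * Y * Y * Y * Y
        0≤Y⁶ = 0≤* (0≤* (0≤* (0≤* (0≤* 0≤Y 0≤Y) 0≤Y) 0≤Y) 0≤Y) 0≤Y
        lem : ∀ K W Y c₁ c₂ g F →
          W * (K * (Y * Y * Y * Y * Y * Y) * g - K * Y * F + (+ 108 * c₁ + + 238 * c₂) * (Y * Y * Y * Y * Y * Y * Y))
          + K * Y * (W * F - Y * Y * Y * Y * Y * Y)
          + + 238 * W * (c₁ - c₂) * (Y * Y * Y * Y * Y * Y * Y)
          ≡ W * (K * (Y * Y * Y * Y * Y * Y)) * g - (K - + 346 * c₁ * W) * (Y * Y * Y * Y * Y * Y * Y)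
        lem = solve-∀

      -- Let r = X₁ / Y and let r′ be the preceding ratio. The recurrence reads s = K r + M r r′, so
      -- M r² exceeds s by at most M / K. Hence M (α² - β² r²) ≥ μ - K β² - β² M / K. The last
      -- hypotheses bound each of the two losses by μ / 4, and M ≤ 5μ leaves 10 (α² - β² r²) ≥ 1.
      -- Division by α + β r ≤ 2α gives the linear form.
      ratio-upper : ∀ α β μ → let M = G + + s - + 2 in
        0ℤ < α → 0ℤ ≤ β → 0ℤ ≤ μ → 0ℤ < M → 0ℤ ≤ + 5 * μ - M → 0ℤ ≤ α * α * M - β * β * + s - (μ - K * (β * β)) →
        0ℤ ≤ μ - + 4 * (K * (β * β)) → 0ℤ ≤ K - + 20 * (β * β) → 0ℤ ≤ + 20 * α * (α * Y - β * X₁) - Y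
      ratio-upper α β μ 0<α 0≤β 0≤μ 0<M M≤5μ gap μ-large K-large = 0≤-cancel 0<Y
        (0≤-by (0≤+ 0≤square (0≤* (0≤+ⁿ 10) (0≤* 0≤a 0≤a))) (lem₃ α β X₁ Y))
        where
        M = G + + s - + 2
        z = back 2 b s
        a = α * Y - β * X₁
        0≤M = ℤₚ.<⇒≤ 0<M
        0≤β² = 0≤* 0≤β 0≤β
        0≤Y² = 0≤* 0≤Y 0≤Y
        0≤square : 0ℤ ≤ + 10 * (α * α * (Y * Y) - β * β * (X₁ * X₁)) - Y * Y
        0≤square = 0≤-cancel (0<* {+ 2} (ℤ.+<+ (ℕ.s≤s ℕ.z≤n)) (0<* 0<K 0<M)) (0≤-by
          (0≤+ (0≤* (0≤+ⁿ 2) (0≤+ (0≤+ (0≤+ (0≤+ (0≤+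
              (0≤* (0≤+ⁿ 10) (0≤* 0≤β² (0≤* 0≤M (proj₁ (ratio-step 0 s)))))
              (0≤* (0≤+ⁿ 10) (0≤* 0≤β² (0≤* 0≤M (0≤* 0≤Y X₁≤Y)))))
              (0≤* (0≤+ⁿ 10) (0≤* 0≤β² (0≤* (0≤* 0≤K 0≤K) (0≤* 0≤X₁ 0≤Y)))))
              (0≤* (0≤+ⁿ 10) (0≤* 0≤K (0≤* 0≤Y² gap))))
              (0≤* (0≤+ⁿ 10) (0≤* 0≤β² (0≤* 0≤Y² M≤5μ))))
              (0≤* 0≤K (0≤* 0≤Y² M≤5μ))))
            (0≤* 0≤Y² (0≤+ (0≤* (0≤+ⁿ 5) (0≤* 0≤K μ-large)) (0≤* (0≤+ⁿ 5) (0≤* 0≤μ K-large)))))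
          (trans (lem₁ K M α β μ (+ s) X₁ Y z)
            (trans (cong (λ t → + 2 * (K * M) * (+ 10 * (α * α * (Y * Y) - β * β * (X₁ * X₁)) - Y * Y) + + 20 * (β * β) * K * Y * (t - + s * Y)) (sym (rec″ s)))
              (lem₂ (+ 2 * (K * M) * (+ 10 * (α * α * (Y * Y) - β * β * (X₁ * X₁)) - Y * Y)) (+ 20 * (β * β) * K * Y) (+ s * Y)))))
          where
          lem₁ : ∀ K M α β μ s X Y z →
            + 2 * (+ 10 * (β * β * (M * (X * Y - K * (X * X - Y * z)))) + + 10 * (β * β * (M * (Y * (Y - X)))) + + 10 * (β * β * (K * K * (X * Y)))
              + + 10 * (K * (Y * Y * (α * α * M - β * β * s - (μ - K * (β * β))))) + + 10 * (β * β * (Y * Y * (+ 5 * μ - M))) + K * (Y * Y * (+ 5 * μ - M)))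
            + Y * Y * (+ 5 * (K * (μ - + 4 * (K * (β * β)))) + + 5 * (μ * (K - + 20 * (β * β))))
            ≡ + 2 * (K * M) * (+ 10 * (α * α * (Y * Y) - β * β * (X * X)) - Y * Y) + + 20 * (β * β) * K * Y * (K * X + M * z - s * Y)
          lem₁ = solve-∀
          lem₂ : ∀ a b c → a + b * (c - c) ≡ a
          lem₂ = solve-∀
        0≤a : 0ℤ ≤ a
        0≤a = ℤₚ.<⇒≤ (0<-cancel {+ 10 * (α * Y + β * X₁)} (0≤* (0≤+ⁿ 10) (0≤+ (0≤* (ℤₚ.<⇒≤ 0<α) 0≤Y) (0≤* 0≤β 0≤X₁)))
          (ℤₚ.<-≤-trans (0<* 0<Y 0<Y) (0≤⇒≤ (0≤-by 0≤square (lem α β X₁ Y)))))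
          where
          lem : ∀ α β X Y → + 10 * (α * α * (Y * Y) - β * β * (X * X)) - Y * Y ≡ + 10 * (α * Y + β * X) * (α * Y - β * X) - Y * Y
          lem = solve-∀
        lem₃ : ∀ α β X Y → + 10 * (α * α * (Y * Y) - β * β * (X * X)) - Y * Y + + 10 * ((α * Y - β * X) * (α * Y - β * X)) ≡ Y * (+ 20 * α * (α * Y - β * X) - Y)
        lem₃ = solve-∀

      -- The opposite estimate M r² ≥ s - K - M / K. The losses K and M / K are at most s / 12 each,
      -- so 5 s r² ≥ 5 s / 6. The limit of r² at the top index is 1/5; the weaker 1/6 already makes
      -- 1 - 6r + r² negative.
      ratio-lower : let M = G + + s - + 2 in
        0ℤ < + s → 0ℤ < M → 0ℤ ≤ + 5 * + s - M → 0ℤ ≤ + s - + 12 * K → 0ℤ ≤ K - + 60 → 0ℤ ≤ + 6 * (X₁ * X₁) - Y * Y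
      ratio-lower 0<s 0<M M≤5s s-large K-large = 0≤-cancel (0<* {+ 10} (ℤ.+<+ (ℕ.s≤s ℕ.z≤n)) (0<* 0<s 0<K)) (0≤-by
          (0≤+ (0≤+ (0≤+ (0≤+ (0≤+
            (0≤* (0≤+ⁿ 12) (0≤* 0≤M (proj₂ (ratio-step 0 s))))
            (0≤* (0≤+ⁿ 12) (0≤* 0≤K (0≤* (0≤* 0≤X₁ 0≤X₁) M≤5s))))
            (0≤* (0≤+ⁿ 12) (0≤* (0≤* 0≤K 0≤K) (0≤* 0≤Y X₁≤Y))))
            (0≤* (0≤+ⁿ 12) (0≤* 0≤M (0≤* 0≤Y X₁≤Y))))
            (0≤* (0≤+ⁿ 12) (0≤* 0≤Y² M≤5s)))
            (0≤* 0≤Y² (0≤+ (0≤* 0≤K s-large) (0≤* (ℤₚ.<⇒≤ 0<s) K-large))))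
          (trans (lem₁ K M (+ s) X₁ Y z)
            (trans (cong (λ t → + 10 * (+ s * K) * (+ 6 * (X₁ * X₁) - Y * Y) - + 12 * K * Y * (t - + s * Y)) (sym (rec″ s)))
              (lem₂ (+ 10 * (+ s * K) * (+ 6 * (X₁ * X₁) - Y * Y)) (+ 12 * K * Y) (+ s * Y)))))
        where
        M = G + + s - + 2
        z = back 2 b s
        0≤M = ℤₚ.<⇒≤ 0<M
        0≤Y² = 0≤* 0≤Y 0≤Y
        lem₁ : ∀ K M s X Y z →
          + 12 * (M * (X * Y + K * (X * X - Y * z))) + + 12 * (K * (X * X * (+ 5 * s - M))) + + 12 * (K * K * (Y * (Y - X))) + + 12 * (M * (Y * (Y - X)))
            + + 12 * (Y * Y * (+ 5 * s - M)) + Y * Y * (K * (s - + 12 * K) + s * (K - + 60))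
          ≡ + 10 * (s * K) * (+ 6 * (X * X) - Y * Y) - + 12 * K * Y * (K * X + M * z - s * Y)
        lem₁ = solve-∀
        lem₂ : ∀ a b c → a - b * (c - c) ≡ a
        lem₂ = solve-∀

  -- Factorisation of F and lower bounds for its values

  module Factor (H j : ℤ) (1≤j : 0ℤ ≤ j - 1ℤ) (j<H : 0ℤ ≤ H - j - 1ℤ) (3H≤5j : 0ℤ ≤ + 5 * j - + 3 * H) where

    -- With t = j / H, u / v is (1 - t)/(1 + t) and c₁ / c₂ is J(t). The factor (H² - j²)² of the
    -- denominator is written through H² + j² and H² j², the two quantities in which the
    -- factorisation is carried out.
    u v c₁ c₂ : ℤ
    u = H - j
    v = H + j
    c₁ = (H * H + j * j) * (H * H + j * j) * ((H * H + j * j) * (H * H + j * j))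
    c₂ = ((H * H + j * j) * (H * H + j * j) - + 4 * (H * H * (j * j))) * (H * H * (j * j))

    0≤j : 0ℤ ≤ j
    0≤j = 0≤-by (0≤+ 1≤j (0≤+ⁿ 1)) (lem j)
      where
      lem : ∀ j → j - 1ℤ + 1ℤ ≡ j
      lem = solve-∀

    0≤u : 0ℤ ≤ u
    0≤u = 0≤-by (0≤+ j<H (0≤+ⁿ 1)) (lem H j)
      where
      lem : ∀ H j → H - j - 1ℤ + 1ℤ ≡ H - j
      lem = solve-∀

    0≤H : 0ℤ ≤ H
    0≤H = 0≤-by (0≤+ 0≤u 0≤j) (lem H j)
      where
      lem : ∀ H j → H - j + j ≡ H
      lem = solve-∀

    0≤v : 0ℤ ≤ v
    0≤v = 0≤+ 0≤H 0≤j

    0<u : 0ℤ < u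
    0<u = ℤₚ.suc[i]≤j⇒i<j (0≤⇒≤ j<H)

    0<j : 0ℤ < j
    0<j = ℤₚ.suc[i]≤j⇒i<j (0≤⇒≤ 1≤j)

    -- The bound t ≥ 3/5 puts (u / v)² below 1/16, hence below 3 - 2√2, the smaller root of 1 - 6Z +
    -- Z².
    16u²≤v² : 0ℤ ≤ v * v - + 16 * (u * u)
    16u²≤v² = 0≤-by (0≤* 3H≤5j (0≤+ 0≤v (0≤* (0≤+ⁿ 4) 0≤u))) (lem H j)
      where
      lem : ∀ H j → (+ 5 * j - + 3 * H) * (H + j + + 4 * (H - j)) ≡ (H + j) * (H + j) - + 16 * ((H - j) * (H - j))
      lem = solve-∀

    0≤c₁ : 0ℤ ≤ c₁
    0≤c₁ = 0≤* (0≤* 0≤B 0≤B) (0≤* 0≤B 0≤B)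
      where
      0≤B = 0≤+ (0≤* 0≤H 0≤H) (0≤* 0≤j 0≤j)

    0≤c₂ : 0ℤ ≤ c₂
    0≤c₂ = 0≤* (0≤-by (0≤* (0≤* 0≤u 0≤v) (0≤* 0≤u 0≤v)) (lem H j)) (0≤* (0≤* 0≤H 0≤H) (0≤* 0≤j 0≤j))
      where
      lem : ∀ H j → (H - j) * (H + j) * ((H - j) * (H + j)) ≡ (H * H + j * j) * (H * H + j * j) - + 4 * (H * H * (j * j))
      lem = solve-∀

    c₂≤c₁ : 0ℤ ≤ c₁ - c₂
    c₂≤c₁ = 0≤-by (0≤+ (0≤+ (0≤* (0≤* 0≤H² 0≤H²) 0≤B²) (0≤* (0≤* 0≤j² 0≤j²) 0≤B²)) (0≤+ (0≤* (0≤* 0≤H² 0≤j²) 0≤B²) (0≤* (0≤+ⁿ 4) (0≤* (0≤* 0≤H² 0≤j²) (0≤* 0≤H² 0≤j²))))) (lem (H * H) (j * j))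
      where
      0≤H² = 0≤* 0≤H 0≤H
      0≤j² = 0≤* 0≤j 0≤j
      0≤B² = 0≤* (0≤+ 0≤H² 0≤j²) (0≤+ 0≤H² 0≤j²)
      lem : ∀ a b → a * a * ((a + b) * (a + b)) + b * b * ((a + b) * (a + b)) + (a * b * ((a + b) * (a + b)) + + 4 * (a * b * (a * b)))
        ≡ (a + b) * (a + b) * ((a + b) * (a + b)) - ((a + b) * (a + b) - + 4 * (a * b)) * (a * b)
      lem = solve-∀

    -- J is invariant under y -> 1/y and y -> (1 - y)/(1 + y), so in Z = y² the roots of J = J(t)
    -- are t², (u / v)² and their inverses. The quadratic factor comes from dJ.
    form-factor : ∀ X Y → form c₁ c₂ X Y ≡
      (u * u * Y - v * v * X) * (v * v * Y - u * u * X) * ((j * j * Y - H * H * X) * (H * H * Y - j * j * X)) * (Y * Y - + 6 * (X * Y) + X * X)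
    form-factor X Y = trans (lem₁ ((H * H + j * j) * (H * H + j * j)) (H * H * (j * j)) X Y)
      (cong₂ (λ a b → a * b * (Y * Y - + 6 * (X * Y) + X * X)) (lem₂ H j X Y) (lem₃ H j X Y))
      where
      lem₁ : ∀ B C X Y →
        (B - + 4 * C) * C * (Y * Y * Y * Y * Y * Y) - (B * B + + 2 * ((B - + 4 * C) * C)) * (Y * Y * Y * Y * Y * X)
          + (+ 8 * (B * B) - + 17 * ((B - + 4 * C) * C)) * (Y * Y * Y * Y * X * X)
          - (+ 14 * (B * B) + + 28 * ((B - + 4 * C) * C)) * (Y * Y * Y * X * X * X)
          + (+ 8 * (B * B) - + 17 * ((B - + 4 * C) * C)) * (Y * Y * X * X * X * X)
          - (B * B + + 2 * ((B - + 4 * C) * C)) * (Y * X * X * X * X * X) + (B - + 4 * C) * C * (X * X * X * X * X * X)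
        ≡ ((B - + 4 * C) * ((Y + X) * (Y + X)) - + 4 * B * (X * Y)) * (C * ((Y + X) * (Y + X)) - B * (X * Y)) * (Y * Y - + 6 * (X * Y) + X * X)
      lem₁ = solve-∀
      lem₂ : ∀ H j X Y →
        ((H * H + j * j) * (H * H + j * j) - + 4 * (H * H * (j * j))) * ((Y + X) * (Y + X)) - + 4 * ((H * H + j * j) * (H * H + j * j)) * (X * Y)
        ≡ ((H - j) * (H - j) * Y - (H + j) * (H + j) * X) * ((H + j) * (H + j) * Y - (H - j) * (H - j) * X)
      lem₂ = solve-∀
      lem₃ : ∀ H j X Y →
        H * H * (j * j) * ((Y + X) * (Y + X)) - (H * H + j * j) * (H * H + j * j) * (X * Y)
        ≡ (j * j * Y - H * H * X) * (H * H * Y - j * j * X)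
      lem₃ = solve-∀

    0≤*-mono : ∀ {a b c d} → 0ℤ ≤ a → 0ℤ ≤ d → 0ℤ ≤ b - a → 0ℤ ≤ d - c → 0ℤ ≤ b * d - a * c
    0≤*-mono {a} {b} {c} {d} 0≤a 0≤d a≤b c≤d = 0≤-by (0≤+ (0≤* a≤b 0≤d) (0≤* 0≤a c≤d)) (lem a b c d)
      where
      lem : ∀ a b c d → (b - a) * d + a * (d - c) ≡ b * d - a * c
      lem = solve-∀

    product-bound : ∀ {Y f₁ f₂ f₃ f₄ f₅} → 0ℤ ≤ Y → 0ℤ ≤ f₁ - Y → 0ℤ ≤ f₂ - Y → 0ℤ ≤ f₃ - Y → 0ℤ ≤ f₄ - Y → 0ℤ ≤ f₅ - Y * Y →
      0ℤ ≤ f₁ * f₂ * (f₃ * f₄) * f₅ - Y * Y * Y * Y * Y * Y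
    product-bound {Y} {f₁} {f₂} {f₃} {f₄} {f₅} 0≤Y h₁ h₂ h₃ h₄ h₅ = 0≤-by (0≤*-mono {Y * Y * (Y * Y)} {f₁ * f₂ * (f₃ * f₄)} {Y * Y} {f₅} (0≤* 0≤Y² 0≤Y²) (up {Y * Y} {f₅} 0≤Y² h₅) h₁₂₃₄ h₅) (lem Y (f₁ * f₂ * (f₃ * f₄) * f₅))
      where
      0≤Y² = 0≤* 0≤Y 0≤Y
      up : ∀ {a b} → 0ℤ ≤ a → 0ℤ ≤ b - a → 0ℤ ≤ b
      up 0≤a a≤b = ℤₚ.≤-trans 0≤a (0≤⇒≤ a≤b)
      0≤f₂ = up {Y} {f₂} 0≤Y h₂
      0≤f₃ = up {Y} {f₃} 0≤Y h₃
      0≤f₄ = up {Y} {f₄} 0≤Y h₄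
      h₁₂ : 0ℤ ≤ f₁ * f₂ - Y * Y
      h₁₂ = 0≤*-mono {Y} {f₁} {Y} {f₂} 0≤Y 0≤f₂ h₁ h₂
      h₃₄ : 0ℤ ≤ f₃ * f₄ - Y * Y
      h₃₄ = 0≤*-mono {Y} {f₃} {Y} {f₄} 0≤Y 0≤f₄ h₃ h₄
      h₁₂₃₄ : 0ℤ ≤ f₁ * f₂ * (f₃ * f₄) - Y * Y * (Y * Y)
      h₁₂₃₄ = 0≤*-mono {Y * Y} {f₁ * f₂} {Y * Y} {f₃ * f₄} 0≤Y² (0≤* 0≤f₃ 0≤f₄) h₁₂ h₃₄
      lem : ∀ Y p → p - Y * Y * (Y * Y) * (Y * Y) ≡ p - Y * Y * Y * Y * Y * Y
      lem = solve-∀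

    module _ {X Y : ℤ} (0<Y : 0ℤ < Y) (0≤X : 0ℤ ≤ X) (X≤Y : 0ℤ ≤ Y - X) where

      0≤Y′ : 0ℤ ≤ Y
      0≤Y′ = ℤₚ.<⇒≤ 0<Y

      second-factor : 0ℤ ≤ v * v * Y - u * u * X - Y
      second-factor = 0≤-by (0≤+ (0≤* (0≤+ (0≤+ (0≤* (0≤* (0≤+ⁿ 4) 0≤u) 0≤j) (0≤* (0≤* (0≤+ⁿ 4) 0≤j) 1≤j)) (0≤+ (0≤* (0≤+ⁿ 4) 1≤j) (0≤+ⁿ 3))) 0≤Y′) (0≤* (0≤* 0≤u 0≤u) X≤Y)) (lem H j X Y)
        where
        lem : ∀ H j X Y → (+ 4 * (H - j) * j + + 4 * j * (j - 1ℤ) + (+ 4 * (j - 1ℤ) + + 3)) * Y + (H - j) * (H - j) * (Y - X)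
          ≡ (H + j) * (H + j) * Y - (H - j) * (H - j) * X - Y
        lem = solve-∀

      fourth-factor : 0ℤ ≤ H * H * Y - j * j * X - Y
      fourth-factor = 0≤-by (0≤+ (0≤* (0≤+ (0≤* j<H 0≤v) (0≤+ 0≤H 1≤j)) 0≤Y′) (0≤* (0≤* 0≤j 0≤j) X≤Y)) (lem H j X Y)
        where
        lem : ∀ H j X Y → ((H - j - 1ℤ) * (H + j) + (H + (j - 1ℤ))) * Y + j * j * (Y - X) ≡ H * H * Y - j * j * X - Y
        lem = solve-∀

      -- Below (u / v)² all factors are positive. 640 = 20·16·2 collects the constants that bring
      -- each factor above Y, or above Y² for the quadratic one.
      form-small-ratio : 0ℤ ≤ + 20 * (u * u) * (u * u * Y - v * v * X) - Y → 0ℤ ≤ + 640 * (H * H) * form c₁ c₂ X Y - Y * Y * Y * Y * Y * Y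
      form-small-ratio h = 0≤-by
        (product-bound {f₁ = + 20 * (H * H) * (u * u * Y - v * v * X)} {f₃ = + 16 * (j * j * Y - H * H * X)} {f₅ = + 2 * (Y * Y - + 6 * (X * Y) + X * X)} 0≤Y′ first second-factor third fourth-factor fifth)
        (trans (lem (H * H) (u * u * Y - v * v * X) (v * v * Y - u * u * X) (j * j * Y - H * H * X) (H * H * Y - j * j * X) (Y * Y - + 6 * (X * Y) + X * X) (Y * Y * Y * Y * Y * Y))
          (cong (λ z → + 640 * (H * H) * z - Y * Y * Y * Y * Y * Y) (sym (form-factor X Y))))
        where
        a = u * u * Y - v * v * X
        0≤a : 0ℤ ≤ a
        0≤a = ℤₚ.<⇒≤ (0<-cancel {+ 20 * (u * u)} (0≤* (0≤+ⁿ 20) (0≤* 0≤u 0≤u)) (ℤₚ.<-≤-trans 0<Y (0≤⇒≤ h)))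
        first : 0ℤ ≤ + 20 * (H * H) * a - Y
        first = 0≤-by (0≤+ h (0≤* (0≤* (0≤+ⁿ 20) (0≤* 0≤j (0≤+ 0≤H 0≤u))) 0≤a)) (lem′ H j a Y)
          where
          lem′ : ∀ H j a Y → + 20 * ((H - j) * (H - j)) * a - Y + + 20 * (j * (H + (H - j))) * a ≡ + 20 * (H * H) * a - Y
          lem′ = solve-∀
        16X≤Y : 0ℤ ≤ Y - + 16 * X
        16X≤Y = 0≤-cancel (0<* 0<u 0<u) (0≤-by (0≤+ 0≤a (0≤* 16u²≤v² 0≤X)) (lem′ u v X Y))
          where
          lem′ : ∀ u v X Y → u * u * Y - v * v * X + (v * v - + 16 * (u * u)) * X ≡ u * u * (Y - + 16 * X)
          lem′ = solve-∀
        third : 0ℤ ≤ + 16 * (j * j * Y - H * H * X) - Y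
        third = 0≤-cancel {+ 9} (ℤ.+<+ (ℕ.s≤s ℕ.z≤n)) (0≤-by
          (0≤+ (0≤* (0≤+ (0≤* 3H≤5j (0≤+ (0≤* (0≤+ⁿ 5) 0≤j) (0≤* (0≤+ⁿ 3) 0≤H))) (0≤+ (0≤* (0≤+ⁿ 119) (0≤* 1≤j (0≤+ 0≤j (0≤+ⁿ 1)))) (0≤+ⁿ 110))) 0≤Y′) (0≤* (0≤* (0≤+ⁿ 9) (0≤* 0≤H 0≤H)) 16X≤Y)) (lem′ H j X Y))
          where
          lem′ : ∀ H j X Y → ((+ 5 * j - + 3 * H) * (+ 5 * j + + 3 * H) + (+ 119 * ((j - 1ℤ) * (j + 1ℤ)) + + 110)) * Y + + 9 * (H * H) * (Y - + 16 * X)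
            ≡ + 9 * (+ 16 * (j * j * Y - H * H * X) - Y)
          lem′ = solve-∀
        fifth : 0ℤ ≤ + 2 * (Y * Y - + 6 * (X * Y) + X * X) - Y * Y
        fifth = 0≤-by (0≤+ (0≤* 0≤Y′ 16X≤Y) (0≤+ (0≤* (0≤+ⁿ 4) (0≤* 0≤X 0≤Y′)) (0≤* (0≤+ⁿ 2) (0≤* 0≤X 0≤X)))) (lem′ X Y)
          where
          lem′ : ∀ X Y → Y * (Y - + 16 * X) + (+ 4 * (X * Y) + + 2 * (X * X)) ≡ + 2 * (Y * Y - + 6 * (X * Y) + X * X) - Y * Y
          lem′ = solve-∀
        lem : ∀ h a b c d e y → + 20 * h * a * b * (+ 16 * c * d) * (+ 2 * e) - y ≡ + 640 * h * (a * b * (c * d) * e) - y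
        lem = solve-∀

      -- Between 3 - 2√2 and t² exactly two factors are negative, the first and the quadratic one;
      -- both are negated before the bounds are multiplied.
      form-large-ratio : 0ℤ ≤ + 6 * (X * X) - Y * Y → 0ℤ ≤ + 20 * (j * j) * (j * j * Y - H * H * X) - Y → 0ℤ ≤ + 640 * (H * H) * form c₁ c₂ X Y - Y * Y * Y * Y * Y * Y
      form-large-ratio Y²≤6X² h = 0≤-by
        (product-bound {f₁ = + 16 * (v * v * X - u * u * Y)} {f₃ = + 20 * (H * H) * (j * j * Y - H * H * X)} {f₅ = + 2 * (+ 6 * (X * Y) - Y * Y - X * X)} 0≤Y′ first second-factor third fourth-factor fifth)
        (trans (lem (H * H) (u * u * Y) (v * v * X) (v * v * Y - u * u * X) (j * j * Y - H * H * X) (H * H * Y - j * j * X) X Y (Y * Y * Y * Y * Y * Y))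
          (cong (λ z → + 640 * (H * H) * z - Y * Y * Y * Y * Y * Y) (sym (form-factor X Y))))
        where
        c = j * j * Y - H * H * X
        0≤c : 0ℤ ≤ c
        0≤c = ℤₚ.<⇒≤ (0<-cancel {+ 20 * (j * j)} (0≤* (0≤+ⁿ 20) (0≤* 0≤j 0≤j)) (ℤₚ.<-≤-trans 0<Y (0≤⇒≤ h)))
        third : 0ℤ ≤ + 20 * (H * H) * c - Y
        third = 0≤-by (0≤+ h (0≤* (0≤* (0≤+ⁿ 20) (0≤* 0≤u 0≤v)) 0≤c)) (lem′ H j c Y)
          where
          lem′ : ∀ H j c Y → + 20 * (j * j) * c - Y + + 20 * ((H - j) * (H + j)) * c ≡ + 20 * (H * H) * c - Y
          lem′ = solve-∀
        Y≤3X : 0ℤ ≤ + 3 * X - Y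
        Y≤3X = 0≤-cancel {+ 3 * X + Y} (ℤₚ.+-mono-≤-< (0≤* (0≤+ⁿ 3) 0≤X) 0<Y) (0≤-by (0≤+ Y²≤6X² (0≤* (0≤+ⁿ 3) (0≤* 0≤X 0≤X))) (lem′ X Y))
          where
          lem′ : ∀ X Y → + 6 * (X * X) - Y * Y + + 3 * (X * X) ≡ (+ 3 * X + Y) * (+ 3 * X - Y)
          lem′ = solve-∀
        first : 0ℤ ≤ + 16 * (v * v * X - u * u * Y) - Y
        first = 0≤-by (0≤+ (0≤+ (0≤* (0≤+ⁿ 16) (0≤* 16u²≤v² 0≤X)) (0≤* (0≤* (0≤+ⁿ 16) (0≤* 0≤u 0≤u)) (0≤+ (0≤* (0≤+ⁿ 5) Y≤3X) 0≤X))) (0≤* (0≤+ (0≤* (0≤+ⁿ 64) (0≤* j<H (0≤+ 0≤u (0≤+ⁿ 1)))) (0≤+ⁿ 63)) 0≤Y′)) (lem′ H j X Y)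
          where
          lem′ : ∀ H j X Y → + 16 * (((H + j) * (H + j) - + 16 * ((H - j) * (H - j))) * X) + + 16 * ((H - j) * (H - j)) * (+ 5 * (+ 3 * X - Y) + X)
            + (+ 64 * ((H - j - 1ℤ) * (H - j + 1ℤ)) + + 63) * Y ≡ + 16 * ((H + j) * (H + j) * X - (H - j) * (H - j) * Y) - Y
          lem′ = solve-∀
        fifth : 0ℤ ≤ + 2 * (+ 6 * (X * Y) - Y * Y - X * X) - Y * Y
        fifth = 0≤-by (0≤+ (0≤* (0≤* (0≤+ⁿ 2) 0≤X) X≤Y) (0≤+ (0≤* (0≤* (0≤+ⁿ 3) 0≤Y′) Y≤3X) (0≤* 0≤X 0≤Y′))) (lem′ X Y)
          where
          lem′ : ∀ X Y → + 2 * X * (Y - X) + (+ 3 * Y * (+ 3 * X - Y) + X * Y) ≡ + 2 * (+ 6 * (X * Y) - Y * Y - X * X) - Y * Y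
          lem′ = solve-∀
        lem : ∀ h a a′ b c d X Y y → + 16 * (a′ - a) * b * (+ 20 * h * c * d) * (+ 2 * (+ 6 * (X * Y) - Y * Y - X * X)) - y
          ≡ + 640 * h * ((a - a′) * b * (c * d) * (Y * Y - + 6 * (X * Y) + X * X)) - y
        lem = solve-∀

-- A rational approximation to 5^(-1/4) from above

module Parameters where
  open import Data.Integer.Base using (_+_; _*_; -_; _-_; _≤_; _<_)
  open PowerSeries
  open Ratios

  fourth : ℤ → ℤ
  fourth a = a * a * a * a

  0≤-or-absurd : ∀ {t} → (0ℤ ≤ -1ℤ - t → 0ℤ ≤ -1ℤ) → 0ℤ ≤ t
  0≤-or-absurd {t} f with 0ℤ ℤₚ.≤? t
  ... | yes 0≤t = 0≤t
  ... | no ¬0≤t with f (0≤-by (≤⇒0≤ (ℤₚ.i<j⇒suc[i]≤j (ℤₚ.≰⇒> ¬0≤t))) (lem t))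
    where
    lem : ∀ t → 0ℤ - (1ℤ + t) ≡ -1ℤ - t
    lem = solve-∀
  ...   | ()

  fourth-mono : ∀ {a b} → 0ℤ ≤ a → 0ℤ ≤ b - a → 0ℤ ≤ fourth b - fourth a
  fourth-mono {a} {b} 0≤a a≤b = 0≤-by (0≤* a≤b (0≤* (0≤+ 0≤b 0≤a) (0≤+ (0≤* 0≤b 0≤b) (0≤* 0≤a 0≤a)))) (lem a b)
    where
    0≤b : 0ℤ ≤ b
    0≤b = ℤₚ.≤-trans 0≤a (0≤⇒≤ a≤b)
    lem : ∀ a b → (b - a) * ((b + a) * (b * b + a * a)) ≡ b * b * b * b - a * a * a * a
    lem = solve-∀

  fourth-root : ∀ A → ∃ λ i → 0ℤ ≤ + A - + 5 * fourth (+ i) × 0ℤ ≤ + 5 * fourth (+ suc i) - + A - 1ℤ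
  fourth-root zero    = 0 , 0≤+ⁿ 0 , 0≤+ⁿ 4
  fourth-root (suc A) with fourth-root A
  ... | i , low , high with 0ℤ ℤₚ.≤? + 5 * fourth (+ suc i) - + suc A - 1ℤ
  ...   | yes high′ = i , 0≤-by (0≤+ low (0≤+ⁿ 1)) (lem (+ A) (+ 5 * fourth (+ i))) , high′
    where
    lem : ∀ A f → A - f + 1ℤ ≡ 1ℤ + A - f
    lem = solve-∀
  ...   | no ¬high′ = suc i , 0≤-by low′ (lem₁ (+ A) (+ 5 * fourth (+ suc i)))
        , 0≤-by (0≤+ high (0≤+ (0≤+ (0≤* (0≤+ⁿ 20) (0≤* (0≤* 0≤k 0≤k) 0≤k)) (0≤* (0≤+ⁿ 30) (0≤* 0≤k 0≤k))) (0≤+ (0≤* (0≤+ⁿ 20) 0≤k) (0≤+ⁿ 4)))) (lem₂ (+ suc i) (+ A))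
    where
    0≤k = 0≤+ⁿ (suc i)
    low′ : 0ℤ ≤ 0ℤ - (1ℤ + (+ 5 * fourth (+ suc i) - + suc A - 1ℤ))
    low′ = ≤⇒0≤ (ℤₚ.i<j⇒suc[i]≤j (ℤₚ.≰⇒> ¬high′))
    lem₁ : ∀ A f → 0ℤ - (1ℤ + (f - (1ℤ + A) - 1ℤ)) ≡ 1ℤ + A - f
    lem₁ = solve-∀
    lem₂ : ∀ k A → + 5 * (k * k * k * k) - A - 1ℤ + (+ 20 * (k * k * k) + + 30 * (k * k) + (+ 20 * k + + 4))
      ≡ + 5 * ((1ℤ + k) * (1ℤ + k) * (1ℤ + k) * (1ℤ + k)) - (1ℤ + A) - 1ℤ
    lem₂ = solve-∀

  nonneg-nat : ∀ {z} → 0ℤ ≤ z → ∃ λ n → + n ≡ z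
  nonneg-nat {z} 0≤z = ℤ.∣ z ∣ , ℤₚ.0≤i⇒+∣i∣≡i 0≤z

  -- j / H is a rational slightly above 5 ^ (-1/4), and ε / H = e / b.
  record Approximation (b e : ℤ) : Set where
    field
      H j L : ℤ
    ε : ℤ
    ε = e * L
    field
      H≡   : H ≡ b * L
      0≤L  : 0ℤ ≤ L
      1≤j  : 0ℤ ≤ j - 1ℤ
      j<H  : 0ℤ ≤ H - j - 1ℤ
      3H≤5j : 0ℤ ≤ + 5 * j - + 3 * H
      above : 0ℤ ≤ + 5 * fourth j - fourth H - 1ℤ
      close : 0ℤ ≤ + 4 * (fourth H - + 5 * fourth j) + + 24 * (j - ε) * (j * (H * H + j * j)) - 1ℤ

  -- Here j is the least integer with 5 j⁴ > H⁴. Rounding costs a term of order H³, and so does one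
  -- unit of j - ε in `close`, so a fixed distance between j and ε suffices; L enlarges the fraction
  -- e / b until that distance is at least 4.
  approximation : ∀ b e → 0ℤ ≤ + b - 1ℤ → 0ℤ ≤ fourth (+ b) - + 5 * fourth (+ e) - 1ℤ → Approximation (+ b) (+ e)
  approximation bₙ eₙ 1≤b below = record
    { H = H ; j = j ; L = L ; H≡ = refl ; 0≤L = 0≤L ; 1≤j = 1≤j ; j<H = j<H ; 3H≤5j = 3H≤5j ; above = above ; close = close }
    where
    b = + bₙ
    e = + eₙ
    0≤e = 0≤+ⁿ eₙ
    0≤e² = 0≤* 0≤e 0≤e
    0≤e³ = 0≤* 0≤e² 0≤e
    -- The coefficients of the lower terms of (eL + 3)⁴. With L = 5S these terms contribute at most
    -- L⁴ to 5 (ε + 3)⁴, and 5e⁴ + 1 ≤ b⁴ then gives 5 (ε + 3)⁴ ≤ H⁴, so j ≥ ε + 4.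
    S = + 12 * (e * e * e) + + 54 * (e * e) + + 108 * e + + 81
    L = + 5 * S
    0≤S₀ : 0ℤ ≤ + 12 * (e * e * e) + + 54 * (e * e) + + 108 * e
    0≤S₀ = 0≤+ (0≤+ (0≤* (0≤+ⁿ 12) 0≤e³) (0≤* (0≤+ⁿ 54) 0≤e²)) (0≤* (0≤+ⁿ 108) 0≤e)
    5≤L : 0ℤ ≤ L - + 5
    5≤L = 0≤-by (0≤+ (0≤* (0≤+ⁿ 5) 0≤S₀) (0≤+ⁿ 400)) (lem (+ 12 * (e * e * e) + + 54 * (e * e) + + 108 * e))
      where
      lem : ∀ s → + 5 * s + + 400 ≡ + 5 * (s + + 81) - + 5
      lem = solve-∀
    0≤L : 0ℤ ≤ L
    0≤L = 0≤* (0≤+ⁿ 5) (0≤+ 0≤S₀ (0≤+ⁿ 81))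
    H = b * L
    4≤H : 0ℤ ≤ H - + 4
    4≤H = 0≤-by (0≤+ (0≤* 1≤b 0≤L) (0≤+ 5≤L (0≤+ⁿ 1))) (lem b L)
      where
      lem : ∀ b L → (b - 1ℤ) * L + (L - + 5 + 1ℤ) ≡ b * L - + 4
      lem = solve-∀
    0≤H : 0ℤ ≤ H
    0≤H = 0≤* (0≤+ⁿ bₙ) 0≤L
    natural = nonneg-nat {fourth H} (0≤* (0≤* (0≤* 0≤H 0≤H) 0≤H) 0≤H)
    root = fourth-root (proj₁ natural)
    i = + proj₁ root
    j = 1ℤ + i
    0≤i = 0≤+ⁿ (proj₁ root)
    0≤j : 0ℤ ≤ j
    0≤j = 0≤+ⁿ (suc (proj₁ root))
    low : 0ℤ ≤ fourth H - + 5 * fourth i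
    low = subst (λ z → 0ℤ ≤ z - + 5 * fourth i) (proj₂ natural) (proj₁ (proj₂ root))
    above : 0ℤ ≤ + 5 * fourth j - fourth H - 1ℤ
    above = subst (λ z → 0ℤ ≤ + 5 * fourth j - z - 1ℤ) (proj₂ natural) (proj₂ (proj₂ root))
    1≤j : 0ℤ ≤ j - 1ℤ
    1≤j = 0≤-by 0≤i (lem i)
      where
      lem : ∀ i → i ≡ 1ℤ + i - 1ℤ
      lem = solve-∀
    j<H : 0ℤ ≤ H - j - 1ℤ
    -- Otherwise i ≥ H - 1 and 5 (H - 1)⁴ ≤ H⁴, which fails for H ≥ 4; the remainder is expanded in
    -- powers of H - 4.
    j<H = 0≤-or-absurd λ h → 0≤-by
      (0≤+ (0≤+ low (0≤* (0≤+ⁿ 5) (fourth-mono {H - 1ℤ} {i} 0≤H-1 (0≤-by h (lem₁ H i)))))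
        (0≤+ (0≤+ (0≤* (0≤+ⁿ 4) (0≤* (0≤* (0≤* 4≤H 4≤H) 4≤H) 4≤H)) (0≤* (0≤+ⁿ 44) (0≤* (0≤* 4≤H 4≤H) 4≤H)))
          (0≤+ (0≤+ (0≤* (0≤+ⁿ 174) (0≤* 4≤H 4≤H)) (0≤* (0≤+ⁿ 284) 4≤H)) (0≤+ⁿ 148)))) (lem₂ H (fourth i))
      where
      0≤H-1 : 0ℤ ≤ H - 1ℤ
      0≤H-1 = 0≤-by (0≤+ 4≤H (0≤+ⁿ 3)) (lem H)
        where
        lem : ∀ H → H - + 4 + + 3 ≡ H - 1ℤ
        lem = solve-∀
      lem₁ : ∀ H i → -1ℤ - (H - (1ℤ + i) - 1ℤ) ≡ i - (H - 1ℤ)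
      lem₁ = solve-∀
      lem₂ : ∀ H f → H * H * H * H - + 5 * f + + 5 * (f - (H - 1ℤ) * (H - 1ℤ) * (H - 1ℤ) * (H - 1ℤ))
        + (+ 4 * ((H - + 4) * (H - + 4) * (H - + 4) * (H - + 4)) + + 44 * ((H - + 4) * (H - + 4) * (H - + 4))
          + (+ 174 * ((H - + 4) * (H - + 4)) + + 284 * (H - + 4) + + 148)) ≡ -1ℤ
      lem₂ = solve-∀
    3H≤5j : 0ℤ ≤ + 5 * j - + 3 * H
    3H≤5j = 0≤-or-absurd λ h → 0≤-by
      (0≤+ (0≤+ (fourth-mono {+ 5 * j} {+ 3 * H} (0≤* (0≤+ⁿ 5) 0≤j) (0≤-by (0≤+ h (0≤+ⁿ 1)) (lem₁ H j))) (0≤* (0≤+ⁿ 81) above))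
        (0≤+ (0≤* (0≤+ⁿ 220) (0≤* (0≤* (0≤* 0≤j 0≤j) 0≤j) 0≤j)) (0≤+ⁿ 80))) (lem₂ H j)
      where
      lem₁ : ∀ H j → -1ℤ - (+ 5 * j - + 3 * H) + 1ℤ ≡ + 3 * H - + 5 * j
      lem₁ = solve-∀
      lem₂ : ∀ H j → + 3 * H * (+ 3 * H) * (+ 3 * H) * (+ 3 * H) - + 5 * j * (+ 5 * j) * (+ 5 * j) * (+ 5 * j) + + 81 * (+ 5 * (j * j * j * j) - H * H * H * H - 1ℤ)
        + (+ 220 * (j * j * j * j) + + 80) ≡ -1ℤ
      lem₂ = solve-∀
    ε = e * L
    0≤ε = 0≤* 0≤e 0≤L
    ε+4≤j : 0ℤ ≤ j - ε - + 4
    ε+4≤j = 0≤-or-absurd λ h → 0≤-by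
      (0≤+ (0≤+ above (0≤* (0≤+ⁿ 5) (fourth-mono {j} {ε + + 3} 0≤j (0≤-by h (lem₁ j ε)))))
        (0≤+ (0≤* (0≤* (0≤* (0≤* 0≤L 0≤L) 0≤L) 0≤L) below)
          (0≤+ (0≤* (0≤* (0≤+ⁿ 5) (0≤* 0≤L 0≤L)) (0≤+ (0≤* (0≤* (0≤+ⁿ 54) 0≤e²) 0≤L-1) (0≤+ (0≤* (0≤* (0≤+ⁿ 108) 0≤e) (0≤* 0≤L-1 (0≤+ⁿ 1))) (0≤* (0≤+ⁿ 81) (0≤* 0≤L-1 (0≤+ⁿ 1))))))
            (0≤+ (0≤* (0≤* (0≤+ⁿ 540) 0≤e) (0≤* 0≤L 0≤L-1)) (0≤* (0≤+ⁿ 405) (0≤* 0≤L-1 (0≤+ 0≤L (0≤+ⁿ 1)))))))) (lem₂ b e L j refl)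
      where
      0≤L-1 : 0ℤ ≤ L - 1ℤ
      0≤L-1 = 0≤-by (0≤+ 5≤L (0≤+ⁿ 4)) (lem L)
        where
        lem : ∀ L → L - + 5 + + 4 ≡ L - 1ℤ
        lem = solve-∀
      lem₁ : ∀ j ε → -1ℤ - (j - ε - + 4) ≡ ε + + 3 - j
      lem₁ = solve-∀
      lem₂ : ∀ b e L j → L ≡ + 5 * (+ 12 * (e * e * e) + + 54 * (e * e) + + 108 * e + + 81) →
        + 5 * (j * j * j * j) - b * L * (b * L) * (b * L) * (b * L) - 1ℤ + + 5 * ((e * L + + 3) * (e * L + + 3) * (e * L + + 3) * (e * L + + 3) - j * j * j * j)
        + (L * L * L * L * (b * b * b * b - + 5 * (e * e * e * e) - 1ℤ)
          + (+ 5 * (L * L) * (+ 54 * (e * e) * (L - 1ℤ) + (+ 108 * e * ((L - 1ℤ) * 1ℤ) + + 81 * ((L - 1ℤ) * 1ℤ)))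
            + (+ 540 * e * (L * (L - 1ℤ)) + + 405 * ((L - 1ℤ) * (L + 1ℤ))))) ≡ -1ℤ
      lem₂ b e L j L≡ = trans (lem₃ b e L j) (trans (cong (λ z → L * L * L * (z - L) - 1ℤ) (sym L≡)) (lem₄ L))
        where
        lem₃ : ∀ b e L j →
          + 5 * (j * j * j * j) - b * L * (b * L) * (b * L) * (b * L) - 1ℤ + + 5 * ((e * L + + 3) * (e * L + + 3) * (e * L + + 3) * (e * L + + 3) - j * j * j * j)
          + (L * L * L * L * (b * b * b * b - + 5 * (e * e * e * e) - 1ℤ)
            + (+ 5 * (L * L) * (+ 54 * (e * e) * (L - 1ℤ) + (+ 108 * e * ((L - 1ℤ) * 1ℤ) + + 81 * ((L - 1ℤ) * 1ℤ)))
              + (+ 540 * e * (L * (L - 1ℤ)) + + 405 * ((L - 1ℤ) * (L + 1ℤ)))))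
          ≡ L * L * L * (+ 5 * (+ 12 * (e * e * e) + + 54 * (e * e) + + 108 * e + + 81) - L) - 1ℤ
        lem₃ = solve-∀
        lem₄ : ∀ L → L * L * L * (L - L) - 1ℤ ≡ -1ℤ
        lem₄ = solve-∀
    close : 0ℤ ≤ + 4 * (fourth H - + 5 * fourth j) + + 24 * (j - ε) * (j * (H * H + j * j)) - 1ℤ
    -- Passing from i to j = i + 1 costs 20 (j⁴ - i⁴) ≤ 80 j³, while j - ε ≥ 4 yields 96 j (H² +
    -- j²).
    close = 0≤-by
      (0≤+ (0≤+ (0≤* (0≤+ⁿ 4) low) (0≤* (0≤* (0≤+ⁿ 24) ε+4≤j) (0≤* 0≤j (0≤+ (0≤* 0≤H 0≤H) (0≤* 0≤j 0≤j)))))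
        (0≤+ (0≤* (0≤* (0≤+ⁿ 96) 0≤j) (0≤* (0≤+ j<H (0≤+ⁿ 1)) (0≤+ 0≤H 0≤j)))
          (0≤+ (0≤+ (0≤* (0≤+ⁿ 112) (0≤* (0≤* 0≤i 0≤i) 0≤i)) (0≤* (0≤+ⁿ 456) (0≤* 0≤i 0≤i))) (0≤+ (0≤* (0≤+ⁿ 496) 0≤i) (0≤+ⁿ 171))))) (lem H i ε)
      where
      lem : ∀ H i ε →
        + 4 * (H * H * H * H - + 5 * (i * i * i * i)) + + 24 * (1ℤ + i - ε - + 4) * ((1ℤ + i) * (H * H + (1ℤ + i) * (1ℤ + i)))
        + (+ 96 * (1ℤ + i) * ((H - (1ℤ + i) - 1ℤ + 1ℤ) * (H + (1ℤ + i))) + (+ 112 * (i * i * i) + + 456 * (i * i) + (+ 496 * i + + 171)))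
        ≡ + 4 * (H * H * H * H - + 5 * ((1ℤ + i) * (1ℤ + i) * (1ℤ + i) * (1ℤ + i))) + + 24 * (1ℤ + i - ε) * ((1ℤ + i) * (H * H + (1ℤ + i) * (1ℤ + i))) - 1ℤ
      lem = solve-∀

-- Choice of the parameters and conclusion

module Bound where
  open import Data.Integer.Base using (_+_; _*_; -_; _-_; _≤_; _<_)
  open PowerSeries
  open Words
  open Ratios
  open Parameters

  module Positivity {b e : ℤ} (0≤e : 0ℤ ≤ e) (A : Approximation b e) where
    open Approximation A
    open Factor H j 1≤j j<H 3H≤5j

    0≤fourth : ∀ {a} → 0ℤ ≤ a → 0ℤ ≤ a * a * (a * a)
    0≤fourth 0≤a = 0≤* (0≤* 0≤a 0≤a) (0≤* 0≤a 0≤a)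

    v⁴ H⁴ W : ℤ
    v⁴ = v * v * (v * v)
    H⁴ = H * H * (H * H)
    W = + 640 * (H * H)

    0≤W : 0ℤ ≤ W
    0≤W = 0≤* (0≤+ⁿ 640) (0≤* 0≤H 0≤H)

    0≤v⁴ : 0ℤ ≤ v⁴
    0≤v⁴ = 0≤fourth 0≤v

    0≤H⁴ : 0ℤ ≤ H⁴
    0≤H⁴ = 0≤fourth 0≤H

    -- 346 c₁ W is the demand of `combination-pos`, 20 v⁴ and 20 H⁴ those of `ratio-upper` for β =
    -- v² and β = H², and 61 covers the 60 of `ratio-lower` with one to spare for strictness.
    threshold : ℤ
    threshold = + 346 * c₁ * W + + 20 * v⁴ + + 20 * H⁴ + + 61

    0≤346 : 0ℤ ≤ + 346 * c₁ * W
    0≤346 = 0≤* (0≤* (0≤+ⁿ 346) 0≤c₁) 0≤W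

    0≤threshold : 0ℤ ≤ threshold
    0≤threshold = 0≤+ (0≤+ (0≤+ 0≤346 (0≤* (0≤+ⁿ 20) 0≤v⁴)) (0≤* (0≤+ⁿ 20) 0≤H⁴)) (0≤+ⁿ 61)

    module _ {K G : ℤ} {f : ℕ → ℤ} (S : Sequence K G f) (m : ℕ) (G≡ : G ≡ + 4 * + m + + 6 - K)
             (K-large : 0ℤ ≤ K - threshold) (m-large : 0ℤ ≤ + m - (+ 4 * (K * v⁴) + + 4 * (K * H⁴) + + 12 * K)) where

      K≥60 : 0ℤ ≤ K - + 60
      K≥60 = 0≤-by (0≤+ K-large (0≤+ (0≤+ 0≤346 (0≤* (0≤+ⁿ 20) 0≤v⁴)) (0≤+ (0≤* (0≤+ⁿ 20) 0≤H⁴) (0≤+ⁿ 1)))) (lem K (+ 346 * c₁ * W) v⁴ H⁴)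
        where
        lem : ∀ K a b c → K - (a + + 20 * b + + 20 * c + + 61) + (a + + 20 * b + (+ 20 * c + 1ℤ)) ≡ K - + 60
        lem = solve-∀

      K≥20v⁴ : 0ℤ ≤ K - + 20 * v⁴
      K≥20v⁴ = 0≤-by (0≤+ K-large (0≤+ 0≤346 (0≤+ (0≤* (0≤+ⁿ 20) 0≤H⁴) (0≤+ⁿ 61)))) (lem K (+ 346 * c₁ * W) v⁴ H⁴)
        where
        lem : ∀ K a b c → K - (a + + 20 * b + + 20 * c + + 61) + (a + (+ 20 * c + + 61)) ≡ K - + 20 * b
        lem = solve-∀

      K≥20H⁴ : 0ℤ ≤ K - + 20 * H⁴
      K≥20H⁴ = 0≤-by (0≤+ K-large (0≤+ 0≤346 (0≤+ (0≤* (0≤+ⁿ 20) 0≤v⁴) (0≤+ⁿ 61)))) (lem K (+ 346 * c₁ * W) v⁴ H⁴)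
        where
        lem : ∀ K a b c → K - (a + + 20 * b + + 20 * c + + 61) + (a + (+ 20 * b + + 61)) ≡ K - + 20 * c
        lem = solve-∀

      K>346 : 0ℤ < K - + 346 * c₁ * W
      K>346 = ℤₚ.suc[i]≤j⇒i<j (0≤⇒≤ (0≤-by (0≤+ K-large (0≤+ (0≤* (0≤+ⁿ 20) 0≤v⁴) (0≤+ (0≤* (0≤+ⁿ 20) 0≤H⁴) (0≤+ⁿ 60)))) (lem K (+ 346 * c₁ * W) v⁴ H⁴)))
        where
        lem : ∀ K a b c → K - (a + + 20 * b + + 20 * c + + 61) + (+ 20 * b + (+ 20 * c + + 60)) ≡ K - a - 1ℤ
        lem = solve-∀

      0≤Kv⁴ = 0≤* (0≤K S) 0≤v⁴
      0≤KH⁴ = 0≤* (0≤K S) 0≤H⁴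

      m≥4Kv⁴ : 0ℤ ≤ + m - + 4 * (K * v⁴)
      m≥4Kv⁴ = 0≤-by (0≤+ m-large (0≤+ (0≤* (0≤+ⁿ 4) 0≤KH⁴) (0≤* (0≤+ⁿ 12) (0≤K S)))) (lem (+ m) (K * v⁴) (K * H⁴) K)
        where
        lem : ∀ m a b K → m - (+ 4 * a + + 4 * b + + 12 * K) + (+ 4 * b + + 12 * K) ≡ m - + 4 * a
        lem = solve-∀

      m≥4KH⁴ : 0ℤ ≤ + m - + 4 * (K * H⁴)
      m≥4KH⁴ = 0≤-by (0≤+ m-large (0≤+ (0≤* (0≤+ⁿ 4) 0≤Kv⁴) (0≤* (0≤+ⁿ 12) (0≤K S)))) (lem (+ m) (K * v⁴) (K * H⁴) K)
        where
        lem : ∀ m a b K → m - (+ 4 * a + + 4 * b + + 12 * K) + (+ 4 * a + + 12 * K) ≡ m - + 4 * b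
        lem = solve-∀

      m≥12K : 0ℤ ≤ + m - + 12 * K
      m≥12K = 0≤-by (0≤+ m-large (0≤+ (0≤* (0≤+ⁿ 4) 0≤Kv⁴) (0≤* (0≤+ⁿ 4) 0≤KH⁴))) (lem (+ m) (K * v⁴) (K * H⁴) K)
        where
        lem : ∀ m a b K → m - (+ 4 * a + + 4 * b + + 12 * K) + (+ 4 * a + + 4 * b) ≡ m - + 12 * K
        lem = solve-∀

      M≡ : ∀ s → G + + s - + 2 ≡ + 4 * + m + + 4 - K + + s
      M≡ s = trans (cong (λ z → z + + s - + 2) G≡) (lem (+ m) K (+ s))
        where
        lem : ∀ m K s → + 4 * m + + 6 - K + s - + 2 ≡ + 4 * m + + 4 - K + s
        lem = solve-∀

      0<M : ∀ s → 0ℤ < G + + s - + 2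
      0<M s = ℤₚ.suc[i]≤j⇒i<j (0≤⇒≤ (0≤-by (0≤+ (0≤+ m≥12K (0≤* (0≤+ⁿ 3) (0≤+ⁿ m))) (0≤+ (0≤* (0≤+ⁿ 11) (0≤K S)) (0≤+ (0≤+ⁿ 3) (0≤+ⁿ s)))) (trans (lem (+ m) K (+ s)) (cong (_- 1ℤ) (sym (M≡ s))))))
        where
        lem : ∀ m K s → m - + 12 * K + + 3 * m + (+ 11 * K + (+ 3 + s)) ≡ + 4 * m + + 4 - K + s - 1ℤ
        lem = solve-∀

      positive-by : ∀ s → 0ℤ ≤ W * form c₁ c₂ (back 1 f s) (f s) - f s * f s * f s * f s * f s * f s → 0ℤ < At.combination S s c₁ c₂
      positive-by s = At.combination-pos S s 0≤c₁ 0≤c₂ c₂≤c₁ 0≤W K>346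

      -- At s = m + 1 the number M is 5 (m + 1) - K, so r² is close to 1/5, and 5 j⁴ > H⁴ keeps r
      -- below t².
      positive-at-top : 0ℤ < At.combination S (suc m) c₁ c₂
      positive-at-top = positive-by (suc m) (form-large-ratio (At.0<Y S (suc m)) (At.0≤X₁ S (suc m)) (At.X₁≤Y S (suc m))
        (At.ratio-lower S (suc m) (ℤ.+<+ (ℕ.s≤s ℕ.z≤n)) (0<M (suc m)) M≤5s (0≤-by (0≤+ m≥12K (0≤+ⁿ 1)) (lem₁ (+ m) (+ 12 * K))) K≥60)
        (At.ratio-upper S (suc m) (j * j) (H * H) (+ suc m) (0<* 0<j 0<j) (0≤* 0≤H 0≤H) (0≤+ⁿ (suc m)) (0<M (suc m)) M≤5s gap
          (0≤-by (0≤+ m≥4KH⁴ (0≤+ⁿ 1)) (lem₁ (+ m) (+ 4 * (K * H⁴)))) K≥20H⁴))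
        where
        lem₁ : ∀ m a → m - a + 1ℤ ≡ 1ℤ + m - a
        lem₁ = solve-∀
        M≤5s : 0ℤ ≤ + 5 * + suc m - (G + + suc m - + 2)
        M≤5s = 0≤-by (0≤K S) (trans (lem (+ m) K) (cong (λ z → + 5 * + suc m - z) (sym (M≡ (suc m)))))
          where
          lem : ∀ m K → K ≡ + 5 * (1ℤ + m) - (+ 4 * m + + 4 - K + (1ℤ + m))
          lem = solve-∀
        gap : 0ℤ ≤ j * j * (j * j) * (G + + suc m - + 2) - H * H * (H * H) * + suc m - (+ suc m - K * (H * H * (H * H)))
        gap = 0≤-by (0≤+ (0≤* (0≤+ⁿ (suc m)) above) (0≤* (0≤K S) (fourth-mono {j} {H} 0≤j 0≤u)))
          (trans (lem (+ m) K j H) (cong (λ z → j * j * (j * j) * z - H * H * (H * H) * + suc m - (+ suc m - K * (H * H * (H * H)))) (sym (M≡ (suc m)))))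
          where
          lem : ∀ m K j H → (1ℤ + m) * (+ 5 * (j * j * j * j) - H * H * H * H - 1ℤ) + K * (H * H * H * H - j * j * j * j)
            ≡ j * j * (j * j) * (+ 4 * m + + 4 - K + (1ℤ + m)) - H * H * (H * H) * (1ℤ + m) - (1ℤ + m - K * (H * H * (H * H)))
          lem = solve-∀

      -- Since 6m + 2 - K will be N, the last hypothesis is k ≥ (1 - e/b) N / 2, the range of k
      -- allowed by the minimum distance. It serves to keep r below (u / v)².
      positive-below : ∀ k s → k ℕ.+ s ≡ suc m → 0ℤ ≤ + 2 * + k * H - (H - ε) * (+ 6 * + m + + 2 - K) → 0ℤ < At.combination S s c₁ c₂
      positive-below k s k+s≡ far = positive-by s (form-small-ratio (At.0<Y S s) (At.0≤X₁ S s) (At.X₁≤Y S s)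
        (At.ratio-upper S s (u * u) (v * v) (+ m) (0<* 0<u 0<u) (0≤* 0≤v 0≤v) (0≤+ⁿ m) (0<M s) M≤5m gap m≥4Kv⁴ K≥20v⁴))
        where
        s≡ : + s ≡ 1ℤ + + m - + k
        s≡ = trans (lem (+ k) (+ s)) (cong (_- + k) (cong +_ k+s≡))
          where
          lem : ∀ k s → s ≡ k + s - k
          lem = solve-∀
        M≤5m : 0ℤ ≤ + 5 * + m - (G + + s - + 2)
        M≤5m = 0≤-by (0≤+ K≥60 (0≤+ (0≤+ⁿ k) (0≤+ⁿ 55))) (trans (lem (+ m) K (+ k)) (cong (λ z → + 5 * + m - z) (sym (trans (M≡ s) (cong (λ z → + 4 * + m + + 4 - K + z) s≡)))))
          where
          lem : ∀ m K k → K - + 60 + (k + + 55) ≡ + 5 * m - (+ 4 * m + + 4 - K + (1ℤ + m - k))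
          lem = solve-∀
        U = u * u * (u * u)
        D = + 8 * (H * j) * (H * H + j * j)
        0≤D : 0ℤ ≤ D
        0≤D = 0≤* (0≤* (0≤+ⁿ 8) (0≤* 0≤H 0≤j)) (0≤+ (0≤* 0≤H 0≤H) (0≤* 0≤j 0≤j))
        0≤ε : 0ℤ ≤ ε
        0≤ε = 0≤* 0≤e 0≤L
        2≤K : 0ℤ ≤ K - + 2
        2≤K = 0≤-by (0≤+ K≥60 (0≤+ⁿ 58)) (lem K)
          where
          lem : ∀ K → K - + 60 + + 58 ≡ K - + 2
          lem = solve-∀
        0<H : 0ℤ < H
        0<H = ℤₚ.<-≤-trans 0<j (0≤⇒≤ 0≤u)
        -- To leading order u⁴ (5m - k) ≥ v⁴ (m - k) is needed for k = 3m (1 - ε/H), that is 4 H u⁴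
        -- ≥ (v⁴ - u⁴) (3ε - 2H). For ε = j the two sides differ by 4 H (H⁴ - 5 j⁴), the origin of
        -- the fourth root of 5; `close` is this inequality divided by H, with a margin of 1 that
        -- supplies the summand m.
        gap : 0ℤ ≤ u * u * (u * u) * (G + + s - + 2) - v * v * (v * v) * + s - (+ m - K * (v * v * (v * v)))
        gap = 0≤-cancel {+ 2 * H} (0<* {+ 2} (ℤ.+<+ (ℕ.s≤s ℕ.z≤n)) 0<H) (0≤-by
          (0≤+ (0≤+ (0≤* 0≤D far) (0≤* (0≤* (0≤+ⁿ 2) (0≤+ⁿ m)) (0≤* 0≤H close)))
            (0≤+ (0≤* (0≤* (0≤+ⁿ 8) 0≤H) (0≤fourth 0≤u)) (0≤+ (0≤* (0≤* (0≤K S) 0≤H) 0≤D) (0≤* (0≤* 0≤D 0≤ε) 2≤K))))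
          (trans (cong (λ z → D * (+ 2 * + k * H - (H - ε) * (+ 6 * + m + + 2 - K)) + + 2 * + m * z + (+ 8 * H * U + (K * H * D + D * ε * (K - + 2)))) (lem₁ H j ε))
            (trans (lem₂ U D H ε (+ m) K (+ k))
              (trans (cong₂ (λ y z → + 2 * H * (U * y - (U + D) * z - (+ m - K * (U + D)))) (sym (trans (M≡ s) (cong (λ z → + 4 * + m + + 4 - K + z) s≡))) (sym s≡))
                (cong (λ z → + 2 * H * (U * (G + + s - + 2) - z * + s - (+ m - K * z))) (lem₃ H j))))))
          where
          lem₁ : ∀ H j ε → H * (+ 4 * (H * H * H * H - + 5 * (j * j * j * j)) + + 24 * (j - ε) * (j * (H * H + j * j)) - 1ℤ)
            ≡ + 4 * H * ((H - j) * (H - j) * ((H - j) * (H - j))) - + 8 * (H * j) * (H * H + j * j) * (+ 3 * ε - + 2 * H) - H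
          lem₁ = solve-∀
          lem₂ : ∀ U D H ε m K k →
            D * (+ 2 * k * H - (H - ε) * (+ 6 * m + + 2 - K)) + + 2 * m * (+ 4 * H * U - D * (+ 3 * ε - + 2 * H) - H) + (+ 8 * H * U + (K * H * D + D * ε * (K - + 2)))
            ≡ + 2 * H * (U * (+ 4 * m + + 4 - K + (1ℤ + m - k)) - (U + D) * (1ℤ + m - k) - (m - K * (U + D)))
          lem₂ = solve-∀
          lem₃ : ∀ H j → (H - j) * (H - j) * ((H - j) * (H - j)) + + 8 * (H * j) * (H * H + j * j) ≡ (H + j) * (H + j) * ((H + j) * (H + j))
          lem₃ = solve-∀

  back-cases : ∀ k (g : Series) M → back k g M ≡ 0ℤ ⊎ ∃ λ s → k ℕ.+ s ≡ M × back k g M ≡ g s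
  back-cases zero    g M       = inj₂ (M , refl , refl)
  back-cases (suc k) g zero    = inj₁ refl
  back-cases (suc k) g (suc M) with back-cases k g M
  ... | inj₁ eq            = inj₁ eq
  ... | inj₂ (s , eq , eq′) = inj₂ (s , cong suc eq , eq′)

  pos-fourth : ∀ b → + (b ℕ.^ 4) ≡ fourth (+ b)
  pos-fourth b = trans (trans (ℤₚ.pos-* b (b ℕ.^ 3)) (cong (+ b *_) (trans (ℤₚ.pos-* b (b ℕ.^ 2)) (cong (+ b *_) (trans (ℤₚ.pos-* b (b ℕ.^ 1)) (cong (+ b *_) (ℤₚ.pos-* b 1))))))) (lem (+ b))
    where
    lem : ∀ b → b * (b * (b * (b * 1ℤ))) ≡ b * b * b * b
    lem = solve-∀

  -- Truncated subtraction merges the two alternatives: in the first one the left side is 0.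
  AboveBound⇒ : ∀ {a b} → 0 ℕ.< b → AboveBound a b → 5 ℕ.* (b ℕ.∸ 2 ℕ.* a) ℕ.^ 4 ℕ.< b ℕ.^ 4
  AboveBound⇒ {a} {b} 0<b (inj₁ b≤2a) rewrite ℕₚ.m≤n⇒m∸n≡0 b≤2a = ℕₚ.^-monoˡ-< 4 0<b
  AboveBound⇒ 0<b (inj₂ h) = h

  module _ (a b e : ℕ) (e≡ : e ≡ b ℕ.∸ 2 ℕ.* a) (approx : Approximation (+ b) (+ e)) where

    open Approximation approx
    open Factor H j 1≤j j<H 3H≤5j using (c₁; c₂; 0≤c₁; 0≤c₂)
    open Positivity {+ b} {+ e} (0≤+ⁿ e) approx

    -- The lower bound that `Positivity` requires of m is K times this; K ≤ K₀ + 14 then gives m₀.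
    slope : ℤ
    slope = + 4 * v⁴ + + 4 * H⁴ + + 12

    0≤slope : 0ℤ ≤ slope
    0≤slope = 0≤+ (0≤+ (0≤* (0≤+ⁿ 4) 0≤v⁴) (0≤* (0≤+ⁿ 4) 0≤H⁴)) (0≤+ⁿ 12)

    module _ (K₀ m₀ : ℕ) (K₀≡ : + K₀ ≡ threshold) (m₀≡ : + m₀ ≡ (+ K₀ + + 14) * slope)
             {n : ℕ} (C : Code n) (sd : IsSelfDual C) (C? : ∀ x → Dec (C x)) (d : ℕ)
             (d≤ : ∀ x → C x → ¬ (x ≡ replicate n false) → d ℕ.≤ weight x) (N : ℕ) (n≡ : n ≡ double N)
             (N-large : 6 ℕ.* m₀ ℕ.+ 2 ℕ.≤ N) (an<db : a ℕ.* n ℕ.< d ℕ.* b) where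

      -- The equation N = 6m + 2 - K has to be solved with m even, so 6m moves in steps of 12 and K
      -- takes up the slack, with values from K₀ + 3 to K₀ + 14.
      r t K m : ℕ
      r = (N ℕ.+ K₀) / 12
      t = 12 ℕ.∸ (N ℕ.+ K₀) % 12
      K = K₀ ℕ.+ 2 ℕ.+ t
      m = double (suc r)

      t≡ : (N ℕ.+ K₀) % 12 ℕ.+ t ≡ 12
      t≡ = ℕₚ.m+[n∸m]≡n (ℕₚ.<⇒≤ (m%n<n (N ℕ.+ K₀) 12))

      N≡ : + N ≡ + 6 * + m + + 2 - + K
      N≡ = trans (lem₁ (+ N) (+ K₀) (+ t)) (trans (cong (λ z → z + + t - + K₀ - + t) sum≡) (trans (lem₂ (+ ((N ℕ.+ K₀) % 12)) (+ t) (+ r) (+ K₀))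
        (trans (cong (λ z → z + + 12 * + r - + K₀ - + t) (cong +_ t≡)) (trans (lem₃ (+ r) (+ K₀) (+ t)) (cong (λ z → + 6 * z + + 2 - + K) (sym (double-+ (suc r))))))))
        where
        sum≡ : + N + + K₀ ≡ + ((N ℕ.+ K₀) % 12) + + r * + 12
        sum≡ = trans (cong +_ (m≡m%n+[m/n]*n (N ℕ.+ K₀) 12)) (cong (λ z → + ((N ℕ.+ K₀) % 12) + z) (ℤₚ.pos-* r 12))
        lem₁ : ∀ N K t → N ≡ N + K + t - K - t
        lem₁ = solve-∀
        lem₂ : ∀ ρ t r K → ρ + r * + 12 + t - K - t ≡ ρ + t + + 12 * r - K - t
        lem₂ = solve-∀
        lem₃ : ∀ r K t → + 12 + + 12 * r - K - t ≡ + 6 * (+ 2 * (1ℤ + r)) + + 2 - (K + + 2 + t)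
        lem₃ = solve-∀

      K≤ : 0ℤ ≤ + K₀ + + 14 - + K
      K≤ = 0≤-by (≤⇒0≤ (+≤+ (ℕₚ.m∸n≤m 12 ((N ℕ.+ K₀) % 12)))) (lem (+ K₀) (+ t))
        where
        lem : ∀ K t → + 12 - t ≡ K + + 14 - (K + + 2 + t)
        lem = solve-∀

      K-large : 0ℤ ≤ + K - threshold
      K-large = subst (λ z → 0ℤ ≤ + K - z) K₀≡ (0≤-by (0≤+ (0≤+ⁿ 2) (0≤+ⁿ t)) (lem (+ K₀) (+ t)))
        where
        lem : ∀ K t → + 2 + t ≡ K + + 2 + t - K
        lem = solve-∀

      m₀≤m : 0ℤ ≤ + m - + m₀
      m₀≤m = 0≤-cancel {+ 6} (ℤ.+<+ (ℕ.s≤s ℕ.z≤n)) (0≤-by (0≤+ (≤⇒0≤ (+≤+ N-large)) (0≤+ⁿ K))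
        (trans (cong₂ (λ y z → y - z + + K) N≡ (cong (_+ + 2) (ℤₚ.pos-* 6 m₀))) (lem (+ m) (+ m₀) (+ K))))
        where
        lem : ∀ m m₀ K → + 6 * m + + 2 - K - (+ 6 * m₀ + + 2) + K ≡ + 6 * (m - m₀)
        lem = solve-∀

      m-large : 0ℤ ≤ + m - (+ 4 * (+ K * v⁴) + + 4 * (+ K * H⁴) + + 12 * + K)
      m-large = 0≤-by (0≤+ m₀≤m (0≤* K≤ 0≤slope)) (trans (cong (λ z → + m - z + (+ K₀ + + 14 - + K) * slope) m₀≡) (lem (+ m) (+ K₀) (+ K) v⁴ H⁴))
        where
        lem : ∀ m K₀ K x y → m - (K₀ + + 14) * (+ 4 * x + + 4 * y + + 12) + (K₀ + + 14 - K) * (+ 4 * x + + 4 * y + + 12)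
          ≡ m - (+ 4 * (K * x) + + 4 * (K * y) + + 12 * K)
        lem = solve-∀

      0≤q : 0ℤ ≤ + 2 * + m + + 3 - + K
      0≤q = 0≤-by (0≤+ (0≤+ m-large (0≤+ (0≤+ (0≤* (0≤+ⁿ 4) (0≤* (0≤+ⁿ K) 0≤v⁴)) (0≤* (0≤+ⁿ 4) (0≤* (0≤+ⁿ K) 0≤H⁴))) (0≤* (0≤+ⁿ 11) (0≤+ⁿ K)))) (0≤+ (0≤+ⁿ m) (0≤+ⁿ 3))) (lem (+ m) (+ K) v⁴ H⁴)
        where
        lem : ∀ m K x y → m - (+ 4 * (K * x) + + 4 * (K * y) + + 12 * K) + (+ 4 * (K * x) + + 4 * (K * y) + + 11 * K) + (m + + 3) ≡ + 2 * m + + 3 - K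
        lem = solve-∀

      Q′ : ℕ
      Q′ = double (suc m)

      odd : sgn (suc m) ≡ -1ℤ
      odd = cong -_ (even (suc r))
        where
        even : ∀ k → sgn (double k) ≡ 1ℤ
        even zero    = refl
        even (suc k) = trans (ℤₚ.neg-involutive _) (even k)

      b≤2a+e : b ℕ.≤ 2 ℕ.* a ℕ.+ e
      b≤2a+e = subst (λ z → b ℕ.≤ 2 ℕ.* a ℕ.+ z) (sym e≡) (ℕₚ.m≤n+m∸n b (2 ℕ.* a))

      -- The chain 2kb ≥ db > an = 2aN ≥ (b - e) N, multiplied by L.
      far : ∀ k → d ℕ.≤ double k → 0ℤ ≤ + 2 * + k * H - (H - ε) * (+ 6 * + m + + 2 - + K)
      far k d≤2k = 0≤-by
        (0≤* 0≤L (0≤+ (0≤+ (0≤* (0≤+ⁿ b) (≤⇒0≤ (+≤+ d≤2k))) (≤⇒0≤ (+≤+ (ℕₚ.<⇒≤ an<db)))) (0≤* (0≤+ⁿ N) (≤⇒0≤ (+≤+ b≤2a+e)))))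
        (trans (cong₂ (λ x y → L * (+ b * (x - + d) + y + + N * (+ (2 ℕ.* a) + + e - + b))) (double-+ k) (cong₂ _-_ (ℤₚ.pos-* d b) (trans (ℤₚ.pos-* a n) (cong (+ a *_) (trans (cong +_ n≡) (double-+ N))))))
          (trans (cong (λ z → L * (+ b * (+ 2 * + k - + d) + (+ d * + b - + a * (+ 2 * + N)) + + N * (z + + e - + b))) (ℤₚ.pos-* 2 a))
            (trans (lem L (+ a) (+ b) (+ d) (+ e) (+ k) (+ N))
              (cong₂ (λ y z → + 2 * + k * y - (y - ε) * z) (sym H≡) N≡))))
        where
        lem : ∀ L a b d e k N → L * (b * (+ 2 * k - d) + (d * b - a * (+ 2 * N)) + N * (+ 2 * a + e - b)) ≡ + 2 * k * (b * L) - (b * L - e * L) * N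
        lem = solve-∀

      module _ (q : ℕ) (q≡ : + q ≡ + 2 * + m + + 3 - + K) where

        q≤Q′ : q ℕ.≤ Q′
        q≤Q′ = ℤₚ.drop‿+≤+ (0≤⇒≤ (0≤-by (0≤+ (0≤+ (0≤+ⁿ K₀) (0≤+ⁿ t)) (0≤+ⁿ 1)) (trans (lem (+ m) (+ K₀) (+ t)) (sym (cong₂ _-_ (double-+ (suc m)) q≡)))))
          where
          lem : ∀ m K t → K + t + 1ℤ ≡ + 2 * (1ℤ + m) - (+ 2 * m + + 3 - (K + + 2 + t))
          lem = solve-∀

        G : ℤ
        G = + suc Q′ + + q

        sequence : Sequence (+ K) G (coeff (suc Q′) q)
        sequence = subst (λ z → Sequence z G (coeff (suc Q′) q))
          (trans (cong₂ (λ y z → 1ℤ + y - z) (double-+ (suc m)) q≡) (lem (+ m) (+ K))) (coeff-sequence Q′ q q≤Q′)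
          where
          lem : ∀ m K → 1ℤ + + 2 * (1ℤ + m) - (+ 2 * m + + 3 - K) ≡ K
          lem = solve-∀

        G≡ : G ≡ + 4 * + m + + 6 - + K
        G≡ = trans (cong₂ (λ y z → 1ℤ + y + z) (double-+ (suc m)) q≡) (lem (+ m) (+ K))
          where
          lem : ∀ m K → 1ℤ + + 2 * (1ℤ + m) + (+ 2 * m + + 3 - K) ≡ + 4 * m + + 6 - K
          lem = solve-∀

        N+1≡ : suc N ≡ q ℕ.+ 4 ℕ.* m
        N+1≡ = ℤₚ.+-injective (trans (cong (λ z → 1ℤ + z) N≡) (trans (lem (+ m) (+ K)) (sym (cong₂ _+_ q≡ (ℤₚ.pos-* 4 m)))))
          where
          lem : ∀ m K → 1ℤ + (+ 6 * m + + 2 - K) ≡ + 2 * m + + 3 - K + + 4 * m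
          lem = solve-∀

        impossible-for : ⊥
        impossible-for = contradiction (subst (0ℤ <_) (sym (kernel-half c₁ c₂ (suc m) q (suc m))) (positive-at-top sequence m G≡ K-large m-large)) nonneg
          where
          open SelfDual C sd C?
          open Contradiction c₁ c₂ 0≤c₁ 0≤c₂ m q N n≡ N+1≡ odd
          nonneg : ∀ c k → C c → ¬ (c ≡ 0ᵂ) → weight c ≡ double k → 0ℤ ≤ back k g (suc m)
          nonneg c k cc c≢0 w≡ = by-cases (back-cases k g (suc m))
            where
            by-cases : back k g (suc m) ≡ 0ℤ ⊎ (∃ λ s → k ℕ.+ s ≡ suc m × back k g (suc m) ≡ g s) → 0ℤ ≤ back k g (suc m)
            -- Words of weight above 2 (m + 1) do not reach the extracted coefficient at all.
            by-cases (inj₁ eq) = ℤₚ.≤-reflexive (sym eq)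
            by-cases (inj₂ (s , k+s≡ , eq)) = subst (0ℤ ≤_) (sym (trans eq (kernel-half c₁ c₂ (suc m) q s)))
              (ℤₚ.<⇒≤ (positive-below sequence m G≡ K-large m-large k s k+s≡ (far k (subst (d ℕ.≤_) w≡ (d≤ c cc c≢0)))))

      impossible : ⊥
      impossible = impossible-for (proj₁ (nonneg-nat 0≤q)) (proj₂ (nonneg-nat 0≤q))

  -- The final inequality between natural numbers is decidable, hence stable under double negation,
  -- so C may be treated as decidable while deriving the contradiction. The bound M is built from a
  -- and b alone, before any code is given.
  self-dual-bound : ∀ a b → 0 ℕ.< b → AboveBound a b → ∃ λ M → ∀ {n} (C : Code n) d → IsSelfDual C →
    (∀ x → C x → ¬ (x ≡ replicate n false) → d ℕ.≤ weight x) → M ℕ.≤ n → d ℕ.* b ℕ.≤ a ℕ.* n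
  self-dual-bound a b 0<b ab = construct (approximation b e (≤⇒0≤ (+≤+ 0<b)) (0≤-by (≤⇒0≤ (+≤+ (AboveBound⇒ {a} 0<b ab)))
      (trans (cong₂ (λ y z → y - (1ℤ + z)) (pos-fourth b) (trans (ℤₚ.pos-* 5 (e ℕ.^ 4)) (cong (+ 5 *_) (pos-fourth e)))) (lem (fourth (+ b)) (+ 5 * fourth (+ e))))))
    where
    e = b ℕ.∸ 2 ℕ.* a
    lem : ∀ x y → x - (1ℤ + y) ≡ x - y - 1ℤ
    lem = solve-∀
    construct : Approximation (+ b) (+ e) → _
    construct approx = constants (nonneg-nat (Positivity.0≤threshold (0≤+ⁿ e) approx))
      where
      constants : (∃ λ K₀ → + K₀ ≡ Positivity.threshold (0≤+ⁿ e) approx) → _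
      constants (K₀ , K₀≡) = finish (nonneg-nat (0≤* (0≤+ (0≤+ⁿ K₀) (0≤+ⁿ 14)) (0≤slope a b e refl approx)))
        where
        finish : (∃ λ m₀ → + m₀ ≡ (+ K₀ + + 14) * slope a b e refl approx) → _
        finish (m₀ , m₀≡) = 2 ℕ.* (6 ℕ.* m₀ ℕ.+ 2) , λ {n} C d sd d≤ n-large → decidable-stable (d ℕ.* b ℕₚ.≤? a ℕ.* n) λ ¬db≤an → ¬¬-decidable C λ C? →
          let N , n≡ = SelfDual.n-even C sd C? in
          impossible a b e refl approx K₀ m₀ K₀≡ m₀≡ C sd C? d d≤ N n≡
            (ℕₚ.*-cancelˡ-≤ 2 (subst (2 ℕ.* (6 ℕ.* m₀ ℕ.+ 2) ℕ.≤_) (trans n≡ (trans (double≡ N) (cong (N ℕ.+_) (sym (ℕₚ.+-identityʳ N))))) n-large)) (ℕₚ.≰⇒> ¬db≤an)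

open import Data.Nat using (ℕ; _*_; _≤_; _<_)
open import Data.Product using (Σ)

theorem6 : (n : ℕ → ℕ) (C : (i : ℕ) → Code (n i)) (d : ℕ → ℕ)
    → (∀ i → IsSelfDual (C i))
    → (∀ i → IsMinDist (C i) (d i))
    → (∀ M → Σ ℕ λ N → ∀ i → N ≤ i → M ≤ n i)
    → ∀ a b → 0 < b → AboveBound a b
    → Σ ℕ λ N → ∀ i → N ≤ i → d i * b ≤ a * n i
theorem6 n C d sd md n→∞ a b 0<b ab = let M , bound = Bound.self-dual-bound a b 0<b ab ; N , large = n→∞ M in
  N , λ i N≤i → bound (C i) (d i) (sd i) (proj₂ (md i)) (large i N≤i)
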